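{- For any integers $k\geq 3$ and $a\geq 0$, the Kneser graph $K(2k+2^a,k)$ has a Hamilton cycle.
   Context: For integers $k\geq 1$ and $n\geq 2k+1$, the Kneser graph $K(n,k)$ is the graph whose vertices are the $k$-element subsets of $[n]=\{1,\ldots,n\}$, two subsets being adjacent if and only if they are disjoint. -}

module Defs where

open import Data.Nat using (ℕ; suc; _+_; _*_; _^_; _≥_)
open import Data.Fin using (Fin)
open import Data.Fin.Subset using (Subset; ∣_∣; _∩_; Empty)
open import Data.Product using (Σ; _×_; _,_; proj₁)
open import Data.List using (List; []; _∷_; length)
open import Data.List.Membership.Propositional using (_∈_)
open import Data.List.Relation.Unary.Unique.Propositional using (Unique)
open import Relation.Binary.PropositionalEquality using (_≡_)

record Graph : Set₁ where
  field
    Vertex : Set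
    Adj    : Vertex → Vertex → Set
open Graph public

KVertex : ℕ → ℕ → Set
KVertex n k = Σ (Subset n) (λ s → ∣ s ∣ ≡ k)

Kneser : ℕ → ℕ → Graph
Kneser n k = record
  { Vertex = KVertex n k
  ; Adj    = λ u v → Empty (proj₁ u ∩ proj₁ v) }

data Path (G : Graph) : List (Vertex G) → Set where
  []  : Path G []
  [_] : ∀ v → Path G (v ∷ [])
  _∷_ : ∀ {u v vs} → Adj G u v → Path G (v ∷ vs) → Path G (u ∷ v ∷ vs)

lastOf : {A : Set} → A → List A → A
lastOf x []       = x
lastOf _ (y ∷ ys) = lastOf y ys

record HamiltonCycle (G : Graph) : Set where
  field
    start    : Vertex G
    rest     : List (Vertex G)
    long     : length (start ∷ rest) ≥ 3
    distinct : Unique (start ∷ rest)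
    spanning : ∀ (v : Vertex G) → v ∈ (start ∷ rest)
    path     : Path G (start ∷ rest)
    closing  : Adj G (lastOf start rest) start

-- Words over Bool stand for subsets.  The proof is an induction on a.
--
-- Odd graphs K(2k+1,k), k ≥ 3.  The vertices are partitioned into cycles of length 2k+1, one for each
-- Dyck word of length 2k (a binary tree with k nodes, Dy), by rotating through the points of its
-- lattice path (Pt).  Cycles of different words are glued along 6-cycles and 8-cycles of the graph,
-- each of which meets every cycle involved in one edge; the gluings form a hypertree, which is built
-- recursively: all words not starting with 10 are attached to those that do (ROp), the words with
-- a single component being inserted into one edge (QOp).
--
-- From K(2j+s,j) for all j to K(2r+2s,r).  Group the 2(r+s) points into pairs: a pair is a bit if
-- the set contains one of its points, and a slot, full or empty, otherwise.  If j slots are full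
-- then j+s are empty, so the slots carry a vertex of K(2j+s,j).  The map f that complements all
-- bits and advances the slots along a Hamilton cycle of K(2j+s,j) permutes the vertices and moves
-- every vertex to a neighbour.  A slot that is empty before and after the step is free; vertices
-- that differ only by exchanging free slots with suitable bits can exchange their images, which
-- merges their f-orbits, and levels j+1 and j are joined by 3-cycles x₁ ↦ f x₂, x₂ ↦ f x₃,
-- x₃ ↦ f x₁.  The only gap is the Petersen graph K(5,2), where two pentagons replace the Hamilton
-- cycle and a second family of 3-cycles joins the second pentagon.
module Submission where

open import Defs
open import Data.Bool using (Bool; true; false; _∧_; not)
open import Data.Bool.Properties using (not-involutive; ∧-comm; ∧-zeroʳ; ∧-inverseʳ) renaming (_≟_ to _≟ᵇ_)
open import Data.Empty using (⊥; ⊥-elim)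
open import Data.Fin using (zero; suc; #_)
import Data.Fin.Subset as S
open import Data.List using (List; []; _∷_; _++_; length; map; reverse; concat; concatMap; filter; cartesianProductWith; initLast; _∷ʳ′_; replicate; zip; drop)
open import Data.List.Properties using (++-assoc; ++-identityʳ; length-++; length-map; length-replicate; length-reverse; map-++; concat-++; concatMap-++; concatMap-map; reverse-++; reverse-involutive; reverse-map; unfold-reverse; ∷-injective; ∷-injectiveʳ; ∷ʳ-injectiveˡ; ∷ʳ-injectiveʳ; ≡-dec)
open import Data.List.Membership.Propositional using (_∈_; lose; find)
open import Data.List.Membership.Propositional.Properties using (∈-map⁺; ∈-map⁻; ∈-++⁺ˡ; ∈-++⁺ʳ; ∈-++⁻; ∈-∃++; ∈-concat⁺′; ∈-concat⁻′; ∈-filter⁺; ∈-filter⁻; ∈-cartesianProductWith⁺; ∈-cartesianProductWith⁻)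
open import Data.List.Membership.Propositional.Properties.WithK using (unique∧set⇒bag)
open import Data.List.Relation.Binary.BagAndSetEquality using (∼bag⇒↭)
open import Data.List.Relation.Binary.Permutation.Propositional using (_↭_; ↭⇒↭ₛ; ↭-refl; ↭-sym; ↭-trans; ↭-reflexive; prep; swap)
open import Data.List.Relation.Binary.Permutation.Propositional.Properties using (∈-resp-↭; shift; shifts; drop-∷; ++⁺ˡ; ++⁺ʳ; ++⁺; ++-comm; ↭-reverse; ↭-length; ++-commutativeMonoid) renaming (map⁺ to ↭-map)
import Data.List.Relation.Binary.Permutation.Setoid.Properties as PS
open import Data.List.Relation.Binary.Pointwise using (Pointwise; []; _∷_)
open import Data.List.Relation.Unary.All using (All; []; _∷_)
import Data.List.Relation.Unary.All as All
import Data.List.Relation.Unary.All.Properties as AllP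
open import Data.List.Relation.Unary.Any using (Any; here; there; any?)
open import Data.List.Relation.Unary.Unique.Propositional using (Unique; []; _∷_)
import Data.List.Relation.Unary.Unique.Propositional.Properties as UP
open import Data.Maybe using (Maybe; just; nothing)
import Data.Maybe as Maybe
import Data.Maybe.Properties as Maybeₚ
open import Data.Nat using (ℕ; zero; suc; _+_; _*_; _∸_; _^_; _≤_; _<_; _≥_; _≤?_; z≤n; s≤s; pred)
import Data.Nat.Properties as ℕₚ
open import Data.Nat.Solver using (module +-*-Solver)
open import Data.Product using (Σ; ∃; ∃₂; _×_; _,_; proj₁; proj₂)
import Data.Product.Properties as Prodₚ
open import Data.Sum using (_⊎_; inj₁; inj₂)
import Data.Sum.Properties as Sumₚ
open import Data.Unit using (⊤; tt)
open import Data.Vec using (Vec; []; _∷_; toList)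
open import Function.Bundles using (mk⇔)
open import Relation.Binary using (DecidableEquality)
open import Relation.Binary.PropositionalEquality hiding ([_])
open import Relation.Nullary using (¬_; Dec; yes; no)

-- The doubling takes s to 2s, starting from s = 1; this is where the powers of 2 come from. Two
-- vertices may exchange images if filling their free slots with bits yields the same string of
-- bits, F and G: an empty slot is disjoint from anything, and equal bits become opposite. Such a
-- string determines the number of F, so exchanges never leave a level, and links of another kind
-- are needed between levels. A linking vertex is lost for exchanges, since its image is already
-- changed; hence the triples are chosen so that no vertex at which an exchange is made is linking.
-- Another obstacle is parity: the bits change at every step, so exchanging a slot with a bit
-- requires a time at which the slot is free and the bit has the value used for filling. In the odd
-- graphs an edge can serve for one gluing only. Each operation of the recursion therefore states
-- which edges it may use up and which it hands on. It acts inside a context, a fixed surrounding of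
-- a smaller word, so that gluing cycles found on short words serve for all sizes.

module Walks where

  -- Walks and Hamilton cycles as lists.

  private variable
    A B : Set
    R R′ : A → A → Set
    a b c d x : A
    xs ys zs : List A

  data Walk {A : Set} (R : A → A → Set) : A → A → List A → Set where
    ∎_  : ∀ a → Walk R a a (a ∷ [])
    _∷_ : ∀ {a b c xs} → R a b → Walk R b c xs → Walk R a c (a ∷ xs)

  _⟨_⟩_ : Walk R a b xs → R b c → Walk R c d ys → Walk R a d (xs ++ ys)
  (∎ _)   ⟨ r ⟩ w = r ∷ w
  (s ∷ v) ⟨ r ⟩ w = s ∷ (v ⟨ r ⟩ w)

  reverseW : ∀ {A : Set} {R : A → A → Set} {a b xs} → (∀ {x y} → R x y → R y x) → Walk R a b xs → Walk R b a (reverse xs)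
  reverseW s (∎ a) = ∎ a
  reverseW {R = R} {b = b} s (_∷_ {a = a} {xs = xs} r w) =
    subst (Walk R b a) (sym (unfold-reverse a xs)) (reverseW s w ⟨ s r ⟩ (∎ a))

  first∈ : Walk R a b xs → a ∈ xs
  first∈ (∎ _)   = here refl
  first∈ (_ ∷ _) = here refl

  last∈ : Walk R a b xs → b ∈ xs
  last∈ (∎ _)   = here refl
  last∈ (_ ∷ w) = there (last∈ w)

  mapW : (∀ {u v} → u ∈ xs → R u v → R′ u v) → Walk R a b xs → Walk R′ a b xs
  mapW f (∎ a)   = ∎ a
  mapW f (r ∷ w) = f (here refl) r ∷ mapW (λ i → f (there i)) w

  splitW : x ∈ xs → Walk R a b xs → ∃ λ ps → Walk R a x ps ×
           (x ≡ b × ps ≡ xs ⊎ ∃₂ λ y qs → R x y × Walk R y b qs × xs ≡ ps ++ qs)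
  splitW (here refl) (∎ _)   = _ , ∎ _ , inj₁ (refl , refl)
  splitW (here refl) (r ∷ w) = _ , ∎ _ , inj₂ (_ , _ , r , w , refl)
  splitW (there i)   (r ∷ w) with splitW i w
  ... | ps , v , inj₁ (refl , refl)           = _ , r ∷ v , inj₁ (refl , refl)
  ... | ps , v , inj₂ (y , qs , s , u , refl) = _ , r ∷ v , inj₂ (y , qs , s , u , refl)

  -- A single vertex with a loop counts as a cycle, as fixed points of a permutation must.
  Cyc : (A → A → Set) → List A → Set
  Cyc R xs = ∃₂ λ a b → Walk R a b xs × R b a

  -- Cutting behind `x` puts its successor first, so that exchanging the successors of two vertices
  -- becomes a concatenation of walks.
  rotate : x ∈ xs → Cyc R xs → ∃₂ λ a ys → Walk R a x ys × R x a × ys ↭ xs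
  rotate i (a , b , w , r) with splitW i w
  ... | ps , v , inj₁ (refl , refl)           = a , ps , v , r , ↭-refl
  ... | ps , v , inj₂ (y , qs , s , u , refl) = y , qs ++ ps , u ⟨ r ⟩ v , s , ++-comm qs ps

  Unique-↭ : ∀ {A : Set} {xs ys : List A} → xs ↭ ys → Unique xs → Unique ys
  Unique-↭ {A = A} p u = PS.Unique-resp-↭ (setoid A) (↭⇒↭ₛ p) u

  Unique-++⁻ : ∀ (xs : List A) {ys} → Unique (xs ++ ys) → Unique xs × Unique ys × (∀ {z} → z ∈ xs → z ∈ ys → ⊥)
  Unique-++⁻ []       u       = [] , u , λ ()
  Unique-++⁻ (x ∷ xs) (p ∷ u) with Unique-++⁻ xs u
  ... | u₁ , u₂ , dis = (All.tabulate (λ i → All.lookup p (∈-++⁺ˡ i)) ∷ u₁) , u₂ ,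
        λ { (here refl) j → All.lookup p (∈-++⁺ʳ xs j) refl ; (there i) j → dis i j }

  record Ham {A : Set} (P : A → Set) (R : A → A → Set) : Set where
    field
      verts : List A
      cyc   : Cyc R verts
      uniq  : Unique verts
      sound : ∀ {a} → a ∈ verts → P a
      full  : ∀ {a} → P a → a ∈ verts

  module _ {P : A → Set} {R : A → A → Set} (to : B → A) (P-to : ∀ b → P (to b))
           (from : ∀ a → P a → B) (to-from : ∀ a p → to (from a p) ≡ a)
           (to-inj : ∀ {b c} → to b ≡ to c → b ≡ c) where

    private
      pull : ∀ xs → (∀ {a} → a ∈ xs → P a) → Σ (List B) λ ys → map to ys ≡ xs
      pull []       p = [] , refl
      pull (x ∷ xs) p with pull xs (λ i → p (there i))
      ... | ys , refl = from x (p (here refl)) ∷ ys , cong (_∷ map to ys) (to-from x _)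

      pullW : ∀ ys {a b} → Walk R a b (map to ys) →
              ∃₂ λ u v → to u ≡ a × to v ≡ b × Walk (λ x y → R (to x) (to y)) u v ys
      pullW (y ∷ [])     (∎ _)   = y , y , refl , refl , ∎ y
      pullW (y ∷ z ∷ ys) (r ∷ w) with pullW (z ∷ ys) w
      ... | u , v , eu , refl , w′ with to-inj {u} {z} (trans eu (fst w))
        where fst : ∀ {a b x xs} → Walk R a b (x ∷ xs) → a ≡ x
              fst (∎ _)   = refl
              fst (_ ∷ _) = refl
      ... | refl = y , v , refl , refl , subst (R (to y)) (sym eu) r ∷ w′

    -- The vertices of `Kneser n k` carry proofs, while `Ham` is used on plain words; an injection
    -- with an inverse on `P` is enough to pull the cycle back.
    transport : Ham P R → Ham (λ (_ : B) → ⊤) (λ x y → R (to x) (to y))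
    transport h with Ham.verts h | Ham.cyc h | Ham.uniq h | Ham.full h | pull _ (Ham.sound h)
    ... | _ | a , b , w , r | u | fl | ys , refl with pullW ys w
    ...   | p , q , refl , refl , w′ = record
      { verts = ys ; cyc = p , q , w′ , r ; uniq = UP.map⁻ u ; sound = λ _ → tt
      ; full = λ {b} _ → back (fl (P-to b)) }
      where
      back : ∀ {b} → to b ∈ map to ys → b ∈ ys
      back i with ∈-map⁻ to i
      ... | c , j , e = subst (_∈ ys) (sym (to-inj e)) j

  -- Subsets as words, and the passage to `Kneser n k`.

  Word : Set
  Word = List Bool

  ones : Word → ℕ
  ones []          = 0
  ones (true ∷ w)  = suc (ones w)
  ones (false ∷ w) = ones w

  IsW : ℕ → ℕ → Word → Set
  IsW n k w = length w ≡ n × ones w ≡ k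

  infixr 5 _∷_
  data _⊥ʷ_ : Word → Word → Set where
    []  : [] ⊥ʷ []
    _∷_ : ∀ {a b v w} → a ∧ b ≡ false → v ⊥ʷ w → (a ∷ v) ⊥ʷ (b ∷ w)

  HamK : ℕ → ℕ → Set
  HamK n k = Ham (IsW n k) _⊥ʷ_

  private
    card : ∀ {n} (s : S.Subset n) → S.∣ s ∣ ≡ ones (toList s)
    card []          = refl
    card (true ∷ s)  = cong suc (card s)
    card (false ∷ s) = card s

    vec : ∀ n (w : Word) → length w ≡ n → Σ (S.Subset n) λ s → toList s ≡ w
    vec zero    []      _ = [] , refl
    vec (suc n) (b ∷ w) e with vec n w (ℕₚ.suc-injective e)
    ... | s , refl = b ∷ s , refl

    tl-inj : ∀ {n} (s t : S.Subset n) → toList s ≡ toList t → s ≡ t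
    tl-inj []      []       _    = refl
    tl-inj (x ∷ s) (y ∷ t) e with Data.List.Properties.∷-injective e
    ... | refl , e′ = cong (x ∷_) (tl-inj s t e′)

    tl-len : ∀ {n} (s : S.Subset n) → length (toList s) ≡ n
    tl-len []      = refl
    tl-len (_ ∷ s) = cong suc (tl-len s)

    disj : ∀ {n} (s t : S.Subset n) → toList s ⊥ʷ toList t → S.Empty (s S.∩ t)
    disj (true ∷ s)  (true ∷ t)  (() ∷ d)
    disj (true ∷ s)  (false ∷ t) (_ ∷ d) (suc i , Data.Vec.there p) = disj s t d (i , p)
    disj (false ∷ s) (true ∷ t)  (_ ∷ d) (suc i , Data.Vec.there p) = disj s t d (i , p)
    disj (false ∷ s) (false ∷ t) (_ ∷ d) (suc i , Data.Vec.there p) = disj s t d (i , p)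

    rest≥ : ∀ {x y z : A} (xs : List A) → x ∈ xs → y ∈ xs → z ∈ xs → x ≢ y → x ≢ z → y ≢ z → length xs ≥ 3
    rest≥ (_ ∷ _ ∷ _ ∷ _) _ _ _ _ _ _ = s≤s (s≤s (s≤s z≤n))
    rest≥ (_ ∷ []) (here refl) (here refl) _ p _ _ = ⊥-elim (p refl)
    rest≥ (_ ∷ _ ∷ []) (here refl) (here refl) _ p _ _ = ⊥-elim (p refl)
    rest≥ (_ ∷ _ ∷ []) (here refl) (there (here refl)) (here refl) _ q _ = ⊥-elim (q refl)
    rest≥ (_ ∷ _ ∷ []) (here refl) (there (here refl)) (there (here refl)) _ _ r = ⊥-elim (r refl)
    rest≥ (_ ∷ _ ∷ []) (there (here refl)) (here refl) (here refl) _ _ r = ⊥-elim (r refl)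
    rest≥ (_ ∷ _ ∷ []) (there (here refl)) (here refl) (there (here refl)) _ q _ = ⊥-elim (q refl)
    rest≥ (_ ∷ _ ∷ []) (there (here refl)) (there (here refl)) _ p _ _ = ⊥-elim (p refl)

    module _ {G : Graph} where
      pathOf : ∀ {a b xs} → Walk (Adj G) a b xs → Path G xs
      pathOf (∎ a)         = [ a ]
      pathOf (r ∷ ∎ b)     = r ∷ [ b ]
      pathOf (r ∷ (s ∷ w)) = r ∷ pathOf (s ∷ w)

      lastOf-W : ∀ {a b x xs} → Walk (Adj G) a b (x ∷ xs) → a ≡ x × lastOf x xs ≡ b
      lastOf-W (∎ a)                = refl , refl
      lastOf-W (r ∷ w@(∎ _))        = refl , refl
      lastOf-W (r ∷ w@(_ ∷ _))      = refl , proj₂ (lastOf-W w)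

  -- A `Ham` may have only one or two vertices; the three distinct words are there to provide
  -- `long`.
  hamiltonCycle : ∀ n k {u v w} → IsW n k u → IsW n k v → IsW n k w → u ≢ v → u ≢ w → v ≢ w →
                  HamK n k → HamiltonCycle (Kneser n k)
  hamiltonCycle n k {u} {v} {w} pu pv pw u≢v u≢w v≢w h = go (Ham.verts H) (Ham.cyc H) (Ham.uniq H) (λ a → Ham.full H {a} tt)
    where
    from : ∀ w → IsW n k w → KVertex n k
    from w (p , q) with vec n w p
    ... | s , refl = s , trans (card s) q

    to : KVertex n k → Word
    to (s , _) = toList s

    to-from : ∀ w p → to (from w p) ≡ w
    to-from w (p , q) with vec n w p
    ... | s , refl = refl

    to-inj : ∀ {b c} → to b ≡ to c → b ≡ c
    to-inj {s , p} {t , q} e with tl-inj s t e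
    ... | refl = cong (s ,_) (ℕₚ.≡-irrelevant p q)

    H : Ham (λ (_ : KVertex n k) → ⊤) (λ x y → to x ⊥ʷ to y)
    H = transport to (λ { (s , p) → tl-len s , trans (sym (card s)) p }) from to-from to-inj h

    neq : ∀ {x y} (p : IsW n k x) (q : IsW n k y) → x ≢ y → from x p ≢ from y q
    neq p q ne e = ne (trans (sym (to-from _ p)) (trans (cong to e) (to-from _ q)))

    go : ∀ xs → Cyc (λ x y → to x ⊥ʷ to y) xs → Unique xs → (∀ a → a ∈ xs) → HamiltonCycle (Kneser n k)
    go (x ∷ xs) (a , b , w , r) un fl with lastOf-W {Kneser n k} (mapW (λ {u} {v} _ → disj (proj₁ u) (proj₁ v)) w)
    ... | refl , e = record
      { start = x ; rest = xs
      ; long = rest≥ (x ∷ xs) (fl (from _ pu)) (fl (from _ pv)) (fl (from _ pw)) (neq pu pv u≢v) (neq pu pw u≢w) (neq pv pw v≢w)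
      ; distinct = un ; spanning = fl
      ; path = pathOf (mapW (λ {u} {v} _ → disj (proj₁ u) (proj₁ v)) w)
      ; closing = subst (λ z → S.Empty (proj₁ z S.∩ proj₁ x)) (sym e) (disj (proj₁ b) (proj₁ x) r) }

  mapHam : ∀ {A B : Set} {P : A → Set} {Q : B → Set} {R : A → A → Set} {R′ : B → B → Set} (f : A → B) →
           (∀ {a} → P a → Q (f a)) → (∀ {a c} → P a → P c → f a ≡ f c → a ≡ c) →
           (∀ {b} → Q b → ∃ λ a → P a × f a ≡ b) → (∀ {a c} → P a → P c → R a c → R′ (f a) (f c)) →
           Ham P R → Ham Q R′
  mapHam {A} {B} {P} {Q} {R} {R′} f PQ inj sur adj h = record
    { verts = map f verts ; cyc = walk (proj₂ (proj₂ cyc)) ; uniq = un verts sound uniq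
    ; sound = λ i → snd (∈-map⁻ f i) ; full = λ q → fl (sur q) }
    where
    open Ham h
    mw : ∀ {a b xs} → (∀ {x} → x ∈ xs → P x) → Walk R a b xs → Walk R′ (f a) (f b) (map f xs)
    mw s (∎ a)   = ∎ (f a)
    mw s (r ∷ w) = adj (s (here refl)) (s (there (first∈ w))) r ∷ mw (λ i → s (there i)) w
    walk : ∀ {a b} → Walk R a b verts × R b a → Cyc R′ (map f verts)
    walk (w , r) = _ , _ , mw sound w , adj (sound (last∈ w)) (sound (first∈ w)) r
    un : ∀ xs → (∀ {x} → x ∈ xs → P x) → Unique xs → Unique (map f xs)
    un []       s []      = []
    un (x ∷ xs) s (n ∷ u) = All.tabulate (λ i → ne (∈-map⁻ f i)) ∷ un xs (λ i → s (there i)) u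
      where
      ne : ∀ {y} → (∃ λ z → z ∈ xs × y ≡ f z) → f x ≢ y
      ne (z , i , refl) e = All.lookup n i (inj (s (here refl)) (s (there i)) e)
    snd : ∀ {b} → (∃ λ a → a ∈ verts × b ≡ f a) → Q b
    snd (a , i , refl) = PQ (sound i)
    fl : ∀ {b} → (∃ λ a → P a × f a ≡ b) → b ∈ map f verts
    fl (a , p , refl) = ∈-map⁺ f (full p)

open Walks

-- Cycle decomposition of a permutation, and merging of its cycles.

module Cycles where

  module Orbits {A : Set} (_≟_ : DecidableEquality A) where

    Edge : List (A × A) → A → A → Set
    Edge es x y = (x , y) ∈ es

    functional : ∀ {x y z} {es : List (A × A)} → Unique (map proj₁ es) → (x , y) ∈ es → (x , z) ∈ es → y ≡ z
    functional (p ∷ u) (here refl) (here refl) = refl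
    functional (p ∷ u) (here refl) (there j)   = ⊥-elim (All.lookup p (∈-map⁺ proj₁ j) refl)
    functional (p ∷ u) (there i)   (here refl) = ⊥-elim (All.lookup p (∈-map⁺ proj₁ i) refl)
    functional (p ∷ u) (there i)   (there j)   = functional u i j

    private
      -- In a walk without repetition the last vertex is the source of no edge, so edges leaving it
      -- may be lost. In `orbits` the lost edge is the shortcut.
      mapLast : ∀ {R R′ : A → A → Set} {a b xs} → Unique xs → (∀ {u v} → u ≢ b → R u v → R′ u v) →
                Walk R a b xs → Walk R′ a b xs
      mapLast u       f (∎ a)   = ∎ a
      mapLast (p ∷ u) f (r ∷ w) = f (All.lookup p (last∈ w)) r ∷ mapLast u f w

      pick : ∀ {x} {cs : List (List A)} → x ∈ concat cs → ∃ λ c → ∃₂ λ as bs → cs ≡ as ++ c ∷ bs × x ∈ c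
      pick {cs = cs} i with ∈-concat⁻′ cs i
      ... | c , j , k with ∈-∃++ k
      ... | as , bs , e = c , as , bs , e , j

    -- Shortcut the first edge x → y to w → y, where w → x, and put x back between w and y afterwards.
    orbits : ∀ n es → length es ≡ n → Unique (map proj₁ es) → map proj₂ es ↭ map proj₁ es →
             ∃ λ cs → All (Cyc (Edge es)) cs × concat cs ↭ map proj₁ es
    orbits zero    []             _ _ _ = [] , [] , ↭-refl
    orbits (suc n) ((x , y) ∷ es) e (nx ∷ u) p with x ≟ y
    ... | yes refl with orbits n es (ℕₚ.suc-injective e) u (drop-∷ p)
    ...   | cs , ok , q = (x ∷ []) ∷ cs , (x , x , ∎ x , here refl) ∷ All.map weaken ok , prep x q
      where
      weaken : ∀ {c} → Cyc (Edge es) c → Cyc (Edge ((x , x) ∷ es)) c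
      weaken (a , b , w , r) = a , b , mapW (λ _ → there) w , there r
    orbits (suc n) ((x , y) ∷ es) e (nx ∷ u) p | no x≢y with ∈-map⁻ proj₂ (tail (∈-resp-↭ (↭-sym p) (here refl)))
      where
      tail : ∀ {zs} → x ∈ y ∷ zs → x ∈ zs
      tail (here e)  = ⊥-elim (x≢y e)
      tail (there i) = i
    ... | (w , .x) , i , refl with ∈-∃++ i
    ... | as , bs , refl = build (orbits n es₁ len u₁ p₁)
      where
      es₁ = as ++ (w , y) ∷ bs
      fst≡ : map proj₁ es₁ ≡ map proj₁ (as ++ (w , x) ∷ bs)
      fst≡ = trans (map-++ proj₁ as _) (sym (map-++ proj₁ as _))
      len : length es₁ ≡ n
      len = trans (trans (length-++ as) (sym (length-++ as))) (ℕₚ.suc-injective e)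
      u₁ : Unique (map proj₁ es₁)
      u₁ = subst Unique (sym fst≡) u
      q₁ : x ∷ (map proj₂ as ++ y ∷ map proj₂ bs) ↭ x ∷ map proj₁ (as ++ (w , x) ∷ bs)
      q₁ = ↭-trans (prep x (shift y _ _)) (↭-trans (swap x y ↭-refl)
            (↭-trans (prep y (↭-trans (↭-sym (shift x (map proj₂ as) (map proj₂ bs))) (↭-reflexive (sym (map-++ proj₂ as _))))) p))
      p₁ : map proj₂ es₁ ↭ map proj₁ es₁
      p₁ = ↭-trans (↭-reflexive (map-++ proj₂ as _)) (↭-trans (drop-∷ q₁) (↭-reflexive (sym fst≡)))
      old : ∀ {u v} → u ≢ w → Edge es₁ u v → Edge ((x , y) ∷ as ++ (w , x) ∷ bs) u v
      old ne j with ∈-++⁻ as j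
      ... | inj₁ k           = there (∈-++⁺ˡ k)
      ... | inj₂ (here refl) = ⊥-elim (ne refl)
      ... | inj₂ (there k)   = there (∈-++⁺ʳ as (there k))
      build : (∃ λ cs → All (Cyc (Edge es₁)) cs × concat cs ↭ map proj₁ es₁) →
              ∃ λ cs → All (Cyc (Edge ((x , y) ∷ as ++ (w , x) ∷ bs))) cs × concat cs ↭ x ∷ map proj₁ (as ++ (w , x) ∷ bs)
      build (cs , ok , q) with pick {cs = cs} (∈-resp-↭ (↭-sym q) (subst (w ∈_) (sym fst≡) (∈-map⁺ proj₁ i)))
      ... | c , ds , fs , refl , j with AllP.++⁻ ds ok
      ...   | ok₁ , okc ∷ ok₂ with rotate j okc
      ...     | z , c′ , wk , r , pc = (x ∷ c′) ∷ ds ++ fs ,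
                (x , w , here (cong (x ,_) z≡y) ∷ mapLast uc′ old wk , there i) ∷ AllP.++⁺ (all ds ok₁ λ k → dis₁ k) (all fs ok₂ dis₂) ,
                prep x (↭-trans (++⁺ʳ _ pc) (↭-trans pm (↭-trans q (↭-reflexive fst≡))))
        where
        z≡y : z ≡ y
        z≡y = functional u₁ r (∈-++⁺ʳ as (here refl))
        split : concat (ds ++ c ∷ fs) ≡ concat ds ++ c ++ concat fs
        split = sym (concat-++ ds (c ∷ fs))
        uniq : Unique (concat ds ++ c ++ concat fs)
        uniq = subst Unique split (Unique-↭ (↭-sym q) u₁)
        uc : Unique c
        uc = proj₁ (Unique-++⁻ c (proj₁ (proj₂ (Unique-++⁻ (concat ds) uniq))))
        uc′ : Unique c′
        uc′ = Unique-↭ (↭-sym pc) uc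
        pm : c ++ concat (ds ++ fs) ↭ concat (ds ++ c ∷ fs)
        pm = ↭-trans (++⁺ˡ c (↭-reflexive (sym (concat-++ ds fs))))
               (↭-trans (shifts c (concat ds)) (↭-reflexive (sym split)))
        dis₁ : ∀ {d} → d ∈ ds → w ∈ d → ⊥
        dis₁ k l = proj₂ (proj₂ (Unique-++⁻ (concat ds) uniq)) (∈-concat⁺′ l k) (∈-++⁺ˡ j)
        dis₂ : ∀ {d} → d ∈ fs → w ∈ d → ⊥
        dis₂ k l = proj₂ (proj₂ (Unique-++⁻ c (proj₁ (proj₂ (Unique-++⁻ (concat ds) uniq))))) j (∈-concat⁺′ l k)
        all : ∀ ds → All (Cyc (Edge es₁)) ds → (∀ {d} → d ∈ ds → w ∈ d → ⊥) →
              All (Cyc (Edge ((x , y) ∷ as ++ (w , x) ∷ bs))) ds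
        all []       []                    _   = []
        all (d ∷ ds) ((a , b , v , s) ∷ k) dis =
          (a , b , mapW (λ i → old (λ { refl → dis (here refl) i })) v , old (λ { refl → dis (here refl) (last∈ v) }) s)
          ∷ all ds k (λ i → dis (there i))

  module Merging {A K : Set} (_≟ᴷ_ : DecidableEquality K) (κ : A → K) (R : A → A → Set)
                 (inv : ∀ {x y z} → κ x ≡ κ y → R x z → R y z) where

    -- Connectivity as an induction principle: a predicate that respects cycles and keys separates
    -- no two vertices. `merge` applies it to membership in one cycle.
    Conn : List (List A) → Set₁
    Conn cs = (S : A → Set) → (∀ {c x y} → c ∈ cs → x ∈ c → y ∈ c → S x → S y) →
              (∀ {x y} → x ∈ concat cs → y ∈ concat cs → κ x ≡ κ y → S x → S y) →
              ∀ {x y} → x ∈ concat cs → y ∈ concat cs → S x → S y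

    -- By `inv`, vertices with equal keys are interchangeable as sources: either walk may continue
    -- with the successor that belongs to the other one.
    joinC : ∀ {c d x y} → Cyc R c → Cyc R d → x ∈ c → y ∈ d → κ x ≡ κ y → ∃ λ f → Cyc R f × f ↭ c ++ d
    joinC c d i j e with rotate i c | rotate j d
    ... | a , c′ , v , r , p | b , d′ , w , s , q =
      c′ ++ d′ , (a , _ , v ⟨ inv (sym e) s ⟩ w , inv e r) , ++⁺ p q

    -- If no other cycle shares a key with `c`, membership in `c` respects cycles and keys and
    -- contradicts `Conn`; otherwise `joinC` absorbs one cycle and the connectivity is inherited.
    merge : ∀ n c cs → length cs ≡ n → All (Cyc R) (c ∷ cs) → Conn (c ∷ cs) → ∃ λ d → Cyc R d × d ↭ concat (c ∷ cs)
    merge n       c []       _ (k ∷ [])  _    = c , k , ↭-sym (↭-trans (↭-reflexive refl) (++-identityʳ′ c))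
      where
      ++-identityʳ′ : ∀ (c : List A) → c ++ [] ↭ c
      ++-identityʳ′ []      = ↭-refl
      ++-identityʳ′ (x ∷ c) = prep x (++-identityʳ′ c)
    merge (suc n) c (b ∷ cs) e (kc ∷ ks) conn with any? (λ d → any? (λ x → any? (λ y → κ x ≟ᴷ κ y) d) c) (b ∷ cs)
    ... | no none = ⊥-elim (none (here (lose y∈c (lose y∈b refl))))
      where
      y∈b : proj₁ (All.head ks) ∈ b
      y∈b = first∈ (proj₁ (proj₂ (proj₂ (All.head ks))))
      out : ∀ {x y d} → x ∈ c → d ∈ b ∷ cs → y ∈ d → κ x ≡ κ y → ⊥
      out i j k e = none (lose j (lose i (lose k e)))
      y∈c : proj₁ (All.head ks) ∈ c
      y∈c = conn (_∈ c)
        (λ { (here refl) i j _ → j ; (there k) i j s → ⊥-elim (out s k i refl) })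
        (λ { {x} {y} i j e s → closed j e s })
        (∈-++⁺ˡ (first∈ (proj₁ (proj₂ (proj₂ kc))))) (∈-++⁺ʳ c (∈-++⁺ˡ y∈b)) (first∈ (proj₁ (proj₂ (proj₂ kc))))
        where
        closed : ∀ {x y} → y ∈ concat (c ∷ b ∷ cs) → κ x ≡ κ y → x ∈ c → y ∈ c
        closed j e s with ∈-++⁻ c j
        ... | inj₁ k = k
        ... | inj₂ k with ∈-concat⁻′ (b ∷ cs) k
        ...   | d , l , m = ⊥-elim (out s m l e)
    ... | yes found with find found
    ... | d , i , f with find f
    ... | x , j , g with find g
    ... | y , k , eq with ∈-∃++ i
    ... | as , bs , es with AllP.++⁻ as (subst (All (Cyc R)) es ks)
    ... | k₁ , kd ∷ k₂ with joinC kc kd j k eq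
    ... | h , kh , ph = let (d′ , kd′ , pd′) = merge n h (as ++ bs) len (kh ∷ AllP.++⁺ k₁ k₂) conn′
                        in d′ , kd′ , ↭-trans pd′ perm
      where
      len : length (as ++ bs) ≡ n
      len = ℕₚ.suc-injective (trans (cong suc (length-++ as)) (trans (sym (ℕₚ.+-suc (length as) (length bs))) (trans (sym (length-++ as)) (trans (cong length (sym es)) e))))
      perm : concat (h ∷ as ++ bs) ↭ concat (c ∷ b ∷ cs)
      perm = ↭-trans (++⁺ ph (↭-reflexive (sym (concat-++ as bs)))) (↭-trans (↭-reflexive (++-assoc c d _))
               (++⁺ˡ c (↭-trans (shifts d (concat as)) (↭-reflexive (trans (concat-++ as (d ∷ bs)) (cong concat (sym es)))))))
      conn′ : Conn (h ∷ as ++ bs)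
      conn′ S cl kl i j = conn S cl′ (λ i j → kl (∈-resp-↭ (↭-sym perm) i) (∈-resp-↭ (↭-sym perm) j))
                            (∈-resp-↭ perm i) (∈-resp-↭ perm j)
        where
        hh : ∀ {z} → z ∈ c ⊎ z ∈ d → z ∈ h
        hh (inj₁ i) = ∈-resp-↭ (↭-sym ph) (∈-++⁺ˡ i)
        hh (inj₂ i) = ∈-resp-↭ (↭-sym ph) (∈-++⁺ʳ c i)
        cl′ : ∀ {e x y} → e ∈ c ∷ b ∷ cs → x ∈ e → y ∈ e → S x → S y
        cl′ (here refl) i j = cl (here refl) (hh (inj₁ i)) (hh (inj₁ j))
        cl′ (there m)   i j with ∈-++⁻ as (subst (_ ∈_) es m)
        ... | inj₁ l           = cl (there (∈-++⁺ˡ l)) i j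
        ... | inj₂ (here refl) = cl (here refl) (hh (inj₂ i)) (hh (inj₂ j))
        ... | inj₂ (there l)   = cl (there (∈-++⁺ʳ as l)) i j

  -- Exchanging the successors of two vertices with the same key keeps all edges and merges two cycles of g.
  mergeHam : ∀ {A K : Set} → DecidableEquality A → DecidableEquality K →
    (P : A → Set) (_~_ : A → A → Set) (vs : List A) → Unique vs → (∀ {x} → x ∈ vs → P x) → (∀ {x} → P x → x ∈ vs) →
    (g g⁻ : A → A) → (∀ {x} → P x → P (g x)) → (∀ {x} → P x → P (g⁻ x)) →
    (∀ {x} → P x → g⁻ (g x) ≡ x) → (∀ {x} → P x → g (g⁻ x) ≡ x) →
    (κ : A → K) → (∀ {x y} → P x → P y → κ x ≡ κ y → x ~ g y) →
    ((S : A → Set) → (∀ {x} → P x → S x → S (g x)) → (∀ {x} → P x → S (g x) → S x) →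
      (∀ {x y} → P x → P y → κ x ≡ κ y → S x → S y) → ∀ {x y} → P x → P y → S x → S y) →
    ∃ P → Ham P _~_
  mergeHam {A} _≟_ _≟ᴷ_ P _~_ vs uvs snd fll g g⁻ Pg Pg⁻ gl gr κ swp conn (x₀ , px₀) = done
    where
    es = map (λ x → x , g x) vs
    fst≡ : map proj₁ es ≡ vs
    fst≡ = go vs where
      go : ∀ vs → map proj₁ (map (λ x → x , g x) vs) ≡ vs
      go []       = refl
      go (v ∷ vs) = cong (v ∷_) (go vs)
    snd≡ : map proj₂ es ≡ map g vs
    snd≡ = go vs where
      go : ∀ vs → map proj₂ (map (λ x → x , g x) vs) ≡ map g vs
      go []       = refl
      go (v ∷ vs) = cong (g v ∷_) (go vs)
    ug : ∀ vs → (∀ {x} → x ∈ vs → P x) → Unique vs → Unique (map g vs)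
    ug []       s []      = []
    ug (v ∷ vs) s (n ∷ u) = All.tabulate (λ i → ne (∈-map⁻ g i)) ∷ ug vs (λ i → s (there i)) u
      where
      ne : ∀ {w} → (∃ λ x → x ∈ vs × w ≡ g x) → g v ≢ w
      ne (x , i , refl) e = All.lookup n i (trans (sym (gl (s (here refl)))) (trans (cong g⁻ e) (gl (s (there i)))))
    perm : map g vs ↭ vs
    perm = ∼bag⇒↭ (unique∧set⇒bag (ug vs snd uvs) uvs (λ {z} → mk⇔ to from))
      where
      to : ∀ {z} → z ∈ map g vs → z ∈ vs
      to i with ∈-map⁻ g i
      ... | x , j , refl = fll (Pg (snd j))
      from : ∀ {z} → z ∈ vs → z ∈ map g vs
      from i = subst (_∈ map g vs) (gr (snd i)) (∈-map⁺ g (fll (Pg⁻ (snd i))))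
    module O = Orbits _≟_
    orb = O.orbits (length es) es refl (subst Unique (sym fst≡) uvs)
            (↭-trans (↭-reflexive snd≡) (↭-trans perm (↭-reflexive (sym fst≡))))
    -- Quantifying over all vertices with the key of `x` makes `R` depend on `x` only through its
    -- key, which is the invariance that `Merging` asks for.
    R : A → A → Set
    R x z = ∀ y → P y → κ y ≡ κ x → y ~ z
    module M = Merging _≟ᴷ_ κ R (λ e r y p q → r y p (trans q (sym e)))
    isG : ∀ {x y} → O.Edge es x y → P x × y ≡ g x
    isG i with ∈-map⁻ (λ x → x , g x) i
    ... | x , j , refl = snd j , refl
    toR : ∀ {x y} → O.Edge es x y → R x y
    toR i y p e with isG i
    ... | q , refl = swp p q e
    cycR : ∀ {c} → Cyc (O.Edge es) c → Cyc R c
    cycR (a , b , w , r) = a , b , mapW (λ _ → toR) w , toR r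
    done : Ham P _~_
    done with orb
    ... | [] , _ , p = ⊥-elim (none (∈-resp-↭ (↭-sym (↭-trans p (↭-reflexive fst≡))) (fll px₀)))
      where none : ∀ {x : A} → x ∈ [] → ⊥
            none ()
    ... | c ∷ cs , ok , p = out (M.merge (length cs) c cs refl (All.map cycR ok) conn′)
      where
      pv : concat (c ∷ cs) ↭ vs
      pv = ↭-trans p (↭-reflexive fst≡)
      conn′ : M.Conn (c ∷ cs)
      conn′ S cl kl i j s = conn (λ x → P x → S x) fwd bwd
         (λ p q e s _ → kl (∈-resp-↭ (↭-sym pv) (fll p)) (∈-resp-↭ (↭-sym pv) (fll q)) e (s p))
         (inP i) (inP j) (λ _ → s) (inP j)
        where
        inP : ∀ {x} → x ∈ concat (c ∷ cs) → P x
        inP i = snd (∈-resp-↭ pv i)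
        next : ∀ {d x} → Cyc (O.Edge es) d → x ∈ d → g x ∈ d
        next k i with rotate i k
        ... | a , d′ , w , r , q with isG r
        ...   | _ , refl = ∈-resp-↭ q (first∈ w)
        same : ∀ {x} → P x → ∃ λ d → d ∈ c ∷ cs × x ∈ d × g x ∈ d
        same p with ∈-concat⁻′ (c ∷ cs) (∈-resp-↭ (↭-sym pv) (fll p))
        ... | d , i , j = d , j , i , next (All.lookup ok j) i
        fwd : ∀ {x} → P x → (P x → S x) → P (g x) → S (g x)
        fwd p s _ = let (d , k , i , j) = same p in cl k i j (s p)
        bwd : ∀ {x} → P x → (P (g x) → S (g x)) → P x → S x
        bwd p s _ = let (d , k , i , j) = same p in cl k j i (s (Pg p))
      out : (∃ λ d → Cyc R d × d ↭ concat (c ∷ cs)) → Ham P _~_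
      out (d , (a , b , w , r) , q) = record
        { verts = d
        ; cyc = a , b , mapW (λ i r → r _ (snd (∈-resp-↭ qv i)) refl) w , r b (snd (∈-resp-↭ qv (last∈ w))) refl
        ; uniq = Unique-↭ (↭-sym qv) uvs
        ; sound = λ i → snd (∈-resp-↭ qv i)
        ; full = λ p → ∈-resp-↭ (↭-sym qv) (fll p) }
        where qv = ↭-trans q pv

open Cycles using (mergeHam)

-- Lattice paths, plane forests and the points on the cycle of a word.

module OddGraphs where

  neg : Word → Word
  neg = map not

  -- The lattice path traversed backwards: the order is reversed, and up and down steps change
  -- places.
  mir : Word → Word
  mir w = reverse (neg w)

  neg-neg : ∀ w → neg (neg w) ≡ w
  neg-neg []      = refl
  neg-neg (b ∷ w) = cong₂ _∷_ (not-involutive b) (neg-neg w)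

  mir-++ : ∀ v w → mir (v ++ w) ≡ mir w ++ mir v
  mir-++ v w = trans (cong reverse (map-++ not v w)) (reverse-++ (neg v) (neg w))

  mir-∷ : ∀ b w → mir (b ∷ w) ≡ mir w ++ not b ∷ []
  mir-∷ b w = unfold-reverse (not b) (neg w)

  mir-mir : ∀ w → mir (mir w) ≡ w
  mir-mir w = trans (cong reverse (reverse-map not (neg w))) (trans (reverse-involutive (neg (neg w))) (neg-neg w))

  mir-inj : ∀ {v w} → mir v ≡ mir w → v ≡ w
  mir-inj {v} {w} e = trans (sym (mir-mir v)) (trans (cong mir e) (mir-mir w))

  neg-inj : ∀ {v w} → neg v ≡ neg w → v ≡ w
  neg-inj {v} {w} e = trans (sym (neg-neg v)) (trans (cong neg e) (neg-neg w))

  neg-mir : ∀ w → neg (reverse w) ≡ mir w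
  neg-mir w = reverse-map not w

  -- Lattice paths from height h to height f that stay nonnegative.
  data St : ℕ → ℕ → Word → Set where
    []  : ∀ {h} → St h h []
    up  : ∀ {h f w} → St (suc h) f w → St h f (true ∷ w)
    dn  : ∀ {h f w} → St h f w → St (suc h) f (false ∷ w)

  st-++ : ∀ {h g f v w} → St h g v → St g f w → St h f (v ++ w)
  st-++ []     t = t
  st-++ (up s) t = up (st-++ s t)
  st-++ (dn s) t = dn (st-++ s t)

  st-lift : ∀ {h f w} k → St h f w → St (h + k) (f + k) w
  st-lift k []     = []
  st-lift k (up s) = up (st-lift k s)
  st-lift k (dn s) = dn (st-lift k s)

  st-mir : ∀ {h f w} → St h f w → St f h (mir w)
  st-mir []             = []
  st-mir (up {w = w} s) = subst (St _ _) (sym (mir-∷ true w)) (st-++ (st-mir s) (dn []))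
  st-mir (dn {w = w} s) = subst (St _ _) (sym (mir-∷ false w)) (st-++ (st-mir s) (up []))

  -- The marked down step is the first passage below 0, and a path has only one of these. All unique
  -- decompositions below rest on this.
  first-down : ∀ {h v w x y} → St h 0 v → St h 0 w → v ++ false ∷ x ≡ w ++ false ∷ y → v ≡ w × x ≡ y
  first-down []     []     refl = refl , refl
  first-down []     (up _) ()
  first-down (up _) []     ()
  first-down (up s) (up t) e with first-down s t (∷-injectiveʳ e)
  ... | refl , refl = refl , refl
  first-down (up _) (dn _) ()
  first-down (dn _) (up _) ()
  first-down (dn s) (dn t) e with first-down s t (∷-injectiveʳ e)
  ... | refl , refl = refl , refl

  no-down : ∀ {h f v y} → St h 0 v → ¬ St h f (v ++ false ∷ y)
  no-down []     ()
  no-down (up s) (up t) = no-down s t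
  no-down (dn s) (dn t) = no-down s t

  passage : ∀ h m → (∃ λ f → St h f m) ⊎ (∃₂ λ d m′ → m ≡ d ++ false ∷ m′ × St h 0 d)
  passage h       []          = inj₁ (h , [])
  passage h       (true ∷ m)  with passage (suc h) m
  ... | inj₁ (f , s)               = inj₁ (f , up s)
  ... | inj₂ (d , m′ , refl , s)   = inj₂ (true ∷ d , m′ , refl , up s)
  passage zero    (false ∷ m) = inj₂ ([] , m , refl , [])
  passage (suc h) (false ∷ m) with passage h m
  ... | inj₁ (f , s)               = inj₁ (f , dn s)
  ... | inj₂ (d , m′ , refl , s)   = inj₂ (false ∷ d , m′ , refl , dn s)

  cut : ∀ g {w} → St (suc g) 0 w → ∃₂ λ d w′ → w ≡ d ++ false ∷ w′ × St g 0 d × St 0 0 w′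
  cut g       (up s) with cut (suc g) s
  ... | d , w′ , refl , t , t′ = true ∷ d , w′ , refl , up t , t′
  cut zero    (dn s) = [] , _ , refl , [] , s
  cut (suc g) (dn s) with cut g s
  ... | d , w′ , refl , t , t′ = false ∷ d , w′ , refl , dn t , t′

  -- Plane forests; the forest under an edge is stored mirrored.
  infixr 6 _◁_
  data Dy : Set where
    ε   : Dy
    _◁_ : Dy → Dy → Dy

  size : Dy → ℕ
  size ε       = 0
  size (u ◁ v) = suc (size u + size v)

  word : Dy → Word
  word ε       = []
  word (u ◁ v) = true ∷ mir (word u) ++ false ∷ word v

  data Pt : Dy → Set where
    end : Pt ε
    top : ∀ {u v} → Pt (u ◁ v)
    inn : ∀ {u v} → Pt u → Pt (u ◁ v)
    aft : ∀ {u v} → Pt v → Pt (u ◁ v)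

  -- From `word D` at the first point to its complement at the last, one bit at a time: for `u ◁ v`
  -- the closing 0 of the component is raised to 1, the points of `u` complement the inside, the
  -- opening 1 drops to 0, and the points of `v` follow.
  wd : ∀ {D} → Pt D → Word
  wd end                 = []
  wd (top {u} {v})       = true ∷ mir (word u) ++ false ∷ word v
  wd (inn {u} {v} p)     = true ∷ mir (wd p) ++ true ∷ word v
  wd (aft {u} {v} q)     = false ∷ reverse (word u) ++ true ∷ wd q

  -- Tells two levels of the cube apart: the word of an even point is balanced, that of an odd point
  -- has two more ones than zeros (`sum-wd`).
  odd : ∀ {D} → Pt D → Bool
  odd end     = false
  odd top     = false
  odd (inn p) = not (odd p)
  odd (aft q) = odd q

  V : Set
  V = Σ Dy Pt

  word-st : ∀ u → St 0 0 (word u)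
  word-st ε       = []
  word-st (u ◁ v) = up (st-++ (st-lift 1 (st-mir (word-st u))) (dn (word-st v)))

  word-inj : ∀ u v → word u ≡ word v → u ≡ v
  word-inj ε       ε       _  = refl
  word-inj ε       (_ ◁ _) ()
  word-inj (_ ◁ _) ε       ()
  word-inj (u ◁ v) (x ◁ y) e with first-down (st-mir (word-st u)) (st-mir (word-st x)) (∷-injectiveʳ e)
  ... | p , q with word-inj u x (mir-inj p) | word-inj v y q
  ... | refl | refl = refl

  private
    mir-inn : ∀ x v → mir (x ++ true ∷ word v) ≡ mir (word v) ++ false ∷ mir x
    mir-inn x v = trans (mir-++ x (true ∷ word v)) (trans (cong (_++ mir x) (mir-∷ true (word v))) (++-assoc (mir (word v)) _ _))

    neg-aft : ∀ u w → neg (reverse (word u) ++ true ∷ w) ≡ mir (word u) ++ false ∷ neg w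
    neg-aft u w = trans (map-++ not (reverse (word u)) (true ∷ w)) (cong (_++ false ∷ neg w) (neg-mir (word u)))

    split-inn : ∀ {x y} v v′ → x ++ true ∷ word v ≡ y ++ true ∷ word v′ → x ≡ y × v ≡ v′
    split-inn {x} {y} v v′ e with first-down (st-mir (word-st v)) (st-mir (word-st v′))
                                    (trans (sym (mir-inn x v)) (trans (cong mir e) (mir-inn y v′)))
    ... | p , q = mir-inj q , word-inj v v′ (mir-inj p)

    split-aft : ∀ {x y} u u′ → reverse (word u) ++ true ∷ x ≡ reverse (word u′) ++ true ∷ y → u ≡ u′ × x ≡ y
    split-aft {x} {y} u u′ e with first-down (st-mir (word-st u)) (st-mir (word-st u′))
                                    (trans (sym (neg-aft u x)) (trans (cong neg e) (neg-aft u′ y)))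
    ... | p , q = word-inj u u′ (mir-inj p) , neg-inj q

    -- Read backwards, the second word falls below 0 right after `word v′`, while a Dyck word never
    -- does.
    top≢inn : ∀ u v v′ x → true ∷ mir (word u) ++ false ∷ word v ≢ true ∷ x ++ true ∷ word v′
    top≢inn u v v′ x e = no-down (st-mir (word-st v′)) (subst (St 0 0) (trans (cong mir e) eq) (st-mir (word-st (u ◁ v))))
      where
      eq : mir (true ∷ x ++ true ∷ word v′) ≡ mir (word v′) ++ false ∷ (mir x ++ false ∷ [])
      eq = trans (mir-∷ true (x ++ true ∷ word v′)) (trans (cong (_++ false ∷ []) (mir-inn x v′)) (++-assoc (mir (word v′)) _ _))

  wd-inj : ∀ {D E} (p : Pt D) (q : Pt E) → odd p ≡ odd q → wd p ≡ wd q → (D , p) ≡ (E , q)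
  wd-inj end             end              _ _ = refl
  wd-inj end             top              _ ()
  wd-inj end             (inn _)          _ ()
  wd-inj end             (aft _)          _ ()
  wd-inj top             end              _ ()
  wd-inj (inn _)         end              _ ()
  wd-inj (aft _)         end              _ ()
  wd-inj (top {u} {v})   (top {x} {y})    _ e with word-inj (u ◁ v) (x ◁ y) e
  ... | refl = refl
  wd-inj (top {u} {v})   (inn {v = y} q)  _ e = ⊥-elim (top≢inn u v y (mir (wd q)) e)
  wd-inj (inn {v = y} q) (top {u} {v})    _ e = ⊥-elim (top≢inn u v y (mir (wd q)) (sym e))
  wd-inj top             (aft _)          _ ()
  wd-inj (inn _)         (aft _)          _ ()
  wd-inj (aft _)         top              _ ()
  wd-inj (aft _)         (inn _)          _ ()
  wd-inj (inn {v = v} p) (inn {v = y} q)  o e with split-inn v y (∷-injectiveʳ e)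
  ... | e′ , refl with wd-inj p q (trans (sym (not-involutive _)) (trans (cong not o) (not-involutive _))) (mir-inj e′)
  ... | refl = refl
  wd-inj (aft {u} p)     (aft {x} q)      o e with split-aft u x (∷-injectiveʳ e)
  ... | refl , e′ with wd-inj p q o e′
  ... | refl = refl

  -- Counting ones and zeros; every word of the two levels belongs to a point.

  zeros : Word → ℕ
  zeros w = ones (neg w)

  ones-++ : ∀ v w → ones (v ++ w) ≡ ones v + ones w
  ones-++ []          w = refl
  ones-++ (true ∷ v)  w = cong suc (ones-++ v w)
  ones-++ (false ∷ v) w = ones-++ v w

  ones-reverse : ∀ w → ones (reverse w) ≡ ones w
  ones-reverse []      = refl
  ones-reverse (b ∷ w) = trans (cong ones (unfold-reverse b w)) (trans (ones-++ (reverse w) (b ∷ []))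
                           (trans (cong (_+ ones (b ∷ [])) (ones-reverse w)) (trans (ℕₚ.+-comm (ones w) _) (lem b))))
    where lem : ∀ b → ones (b ∷ []) + ones w ≡ ones (b ∷ w)
          lem true  = refl
          lem false = refl

  zeros-++ : ∀ v w → zeros (v ++ w) ≡ zeros v + zeros w
  zeros-++ v w = trans (cong ones (map-++ not v w)) (ones-++ (neg v) (neg w))

  st-sum : ∀ {h f w} → St h f w → h + ones w ≡ f + zeros w
  st-sum {h} []             = refl
  st-sum {h} (up {w = w} s) = trans (ℕₚ.+-suc h (ones w)) (st-sum s)
  st-sum (dn {f = f} {w = w} s) = trans (cong suc (st-sum s)) (sym (ℕₚ.+-suc f (zeros w)))

  bal : Bool → ℕ
  bal false = 0
  bal true  = 2

  len-mir : ∀ w → length (mir w) ≡ length w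
  len-mir w = trans (length-reverse (neg w)) (length-map not w)

  len-word : ∀ u → length (word u) ≡ size u + size u
  len-word ε       = refl
  len-word (u ◁ v) = cong suc (trans (length-++ (mir (word u))) (trans (cong₂ _+_ (trans (len-mir (word u)) (len-word u)) (cong suc (len-word v)))
     (solve 2 (λ a b → a :+ a :+ (con 1 :+ (b :+ b)) := (a :+ b) :+ (con 1 :+ (a :+ b))) refl (size u) (size v))))
    where open +-*-Solver

  len-wd : ∀ {D} (p : Pt D) → length (wd p) ≡ size D + size D
  len-wd end = refl
  len-wd (top {u} {v}) = len-word (u ◁ v)
  len-wd (inn {u} {v} p) = cong suc (trans (length-++ (mir (wd p))) (trans (cong₂ _+_ (trans (len-mir (wd p)) (len-wd p)) (cong suc (len-word v)))
     (solve 2 (λ a b → a :+ a :+ (con 1 :+ (b :+ b)) := (a :+ b) :+ (con 1 :+ (a :+ b))) refl (size u) (size v))))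
    where open +-*-Solver
  len-wd (aft {u} {v} q) = cong suc (trans (length-++ (reverse (word u))) (trans (cong₂ _+_ (trans (length-reverse (word u)) (len-word u)) (cong suc (len-wd q)))
     (solve 2 (λ a b → a :+ a :+ (con 1 :+ (b :+ b)) := (a :+ b) :+ (con 1 :+ (a :+ b))) refl (size u) (size v))))
    where open +-*-Solver

  ones-mir : ∀ w → ones (mir w) ≡ zeros w
  ones-mir w = ones-reverse (neg w)

  ones+zeros : ∀ w → ones w + zeros w ≡ length w
  ones+zeros []          = refl
  ones+zeros (true ∷ w)  = cong suc (ones+zeros w)
  ones+zeros (false ∷ w) = trans (ℕₚ.+-suc (ones w) _) (cong suc (ones+zeros w))

  zeros-mir : ∀ w → zeros (mir w) ≡ ones w
  zeros-mir w = trans (sym (ones-mir (mir w))) (cong ones (mir-mir w))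

  sum-wd : ∀ {D} (p : Pt D) → ones (wd p) ≡ bal (odd p) + zeros (wd p)
  sum-wd end = refl
  sum-wd (top {u} {v}) = st-sum (word-st (u ◁ v))
  sum-wd (inn {u} {v} p) = begin
    suc (ones (mir (wd p) ++ true ∷ word v))             ≡⟨ cong suc (ones-++ (mir (wd p)) _) ⟩
    suc (ones (mir (wd p)) + suc (ones (word v)))        ≡⟨ cong₂ (λ a b → suc (a + suc b)) (ones-mir (wd p)) (st-sum (word-st v)) ⟩
    suc (zeros (wd p) + suc (zeros (word v)))            ≡⟨ lem (odd p) (ones (wd p)) (zeros (wd p)) (zeros (word v)) (sum-wd p) ⟩
    bal (not (odd p)) + (ones (wd p) + zeros (word v))   ≡⟨ cong (λ a → bal (not (odd p)) + (a + zeros (word v))) (sym (zeros-mir (wd p))) ⟩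
    bal (not (odd p)) + (zeros (mir (wd p)) + zeros (word v)) ≡⟨ cong (bal (not (odd p)) +_) (sym (zeros-++ (mir (wd p)) (true ∷ word v))) ⟩
    bal (not (odd p)) + zeros (mir (wd p) ++ true ∷ word v) ∎
    where
    open ≡-Reasoning
    lem : ∀ o a b c → a ≡ bal o + b → suc (b + suc c) ≡ bal (not o) + (a + c)
    lem true  a b c refl = cong suc (ℕₚ.+-suc b c)
    lem false a b c refl = cong suc (ℕₚ.+-suc b c)
  sum-wd (aft {u} q) = begin
    ones (reverse (word u) ++ true ∷ wd q)               ≡⟨ ones-++ (reverse (word u)) _ ⟩
    ones (reverse (word u)) + suc (ones (wd q))          ≡⟨ cong₂ (λ a b → a + suc b) (trans (ones-reverse (word u)) (st-sum (word-st u))) (sum-wd q) ⟩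
    zeros (word u) + suc (bal (odd q) + zeros (wd q))    ≡⟨ solve 3 (λ a b c → a :+ (con 1 :+ (b :+ c)) := b :+ (con 1 :+ (a :+ c))) refl (zeros (word u)) (bal (odd q)) (zeros (wd q)) ⟩
    bal (odd q) + suc (zeros (word u) + zeros (wd q))    ≡⟨ cong (λ a → bal (odd q) + suc (a + zeros (wd q))) (sym (trans (cong ones (neg-mir (word u))) (ones-mir (word u)))) ⟩
    bal (odd q) + suc (zeros (reverse (word u)) + zeros (wd q)) ≡⟨ cong (λ a → bal (odd q) + suc a) (sym (zeros-++ (reverse (word u)) (true ∷ wd q))) ⟩
    bal (odd q) + suc (zeros (reverse (word u) ++ true ∷ wd q)) ∎
    where open ≡-Reasoning
          open +-*-Solver

  parse : ∀ n w → length w ≤ n → St 0 0 w → ∃ λ u → word u ≡ w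
  parse n       []         _       _      = ε , refl
  parse (suc n) (true ∷ w) (s≤s l) (up s) with cut 0 s
  ... | d , w′ , refl , t , t′ with parse n (mir d) l₁ (st-mir t) | parse n w′ l₂ t′
    where
    l₁ : length (mir d) ≤ n
    l₁ = ℕₚ.≤-trans (ℕₚ.≤-reflexive (len-mir d)) (ℕₚ.≤-trans (ℕₚ.m≤m+n _ _) (ℕₚ.≤-trans (ℕₚ.≤-reflexive (sym (length-++ d))) l))
    l₂ : length w′ ≤ n
    l₂ = ℕₚ.≤-trans (ℕₚ.≤-trans (ℕₚ.n≤1+n _) (ℕₚ.≤-trans (ℕₚ.m≤n+m _ (length d)) (ℕₚ.≤-reflexive (sym (length-++ d))))) l
  ... | u , e | v , refl = u ◁ v , cong (λ x → true ∷ x ++ false ∷ word v) (trans (cong mir e) (mir-mir d))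

  -- By first passages. A leading 0 means `aft`, cut where the complemented rest first falls below
  -- 0. With a leading 1 the path is read backwards: if it stays nonnegative, the word is a Dyck
  -- word and the point is `top`; otherwise the first passage gives the cut for `inn`.
  locate : ∀ n w o → length w ≤ n → ones w ≡ bal o + zeros w → ∃ λ D → Σ (Pt D) λ p → wd p ≡ w × odd p ≡ o
  locate n       []          false _ _ = ε , end , refl , refl
  locate n       []          true  _ ()
  locate (suc n) (false ∷ w) o (s≤s l) e with passage 0 (neg w)
  ... | inj₁ (f , s) = ⊥-elim (lem (ones w) (zeros w) (bal o) f e (trans (st-sum s) (cong (f +_) (cong ones (neg-neg w)))))
    where lem : ∀ a z b f → a ≡ b + suc z → z ≡ f + a → ⊥
          lem a z b f refl q = ℕₚ.<-irrefl q (ℕₚ.≤-trans (ℕₚ.m≤n+m (suc z) b) (ℕₚ.m≤n+m (b + suc z) f))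
  ... | inj₂ (d , m , q , s) with parse (suc n) (mir d) l₁ (st-mir s) | locate n (neg m) o l₂ e₂
    where
    w≡ : w ≡ neg d ++ true ∷ neg m
    w≡ = trans (sym (neg-neg w)) (trans (cong neg q) (map-++ not d (false ∷ m)))
    lw : length w ≡ length d + suc (length m)
    lw = trans (sym (length-map not w)) (trans (cong length q) (length-++ d))
    l₁ : length (mir d) ≤ suc n
    l₁ = ℕₚ.≤-trans (ℕₚ.≤-reflexive (len-mir d)) (ℕₚ.≤-trans (ℕₚ.m≤m+n _ _) (ℕₚ.≤-trans (ℕₚ.≤-reflexive (sym lw)) (ℕₚ.m≤n⇒m≤1+n l)))
    l₂ : length (neg m) ≤ n
    l₂ = ℕₚ.≤-trans (ℕₚ.≤-reflexive (length-map not m)) (ℕₚ.≤-trans (ℕₚ.≤-trans (ℕₚ.n≤1+n _) (ℕₚ.m≤n+m _ (length d))) (ℕₚ.≤-trans (ℕₚ.≤-reflexive (sym lw)) l))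
    e₂ : ones (neg m) ≡ bal o + zeros (neg m)
    e₂ = ℕₚ.+-cancelˡ-≡ (suc (zeros d)) _ _ (begin
      suc (zeros d) + ones (neg m)                 ≡⟨ sym (ℕₚ.+-suc (zeros d) (ones (neg m))) ⟩
      ones (neg d) + ones (true ∷ neg m)           ≡⟨ sym (ones-++ (neg d) (true ∷ neg m)) ⟩
      ones (neg d ++ true ∷ neg m)                 ≡⟨ cong ones (sym w≡) ⟩
      ones w                                       ≡⟨ e ⟩
      bal o + suc (zeros w)                        ≡⟨ cong (λ x → bal o + suc (zeros x)) w≡ ⟩
      bal o + suc (zeros (neg d ++ true ∷ neg m))  ≡⟨ cong (λ x → bal o + suc x) (zeros-++ (neg d) (true ∷ neg m)) ⟩
      bal o + suc (zeros (neg d) + zeros (neg m))  ≡⟨ cong (λ x → bal o + suc (x + zeros (neg m))) (trans (cong ones (neg-neg d)) (st-sum s)) ⟩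
      bal o + suc (zeros d + zeros (neg m))        ≡⟨ solve 3 (λ b z m → b :+ (con 1 :+ (z :+ m)) := con 1 :+ z :+ (b :+ m)) refl (bal o) (zeros d) (zeros (neg m)) ⟩
      suc (zeros d) + (bal o + zeros (neg m))      ∎)
      where open ≡-Reasoning
            open +-*-Solver
  ... | u , eu | D , p , ep , oo = u ◁ D , aft p , cong (false ∷_) (trans (cong₂ (λ a b → reverse a ++ true ∷ b) eu ep)
          (trans (cong (_++ true ∷ neg m) (trans (reverse-involutive (neg d)) refl)) (sym w≡′))) , oo
    where
    w≡′ : w ≡ neg d ++ true ∷ neg m
    w≡′ = trans (sym (neg-neg w)) (trans (cong neg q) (map-++ not d (false ∷ m)))
  locate (suc n) (true ∷ w) o (s≤s l) e with passage 0 (mir (true ∷ w))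
  ... | inj₁ (zero , s) with o
  ...   | false = let (u , eu) = parse (suc n) (true ∷ w) (s≤s l) (subst (St 0 0) (mir-mir (true ∷ w)) (st-mir s))
                  in go u eu
    where
    go : ∀ u → word u ≡ true ∷ w → ∃ λ D → Σ (Pt D) λ p → wd p ≡ true ∷ w × odd p ≡ false
    go (u ◁ v) eu = u ◁ v , top , eu , refl
  ...   | true  = ⊥-elim (lem (ones w) (zeros w) e (subst₂ (λ a b → a ≡ b) (ones-mir (true ∷ w)) (zeros-mir (true ∷ w)) (st-sum s)))
    where lem : ∀ a z → suc a ≡ suc (suc z) → z ≡ suc a → ⊥
          lem a z p q = ℕₚ.<-irrefl (trans q p) (ℕₚ.n≤1+n _)
  locate (suc n) (true ∷ w) o (s≤s l) e | inj₁ (suc f , s) =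
    ⊥-elim (lem (suc (ones w)) (zeros w) (bal o) f e (trans (sym (ones-mir (true ∷ w))) (trans (st-sum s) (cong (suc f +_) (zeros-mir (true ∷ w))))))
    where lem : ∀ a z b f → a ≡ b + z → z ≡ suc f + a → ⊥
          lem a z b f refl q = ℕₚ.<-irrefl q (s≤s (ℕₚ.≤-trans (ℕₚ.m≤n+m z b) (ℕₚ.m≤n+m (b + z) f)))
  locate (suc n) (true ∷ w) o (s≤s l) e | inj₂ (d , m , q , s) with parse (suc n) (mir d) l₁ (st-mir s)
    where
    ld : length d + suc (length m) ≡ suc (length w)
    ld = trans (sym (length-++ d)) (trans (cong length (sym q)) (len-mir (true ∷ w)))
    l₁ : length (mir d) ≤ suc n
    l₁ = ℕₚ.≤-trans (ℕₚ.≤-reflexive (len-mir d)) (ℕₚ.≤-trans (ℕₚ.m≤m+n _ _) (ℕₚ.≤-trans (ℕₚ.≤-reflexive ld) (s≤s l)))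
  ... | v , ev = tail (mir m) refl
    where
    full : true ∷ w ≡ mir m ++ true ∷ word v
    full = trans (sym (mir-mir (true ∷ w))) (trans (cong mir q) (trans (mir-++ d (false ∷ m))
            (trans (cong (_++ mir d) (mir-∷ false m)) (trans (++-assoc (mir m) _ _) (cong (λ x → mir m ++ true ∷ x) (sym ev))))))
    tail : ∀ x → mir m ≡ x → ∃ λ D → Σ (Pt D) λ p → wd p ≡ true ∷ w × odd p ≡ o
    tail [] em = ⊥-elim (bad o e)
      where
      w≡ : w ≡ word v
      w≡ = ∷-injectiveʳ (trans full (cong (_++ true ∷ word v) em))
      bad : ∀ o → suc (ones w) ≡ bal o + zeros w → ⊥
      bad false e = ℕₚ.<-irrefl (trans (trans (cong ones w≡) (st-sum (word-st v))) (trans (cong zeros (sym w≡)) (sym e))) (ℕₚ.n<1+n (ones w))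
      bad true  e = ℕₚ.<-irrefl (trans (trans (cong zeros w≡) (sym (st-sum (word-st v)))) (trans (cong ones (sym w≡)) (ℕₚ.suc-injective e))) (ℕₚ.n<1+n _)
    tail (b ∷ x) em with locate n (mir x) (not o) l₂ e₂
      where
      eqs : true ∷ w ≡ b ∷ x ++ true ∷ word v
      eqs = trans full (cong (_++ true ∷ word v) em)
      w≡ : w ≡ x ++ true ∷ word v
      w≡ = ∷-injectiveʳ eqs
      l₂ : length (mir x) ≤ n
      l₂ = ℕₚ.≤-trans (ℕₚ.≤-reflexive (len-mir x)) (ℕₚ.≤-trans (ℕₚ.m≤m+n _ _) (ℕₚ.≤-trans (ℕₚ.≤-reflexive (sym (trans (cong length w≡) (length-++ x)))) l))
      so : ∀ o a z c → suc (a + suc c) ≡ bal o + (z + c) → z ≡ bal (not o) + a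
      so false a z c h = ℕₚ.+-cancelʳ-≡ c z _ (trans (sym h) (cong suc (ℕₚ.+-suc a c)))
      so true  a z c h = ℕₚ.+-cancelʳ-≡ c z _ (trans (sym (ℕₚ.suc-injective (ℕₚ.suc-injective (trans (sym (cong suc (ℕₚ.+-suc a c))) h)))) refl)
      e₂ : ones (mir x) ≡ bal (not o) + zeros (mir x)
      e₂ = trans (ones-mir x) (trans (so o (ones x) (zeros x) (zeros (word v)) (trans (sym e-l) (trans e e-r))) (cong (bal (not o) +_) (sym (zeros-mir x))))
        where
        e-l : suc (ones w) ≡ suc (ones x + suc (zeros (word v)))
        e-l = cong suc (trans (cong ones w≡) (trans (ones-++ x _) (cong (λ a → ones x + suc a) (st-sum (word-st v)))))
        e-r : bal o + zeros w ≡ bal o + (zeros x + zeros (word v))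
        e-r = cong (bal o +_) (trans (cong zeros w≡) (zeros-++ x _))
    ... | D , p , ep , oo = D ◁ v , inn p , trans (cong (λ y → true ∷ y ++ true ∷ word v) (trans (cong mir ep) (mir-mir x))) (trans eqs′ refl) ,
            trans (cong not oo) (not-involutive o)
      where
      eqs′ : true ∷ x ++ true ∷ word v ≡ true ∷ w
      eqs′ = cong (true ∷_) (sym (∷-injectiveʳ (trans full (cong (_++ true ∷ word v) em))))

  -- Complementing the sets that contain the last point identifies the odd graph with levels k and
  -- k+1 of the 2k-cube: disjointness becomes a bit flip between the levels, or complementation
  -- within level k.
  enc : V → Word
  enc (D , p) with odd p
  ... | false = wd p ++ false ∷ []
  ... | true  = neg (wd p) ++ true ∷ []

  record Ad (x y : V) : Set where
    constructor ad
    field dis : enc x ⊥ʷ enc y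

  ⊥-sym : ∀ {v w} → v ⊥ʷ w → w ⊥ʷ v
  ⊥-sym []                      = []
  ⊥-sym (_∷_ {a} {b} e d) = trans (∧-comm b a) e ∷ ⊥-sym d

  Ad-sym : ∀ {x y} → Ad x y → Ad y x
  Ad-sym (ad d) = ad (⊥-sym d)

  data D1 : Word → Word → Set where
    here  : ∀ {a w} → D1 (a ∷ w) (not a ∷ w)
    there : ∀ {a v w} → D1 v w → D1 (a ∷ v) (a ∷ w)

  D1-++ʳ : ∀ {v w} x → D1 v w → D1 (v ++ x) (w ++ x)
  D1-++ʳ x here      = here
  D1-++ʳ x (there d) = there (D1-++ʳ x d)

  D1-++ˡ : ∀ {v w} x → D1 v w → D1 (x ++ v) (x ++ w)
  D1-++ˡ []      d = d
  D1-++ˡ (_ ∷ x) d = there (D1-++ˡ x d)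

  D1-mir : ∀ {v w} → D1 v w → D1 (mir v) (mir w)
  D1-mir (here {a} {w}) = subst₂ D1 (sym (mir-∷ a w)) (sym (mir-∷ (not a) w)) (D1-++ˡ (mir w) here)
  D1-mir (there {a} {v} {w} d) = subst₂ D1 (sym (mir-∷ a v)) (sym (mir-∷ a w)) (D1-++ʳ _ (D1-mir d))

  record Near (x y : V) : Set where
    constructor near
    field
      diff : D1 (wd (proj₂ x)) (wd (proj₂ y))
      par  : odd (proj₂ x) ≡ not (odd (proj₂ y))

  private
    data Up : Word → Word → Set where
      here  : ∀ {w} → Up (false ∷ w) (true ∷ w)
      there : ∀ {a v w} → Up v w → Up (a ∷ v) (a ∷ w)

    dir : ∀ {v w} → D1 v w → Up v w ⊎ Up w v
    dir (here {false}) = inj₁ here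
    dir (here {true})  = inj₂ here
    dir (there d) with dir d
    ... | inj₁ u = inj₁ (there u)
    ... | inj₂ u = inj₂ (there u)

    up-ones : ∀ {v w} → Up v w → ones w ≡ suc (ones v) × zeros v ≡ suc (zeros w)
    up-ones here = refl , refl
    up-ones (there {false} u) = proj₁ (up-ones u) , cong suc (proj₂ (up-ones u))
    up-ones (there {true} u)  = cong suc (proj₁ (up-ones u)) , proj₂ (up-ones u)

    self : ∀ w → (w ++ false ∷ []) ⊥ʷ (neg w ++ true ∷ [])
    self []          = refl ∷ []
    self (false ∷ w) = refl ∷ self w
    self (true ∷ w)  = refl ∷ self w

    up-⊥ : ∀ {v w} → Up v w → (v ++ false ∷ []) ⊥ʷ (neg w ++ true ∷ [])
    up-⊥ (here {w})        = refl ∷ self w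
    up-⊥ (there {false} u) = refl ∷ up-⊥ u
    up-⊥ (there {true} u)  = refl ∷ up-⊥ u

    absurd : ∀ {v w} → ones v ≡ zeros v → ones w ≡ suc (suc (zeros w)) → Up w v → ⊥
    absurd {v} {w} ev ow u with up-ones u
    ... | a , b = lem (ones v) (ones w) (zeros v) (zeros w) ev ow a b
      where lem : ∀ ov ow zv zw → ov ≡ zv → ow ≡ suc (suc zw) → ov ≡ suc ow → zw ≡ suc zv → ⊥
            lem ov ow zv zw refl refl p refl = ℕₚ.<-irrefl p (Data.Nat.s≤s (ℕₚ.m≤n+m ov 3))

  -- The numbers of ones fix the direction of the flip: the word of the even point is contained in
  -- that of the odd one, whose complement is therefore disjoint from it.
  near⇒Ad : ∀ {x y} → Near x y → Ad x y
  near⇒Ad {D , p} {E , q} (near d o) = ad (go (odd p) (odd q) refl refl)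
    where
    enc-even : ∀ {D} (p : Pt D) → odd p ≡ false → enc (D , p) ≡ wd p ++ false ∷ []
    enc-even p e with odd p
    ... | false = refl
    enc-odd : ∀ {D} (p : Pt D) → odd p ≡ true → enc (D , p) ≡ neg (wd p) ++ true ∷ []
    enc-odd p e with odd p
    ... | true = refl
    go : ∀ a b → odd p ≡ a → odd q ≡ b → enc (D , p) ⊥ʷ enc (E , q)
    go false false x y with trans (sym x) (trans o (cong not y))
    ... | ()
    go true true x y with trans (sym x) (trans o (cong not y))
    ... | ()
    go false true x y with dir d
    ... | inj₁ u = subst₂ _⊥ʷ_ (sym (enc-even p x)) (sym (enc-odd q y)) (up-⊥ u)
    ... | inj₂ u = ⊥-elim (absurd (trans (sum-wd p) (cong (λ b → bal b + zeros (wd p)) x)) (trans (sum-wd q) (cong (λ b → bal b + zeros (wd q)) y)) u)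
    go true false x y with dir d
    ... | inj₁ u = ⊥-elim (absurd (trans (sum-wd q) (cong (λ b → bal b + zeros (wd q)) y)) (trans (sum-wd p) (cong (λ b → bal b + zeros (wd p)) x)) u)
    ... | inj₂ u = subst₂ _⊥ʷ_ (sym (enc-odd p x)) (sym (enc-even q y)) (⊥-sym (up-⊥ u))

  -- The cycle of a word.

  fst : ∀ {D} → Pt D
  fst {ε}     = end
  fst {_ ◁ _} = top

  lst : ∀ {D} → Pt D
  lst {ε}     = end
  lst {_ ◁ _} = aft lst

  wd-fst : ∀ D → wd (fst {D}) ≡ word D
  wd-fst ε       = refl
  wd-fst (_ ◁ _) = refl

  wd-lst : ∀ D → wd (lst {D}) ≡ neg (word D)
  wd-lst ε       = refl
  wd-lst (u ◁ v) = cong (false ∷_) (trans (cong (λ x → reverse (word u) ++ true ∷ x) (wd-lst v))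
    (sym (trans (map-++ not (mir (word u)) (false ∷ word v)) (cong (_++ true ∷ neg (word v)) (trans (neg-mir (neg (word u))) (cong reverse (neg-neg (word u))))))))

  odd-fst : ∀ D → odd (fst {D}) ≡ false
  odd-fst ε       = refl
  odd-fst (_ ◁ _) = refl

  odd-lst : ∀ D → odd (lst {D}) ≡ false
  odd-lst ε       = refl
  odd-lst (_ ◁ v) = odd-lst v

  data Nx : ∀ {D} → Pt D → Pt D → Set where
    nxt : ∀ {u v} → Nx (top {u} {v}) (inn fst)
    nxi : ∀ {u v p q} → Nx p q → Nx (inn {u} {v} p) (inn q)
    nxm : ∀ {u v} → Nx (inn {u} {v} lst) (aft fst)
    nxa : ∀ {u v p q} → Nx p q → Nx (aft {u} {v} p) (aft q)

  data NxC {D : Dy} : Pt D → Pt D → Set where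
    edge : ∀ {p q} → Nx p q → NxC p q
    close : NxC lst fst

  nx⇒near : ∀ {D} {p q : Pt D} → Nx p q → Near (D , p) (D , q)
  nx⇒near (nxt {u} {v}) = near (there (subst (λ x → D1 (mir (word u) ++ false ∷ word v) (mir x ++ true ∷ word v)) (sym (wd-fst u)) (D1-++ˡ (mir (word u)) here)))
                        (sym (cong (λ b → not (not b)) (odd-fst u)))
  nx⇒near (nxi {v = v} n) with nx⇒near n
  ... | near d o = near (there (D1-++ʳ (true ∷ word v) (D1-mir d))) (cong not o)
  nx⇒near (nxm {u} {v}) = near
    (subst₂ (λ x y → D1 (true ∷ x ++ true ∷ word v) (false ∷ reverse (word u) ++ true ∷ y))
      (sym (trans (cong mir (wd-lst u)) (cong reverse (neg-neg (word u))))) (sym (wd-fst v)) here)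
    (trans (cong not (odd-lst u)) (cong not (sym (odd-fst v))))
  nx⇒near (nxa {u} n) with nx⇒near n
  ... | near d o = near (there (D1-++ˡ (reverse (word u)) (there d))) o

  nxc⇒Ad : ∀ {D} {p q : Pt D} → NxC p q → Ad (D , p) (D , q)
  nxc⇒Ad (edge n) = near⇒Ad (nx⇒near n)
  nxc⇒Ad {D} close = ad (subst₂ _⊥ʷ_ (sym e₁) (sym e₂) (lem (word D)))
    where
    lem : ∀ w → (neg w ++ false ∷ []) ⊥ʷ (w ++ false ∷ [])
    lem []          = refl ∷ []
    lem (false ∷ w) = refl ∷ lem w
    lem (true ∷ w)  = refl ∷ lem w
    even : ∀ {D} (p : Pt D) → odd p ≡ false → enc (D , p) ≡ wd p ++ false ∷ []
    even p e with odd p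
    ... | false = refl
    e₁ : enc (D , lst) ≡ neg (word D) ++ false ∷ []
    e₁ = trans (even lst (odd-lst D)) (cong (_++ false ∷ []) (wd-lst D))
    e₂ : enc (D , fst) ≡ word D ++ false ∷ []
    e₂ = trans (even fst (odd-fst D)) (cong (_++ false ∷ []) (wd-fst D))

  no-nx-lst : ∀ {D} {q : Pt D} → ¬ Nx lst q
  no-nx-lst {u ◁ v} (nxa n) = no-nx-lst n

  nx-det : ∀ {D} {p q r : Pt D} → Nx p q → Nx p r → q ≡ r
  nx-det nxt nxt     = refl
  nx-det (nxi n) (nxi k) = cong inn (nx-det n k)
  nx-det (nxi n) nxm     = ⊥-elim (no-nx-lst n)
  nx-det nxm (nxi k) = ⊥-elim (no-nx-lst k)
  nx-det nxm nxm     = refl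
  nx-det (nxa n) (nxa k) = cong aft (nx-det n k)

  nxc-det : ∀ {D} {p q r : Pt D} → NxC p q → NxC p r → q ≡ r
  nxc-det (edge n) (edge k) = nx-det n k
  nxc-det (edge n) close     = ⊥-elim (no-nx-lst n)
  nxc-det close (edge k) = ⊥-elim (no-nx-lst k)
  nxc-det close close     = refl

  -- Opened cycles and the insertion of walks into edges.

  pts : ∀ D → List (Pt D)
  pts ε       = end ∷ []
  pts (u ◁ v) = top ∷ map inn (pts u) ++ map aft (pts v)

  ∈-pts : ∀ {D} (p : Pt D) → p ∈ pts D
  ∈-pts end     = here refl
  ∈-pts top     = here refl
  ∈-pts (inn p) = there (∈-++⁺ˡ (∈-map⁺ inn (∈-pts p)))
  ∈-pts (aft {u} q) = there (∈-++⁺ʳ (map inn (pts u)) (∈-map⁺ aft (∈-pts q)))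

  private
    mapW′ : ∀ {A B : Set} {R : A → A → Set} {R′ : B → B → Set} (f : A → B) → (∀ {x y} → R x y → R′ (f x) (f y)) →
            ∀ {x y xs} → Walk R x y xs → Walk R′ (f x) (f y) (map f xs)
    mapW′ f g (∎ a)   = ∎ (f a)
    mapW′ f g (r ∷ w) = g r ∷ mapW′ f g w

  walk-pts : ∀ D → Walk Nx (fst {D}) lst (pts D)
  walk-pts ε       = ∎ end
  walk-pts (u ◁ v) = nxt ∷ (mapW′ inn nxi (walk-pts u) ⟨ nxm ⟩ mapW′ aft nxa (walk-pts v))

  allV : Dy → List V
  allV D = map (D ,_) (pts D)

  -- Undirected, because inserted walks may be traversed backwards.
  data Cons {A : Set} (u v : A) : List A → Set where
    fwd   : ∀ {xs} → Cons u v (u ∷ v ∷ xs)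
    bwd   : ∀ {xs} → Cons u v (v ∷ u ∷ xs)
    there : ∀ {x xs} → Cons u v xs → Cons u v (x ∷ xs)

  cons-++ˡ : ∀ {A : Set} {u v : A} xs {ys} → Cons u v ys → Cons u v (xs ++ ys)
  cons-++ˡ []       c = c
  cons-++ˡ (_ ∷ xs) c = there (cons-++ˡ xs c)

  cons-++ʳ : ∀ {A : Set} {u v : A} {xs} ys → Cons u v xs → Cons u v (xs ++ ys)
  cons-++ʳ ys fwd       = fwd
  cons-++ʳ ys bwd       = bwd
  cons-++ʳ ys (there c) = there (cons-++ʳ ys c)

  cons-reverse : ∀ {A : Set} {u v : A} {xs} → Cons u v xs → Cons u v (reverse xs)
  cons-reverse {u = u} {v} (fwd {xs}) = subst (Cons u v) (sym (trans (unfold-reverse u (v ∷ xs)) (trans (cong (_++ u ∷ []) (unfold-reverse v xs)) (++-assoc (reverse xs) _ _)))) (cons-++ˡ (reverse xs) bwd)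
  cons-reverse {u = u} {v} (bwd {xs}) = subst (Cons u v) (sym (trans (unfold-reverse v (u ∷ xs)) (trans (cong (_++ v ∷ []) (unfold-reverse u xs)) (++-assoc (reverse xs) _ _)))) (cons-++ˡ (reverse xs) fwd)
  cons-reverse {u = u} {v} (there {x} {xs} c) = subst (Cons u v) (sym (unfold-reverse x xs)) (cons-++ʳ _ (cons-reverse c))

  walk-next : ∀ {A : Set} {R : A → A → Set} {a b p xs} → Walk R a b xs → p ∈ xs → p ≡ b ⊎ ∃ λ y → R p y × Cons p y xs
  walk-next (∎ _)         (here refl) = inj₁ refl
  walk-next (r ∷ ∎ b)     (here refl) = inj₂ (_ , r , fwd)
  walk-next (r ∷ (s ∷ w)) (here refl) = inj₂ (_ , r , fwd)
  walk-next (r ∷ w)       (there i) with walk-next w i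
  ... | inj₁ e           = inj₁ e
  ... | inj₂ (y , s , k) = inj₂ (y , s , there k)

  cons-map : ∀ {A B : Set} (f : A → B) {u v xs} → Cons u v xs → Cons (f u) (f v) (map f xs)
  cons-map f fwd       = fwd
  cons-map f bwd       = bwd
  cons-map f (there c) = there (cons-map f c)

  -- The edge `s → h` is given up for a gluing, and all other edges of the path stay available for
  -- later ones.
  record Opened (D : Dy) (s h : Pt D) : Set where
    field
      list  : List V
      walk  : Walk Ad (D , h) (D , s) list
      perm  : list ↭ allV D
      edges : ∀ {p q} → Nx p q → p ≢ s → Cons (D , p) (D , q) list

  openAt : ∀ {D} {s h : Pt D} → NxC s h → Opened D s h
  openAt {D} {s} {h} n with rotate {R = NxC} (∈-pts s) (_ , _ , mapW (λ _ → edge) (walk-pts D) , close)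
  ... | h′ , O , w , r , p with nxc-det n r
  ... | refl = record
    { list = map (D ,_) O ; walk = mapW′ (D ,_) nxc⇒Ad w ; perm = ↭-map (D ,_) p ; edges = edges }
    where
    edges : ∀ {p q} → Nx p q → p ≢ s → Cons (D , p) (D , q) (map (D ,_) O)
    edges {p′} n ne with walk-next w (∈-resp-↭ (↭-sym p) (∈-pts p′))
    ... | inj₁ e = ⊥-elim (ne e)
    ... | inj₂ (y , r , k) with nxc-det (edge n) r
    ... | refl = cons-map (D ,_) k

  Same : {A : Set} → A → A → A → A → Set
  Same s t u v = (s ≡ u × t ≡ v) ⊎ (s ≡ v × t ≡ u)

  private
    ins : ∀ {A : Set} {u v : A} {xs} → Cons u v xs → List A → List A
    ins {u = u} {v} (fwd {xs}) ys = u ∷ ys ++ v ∷ xs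
    ins {u = u} {v} (bwd {xs}) ys = v ∷ reverse ys ++ u ∷ xs
    ins (there {x} k)          ys = x ∷ ins k ys

    ins-keep : ∀ {A : Set} {u v s t : A} {xs} (k : Cons u v xs) ys → Cons s t xs → ¬ Same s t u v → Cons s t (ins k ys)
    ins-keep fwd ys fwd ne = ⊥-elim (ne (inj₁ (refl , refl)))
    ins-keep fwd ys bwd ne = ⊥-elim (ne (inj₂ (refl , refl)))
    ins-keep fwd ys (there k) ne = there (cons-++ˡ ys k)
    ins-keep bwd ys fwd ne = ⊥-elim (ne (inj₂ (refl , refl)))
    ins-keep bwd ys bwd ne = ⊥-elim (ne (inj₁ (refl , refl)))
    ins-keep bwd ys (there k) ne = there (cons-++ˡ (reverse ys) k)
    ins-keep (there fwd) ys fwd ne = fwd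
    ins-keep (there fwd) ys bwd ne = bwd
    ins-keep (there bwd) ys fwd ne = fwd
    ins-keep (there bwd) ys bwd ne = bwd
    ins-keep (there (there k)) ys fwd ne = fwd
    ins-keep (there (there k)) ys bwd ne = bwd
    ins-keep (there k) ys (there l) ne = there (ins-keep k ys l ne)

    ins-new : ∀ {A : Set} {u v s t : A} {xs} (k : Cons u v xs) ys → Cons s t ys → Cons s t (ins k ys)
    ins-new fwd ys l = there (cons-++ʳ _ l)
    ins-new bwd ys l = there (cons-++ʳ _ (cons-reverse l))
    ins-new (there k) ys l = there (ins-new k ys l)

    ins-perm : ∀ {A : Set} {u v : A} {xs} (k : Cons u v xs) ys → ins k ys ↭ xs ++ ys
    ins-perm {u = u} {v} (fwd {xs}) ys = prep u (++-comm ys (v ∷ xs))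
    ins-perm {u = u} {v} (bwd {xs}) ys = prep v (↭-trans (++-comm (reverse ys) (u ∷ xs)) (++⁺ˡ (u ∷ xs) (↭-reverse ys)))
    ins-perm (there {x} k) ys = prep x (ins-perm k ys)

    ins-walk : ∀ {u v p q ys a b xs} → Walk Ad a b xs → (k : Cons u v xs) → Walk Ad p q ys → Ad u p → Ad q v → Walk Ad a b (ins k ys)
    ins-walk (r ∷ ∎ v)      fwd w e f = e ∷ (w ⟨ f ⟩ (∎ v))
    ins-walk (r ∷ (s ∷ w′)) fwd w e f = e ∷ (w ⟨ f ⟩ (s ∷ w′))
    ins-walk (r ∷ ∎ u)      bwd w e f = Ad-sym f ∷ (reverseW Ad-sym w ⟨ Ad-sym e ⟩ (∎ u))
    ins-walk (r ∷ (s ∷ w′)) bwd w e f = Ad-sym f ∷ (reverseW Ad-sym w ⟨ Ad-sym e ⟩ (s ∷ w′))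
    ins-walk (∎ _) (there ()) w e f
    ins-walk (r ∷ w′) (there k) w e f = r ∷ ins-walk w′ k w e f

  -- A state is a list of walks with prescribed end points.
  Ends : Set
  Ends = List (V × V)

  St′ : Ends → List (List V) → Set
  St′ = Pointwise (λ e xs → Walk Ad (proj₁ e) (proj₂ e) xs)

  Ed : V → V → List (List V) → Set
  Ed u v = Any (Cons u v)

  -- Gluings are composed through `Keep` and `Add` alone: the first tells which old edges certainly
  -- survive, the second which edges can be used afterwards because of the new cycles.
  record Step (es : Ends) (zs : List (List V)) (new : List V) (Keep Add : V → V → Set) : Set where
    constructor step
    field
      out  : List (List V)
      st   : St′ es out
      perm : concat out ↭ concat zs ++ new
      keep : ∀ {s t} → Ed s t zs → Keep s t → Ed s t out
      add  : ∀ {s t} → Add s t → Ed s t out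

  -- The edge u v gives way to u p and q v. If `ys` is made of opened cycles, the edges given up and
  -- the new ones alternate on a 6-cycle or an 8-cycle.
  insertSt : ∀ {es zs u v p q ys} → St′ es zs → Ed u v zs → Walk Ad p q ys → Ad u p → Ad q v →
             Step es zs ys (λ s t → ¬ Same s t u v) (λ s t → Cons s t ys)
  insertSt {zs = xs ∷ zs} {ys = ys} (w ∷ st) (here k) v e f = step (ins k ys ∷ zs) (ins-walk w k v e f ∷ st)
    (↭-trans (++⁺ʳ (concat zs) (ins-perm k ys)) (↭-trans (↭-reflexive (++-assoc xs ys _)) (↭-trans (++⁺ˡ xs (++-comm ys _)) (↭-reflexive (sym (++-assoc xs _ _))))))
    (λ { (here l) ne → here (ins-keep k ys l ne) ; (there l) ne → there l })
    (λ l → here (ins-new k ys l))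
  insertSt {zs = xs ∷ zs} (w ∷ st) (there k) v e f with insertSt st k v e f
  ... | step out st′ perm keep add = step (xs ∷ out) (w ∷ st′)
    (↭-trans (++⁺ˡ xs perm) (↭-reflexive (sym (++-assoc xs _ _))))
    (λ { (here l) ne → here l ; (there l) ne → there (keep l ne) })
    (λ l → there (add l))

  -- Contexts.

  _≡ⱽ_ : V → V → Set
  _≡ⱽ_ = _≡_

  -- A surrounding that turns each word into a larger one and its points into points of the larger
  -- cycle. By `pt-near`, the edges between different cycles carry over as well, and with them every
  -- gluing cycle.
  record Ctx : Set where
    field
      cx      : Dy → Dy
      pt      : ∀ {x} → Pt x → Pt (cx x)
      pt-nx   : ∀ {x} {p q : Pt x} → Nx p q → Nx (pt p) (pt q)
      pt-near : ∀ {x y} {p : Pt x} {q : Pt y} → Near (x , p) (y , q) → Near (cx x , pt p) (cx y , pt q)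
      cx-inj  : ∀ {x y} → cx x ≡ cx y → x ≡ y
      pt-inj  : ∀ {x y} {p : Pt x} {q : Pt y} → (cx x , pt p) ≡ⱽ (cx y , pt q) → (x , p) ≡ⱽ (y , q)

    at : ∀ {x} → Pt x → V
    at {x} p = cx x , pt p

  open Ctx public

  idC : Ctx
  idC = record { cx = λ x → x ; pt = λ p → p ; pt-nx = λ n → n ; pt-near = λ n → n ; cx-inj = λ e → e ; pt-inj = λ e → e }

  infixr 7 _∘C_
  _∘C_ : Ctx → Ctx → Ctx
  C ∘C D = record
    { cx = λ x → cx C (cx D x) ; pt = λ p → pt C (pt D p) ; pt-nx = λ n → pt-nx C (pt-nx D n)
    ; pt-near = λ n → pt-near C (pt-near D n) ; cx-inj = λ e → cx-inj D (cx-inj C e) ; pt-inj = λ {x} {y} {p} {q} e → pt-inj D {x} {y} {p} {q} (pt-inj C {_} {_} {pt D p} {pt D q} e) }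

  preC : Dy → Ctx
  preC u = record
    { cx = u ◁_ ; pt = aft ; pt-nx = nxa
    ; pt-near = λ { (near d o) → near (there (D1-++ˡ (reverse (word u)) (there d))) o }
    ; cx-inj = λ { refl → refl } ; pt-inj = λ { refl → refl } }

  nestC : Ctx
  nestC = record
    { cx = _◁ ε ; pt = inn ; pt-nx = nxi
    ; pt-near = λ { (near d o) → near (there (D1-++ʳ _ (D1-mir d))) (cong not o) }
    ; cx-inj = λ { refl → refl } ; pt-inj = λ { refl → refl } }

  infixr 6 _⧺_
  _⧺_ : Dy → Dy → Dy
  ε       ⧺ s = s
  (u ◁ v) ⧺ s = u ◁ (v ⧺ s)

  emb : ∀ {x} s → Pt x → Pt (x ⧺ s)
  emb s end     = fst
  emb s top     = top
  emb s (inn p) = inn p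
  emb s (aft q) = aft (emb s q)

  word-⧺ : ∀ x s → word (x ⧺ s) ≡ word x ++ word s
  word-⧺ ε       s = refl
  word-⧺ (u ◁ v) s = cong (true ∷_) (trans (cong (λ y → mir (word u) ++ false ∷ y) (word-⧺ v s)) (sym (++-assoc (mir (word u)) (false ∷ word v) (word s))))

  wd-emb : ∀ {x} s (p : Pt x) → wd (emb s p) ≡ wd p ++ word s
  wd-emb s end = wd-fst s
  wd-emb s (top {u} {v}) = word-⧺ (u ◁ v) s
  wd-emb s (inn {u} {v} p) = cong (true ∷_) (trans (cong (λ y → mir (wd p) ++ true ∷ y) (word-⧺ v s)) (sym (++-assoc (mir (wd p)) (true ∷ word v) (word s))))
  wd-emb s (aft {u} {v} q) = cong (false ∷_) (trans (cong (λ y → reverse (word u) ++ true ∷ y) (wd-emb s q)) (sym (++-assoc (reverse (word u)) (true ∷ wd q) (word s))))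

  odd-emb : ∀ {x} s (p : Pt x) → odd (emb s p) ≡ odd p
  odd-emb s end     = odd-fst s
  odd-emb s top     = refl
  odd-emb s (inn p) = refl
  odd-emb s (aft q) = odd-emb s q

  emb-fst : ∀ x s → emb s (fst {x}) ≡ fst
  emb-fst ε       s = refl
  emb-fst (_ ◁ _) s = refl

  emb-nx : ∀ {x} s {p q : Pt x} → Nx p q → Nx (emb s p) (emb s q)
  emb-nx s nxt = nxt
  emb-nx s (nxi n) = nxi n
  emb-nx s (nxm {u} {v}) = subst (λ y → Nx (inn lst) (aft y)) (sym (emb-fst v s)) nxm
  emb-nx s (nxa n) = nxa (emb-nx s n)

  size-⧺ : ∀ x s → size (x ⧺ s) ≡ size x + size s
  size-⧺ ε       s = refl
  size-⧺ (u ◁ v) s = cong suc (trans (cong (size u +_) (size-⧺ v s)) (sym (ℕₚ.+-assoc (size u) (size v) (size s))))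

  snoc-inj : ∀ x y {w w′} → x ⧺ (w ◁ ε) ≡ y ⧺ (w′ ◁ ε) → x ≡ y × w ≡ w′
  snoc-inj ε             ε             refl = refl , refl
  snoc-inj ε             (_ ◁ ε)       ()
  snoc-inj ε             (_ ◁ (_ ◁ _)) ()
  snoc-inj (_ ◁ ε)       ε             ()
  snoc-inj (_ ◁ (_ ◁ _)) ε             ()
  snoc-inj (u ◁ v)       (u′ ◁ v′)     e with lem e
    where lem : ∀ {a b c d} → a ◁ b ≡ c ◁ d → a ≡ c × b ≡ d
          lem refl = refl , refl
  ... | refl , e′ with snoc-inj v v′ e′
  ... | refl , refl = refl , refl

  emb-inj : ∀ {x} w {p q : Pt x} → emb (w ◁ ε) p ≡ emb (w ◁ ε) q → p ≡ q
  emb-inj w {end}   {end}   _ = refl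
  emb-inj w {top}   {top}   _ = refl
  emb-inj w {inn p} {inn q} e = cong inn (lem e)
    where lem : ∀ {u v} {p q : Pt u} → inn {u} {v} p ≡ inn q → p ≡ q
          lem refl = refl
  emb-inj w {aft p} {aft q} e = cong aft (emb-inj w (lem e))
    where lem : ∀ {u v} {p q : Pt v} → aft {u} {v} p ≡ aft q → p ≡ q
          lem refl = refl

  sufC : Dy → Ctx
  sufC w = record
    { cx = _⧺ (w ◁ ε) ; pt = emb (w ◁ ε) ; pt-nx = emb-nx (w ◁ ε)
    ; pt-near = λ { {p = p} {q} (near d o) → near (subst₂ D1 (sym (wd-emb (w ◁ ε) p)) (sym (wd-emb (w ◁ ε) q)) (D1-++ʳ _ d))
                    (trans (odd-emb (w ◁ ε) p) (trans o (cong not (sym (odd-emb (w ◁ ε) q))))) }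
    ; cx-inj = λ {x} {y} e → proj₁ (snoc-inj x y e) ; pt-inj = λ { {x} {y} {p} {q} e → go x y p q e } }
    where
    Σ-≡ : ∀ {D E : Dy} {p : Pt D} {q : Pt E} → (D , p) ≡ⱽ (E , q) → Σ (D ≡ E) λ e → subst Pt e p ≡ q
    Σ-≡ refl = refl , refl
    go : ∀ x y (p : Pt x) (q : Pt y) → (x ⧺ (w ◁ ε) , emb (w ◁ ε) p) ≡ⱽ (y ⧺ (w ◁ ε) , emb (w ◁ ε) q) → (x , p) ≡ⱽ (y , q)
    go x y p q e with Σ-≡ e
    ... | e₁ , e₂ with snoc-inj x y e₁
    go x .x p q e | refl , e₂ | refl , refl = cong (x ,_) (emb-inj w e₂)

  -- Points strictly inside the last component.
  data Inside : ∀ {D} → Pt D → Set where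
    ini : ∀ {u p} → Inside (inn {u} {ε} p)
    ina : ∀ {u v q} → Inside q → Inside (aft {u} {v} q)

  emb-not-inside : ∀ {x} w (p : Pt x) → ¬ Inside (emb (w ◁ ε) p)
  emb-not-inside w end ()
  emb-not-inside w (top {u} {v}) ()
  emb-not-inside w (inn {u} {ε} p) ()
  emb-not-inside w (inn {u} {_ ◁ _} p) ()
  emb-not-inside w (aft {u} {ε} end) (ina ())
  emb-not-inside w (aft {u} {_ ◁ _} q) (ina k) = emb-not-inside w q k

  open import Algebra.Solver.CommutativeMonoid (++-commutativeMonoid {A = V}) using (prove; var; _⊕_; id)

  -- The second operation acts on an unknown state and is told only what survives the first and what
  -- the first adds; its requirements have to follow from these.
  _then_ : ∀ {es zs n₁ n₂ K₁ K₂ A₁ A₂} → Step es zs n₁ K₁ A₁ →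
    (∀ {out} → St′ es out → (∀ {s t} → Ed s t zs → K₁ s t → Ed s t out) → (∀ {s t} → A₁ s t → Ed s t out) → Step es out n₂ K₂ A₂) →
    Step es zs (n₁ ++ n₂) (λ s t → K₁ s t × K₂ s t) (λ s t → A₁ s t × K₂ s t ⊎ A₂ s t)
  _then_ {zs = zs} {n₁} {n₂} (step out st perm keep add) f with f st keep add
  ... | step out′ st′ perm′ keep′ add′ = step out′ st′
    (↭-trans perm′ (↭-trans (++⁺ʳ n₂ perm) (↭-reflexive (++-assoc (concat zs) n₁ n₂))))
    (λ { k (a , b) → keep′ (keep k a) b }) (λ { (inj₁ (a , b)) → keep′ (add a) b ; (inj₂ a) → add′ a })

  weaken : ∀ {es zs n n′ K K′ A A′} → n ↭ n′ → (∀ {s t} → K′ s t → K s t) → (∀ {s t} → A′ s t → A s t) →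
           Step es zs n K A → Step es zs n′ K′ A′
  weaken {zs = zs} p f g (step out st perm keep add) =
    step out st (↭-trans perm (++⁺ˡ (concat zs) p)) (λ k a → keep k (f a)) (λ a → add (g a))

  -- The recursive gluing operations.

  Hole : Ctx → V → Set
  Hole C u = ∃ λ x → Σ (Pt x) λ p → u ≡ at C p

  data Back : ∀ {x} → Pt x → Set where
    back : ∀ {v q} → Back (aft {ε} {v} q)

  Bad : Ctx → V → Set
  Bad C u = ∃ λ x → Σ (Pt x) λ p → u ≡ at C p × ¬ Back p

  -- An edge of the tree C[x] that does not lie in the hole of C.
  record OutE (C : Ctx) (x : Dy) (s t : V) : Set where
    constructor out
    field
      {p q} : Pt (cx C x)
      nx    : Nx p q
      s≡    : s ≡ (cx C x , p)
      t≡    : t ≡ (cx C x , q)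
      far   : ¬ (Hole C s × Hole C t)

  blk : Ctx → List Dy → List V
  blk C L = concatMap (λ x → allV (cx C x)) L

  blk-++ : ∀ C L M → blk C (L ++ M) ≡ blk C L ++ blk C M
  blk-++ C L M = concatMap-++ (λ x → allV (cx C x)) L M

  blk-map : ∀ C D L → blk C (map (cx D) L) ≡ blk (C ∘C D) L
  blk-map C D L = concatMap-map (λ x → allV (cx C x)) (cx D) L

  RKeep : Ctx → V → V → Set
  RKeep C s t = ¬ (Bad C s × Bad C t)

  RAdd : Ctx → List Dy → V → V → Set
  RAdd C L s t = ∃ λ x → x ∈ L × OutE C x s t

  Enum : (Dy → Set) → List Dy → Set
  Enum P L = Unique L × (∀ {x} → x ∈ L → P x) × (∀ {x} → P x → x ∈ L)

  IsTen : Dy → Set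
  IsTen x = ∃ λ v → x ≡ ε ◁ v

  NewR : ℕ → Dy → Set
  NewR k x = size x ≡ k × ¬ IsTen x

  -- The first edge of the cycle of each word 10v is all that `ROp` demands of the state.
  Idx0 : Ctx → ℕ → List (List V) → Set
  Idx0 C k zs = ∀ v → suc (size v) ≡ k → Ed (at C (top {ε} {v})) (at C (inn {ε} {v} end)) zs

  -- Attach all words not starting with 10 to those starting with 10.
  ROp : ℕ → Set
  ROp k = Σ (List Dy) λ L → Enum (NewR k) L ×
    (∀ C {es zs} → St′ es zs → Idx0 C k zs → Step es zs (blk C L) (RKeep C) (RAdd C L))

  Sing : ℕ → Dy → Set
  Sing k x = size x ≡ k × ∃ λ u → x ≡ u ◁ ε

  -- A walk through all words with one component that fits into the edge mt → mh of M.
  QOp : ℕ → (M : Dy) → Pt M → Pt M → Set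
  QOp k M mt mh = Nx mt mh × Σ (List Dy) λ L → Enum (Sing k) L ×
    (∀ C → ∃ λ P → ∃₂ λ p q → Walk Ad p q P × Ad (at C mt) p × Ad q (at C mh) × P ↭ blk C L ×
       (∀ {s t} → RAdd C L s t → Cons s t P))

  hole-∘ : ∀ {C D u} → Hole (C ∘C D) u → Hole C u
  hole-∘ {D = D} (x , p , e) = cx D x , pt D p , e

  out-∘ : ∀ {C D x s t} → OutE C (cx D x) s t → OutE (C ∘C D) x s t
  out-∘ {C} {D} (out n a b f) = out n a b (λ { (h , k) → f (hole-∘ {C} {D} h , hole-∘ {C} {D} k) })

  bad⇒hole : ∀ {C u} → Bad C u → Hole C u
  bad⇒hole (x , p , e , _) = x , p , e

  bad-suf : ∀ {C w u} → Bad (C ∘C sufC w) u → Bad C u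
  bad-suf {C} {w} (x , p , e , nb) = x ⧺ (w ◁ ε) , emb (w ◁ ε) p , e , λ b → nb (lem x p b)
    where
    lem : ∀ x (p : Pt x) → Back (emb (w ◁ ε) p) → Back p
    lem ε       end     ()
    lem (ε ◁ v) (aft q) back = back
    lem ((_ ◁ _) ◁ v) (aft q) ()

  -- Successors are unique: if `s` were the tail of an edge of the hole, the whole edge from `s` to
  -- `t` would lie in the hole. So opening a cycle inside the hole costs no edge outside it.
  out-slot : ∀ {C x s t} {p h : Pt x} → OutE C x s t → Nx p h → s ≢ at C p
  out-slot {C} (out n refl refl f) k refl with nx-det n (pt-nx C k)
  ... | refl = f ((_ , _ , refl) , (_ , _ , refl))

  op : ∀ C {x} {p h : Pt x} → Nx p h → Opened (cx C x) (pt C p) (pt C h)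
  op C n = openAt (edge (pt-nx C n))

  out-open : ∀ {C x s t} {p : Pt x} {h} (O : Opened (cx C x) (pt C p) h) → OutE C x s t → s ≢ at C p → Cons s t (Opened.list O)
  out-open O (out n refl refl f) ne = Opened.edges O n (λ { refl → ne refl })

  out-op : ∀ C {x s t} {p h : Pt x} (n : Nx p h) → OutE C x s t → Cons s t (Opened.list (op C n))
  out-op C n o = out-open {C} (op C n) o (out-slot {C} o n)

  hole-at : ∀ C {x} (p : Pt x) → Hole C (at C p)
  hole-at C p = _ , p , refl

  bad-at : ∀ C {x} (p : Pt x) → ¬ Back p → Bad C (at C p)
  bad-at C p nb = _ , p , refl , nb

  out-same : ∀ {C x s t u v} → OutE C x s t → Hole C u → Hole C v → ¬ Same s t u v
  out-same o hu hv (inj₁ (refl , refl)) = OutE.far o (hu , hv)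
  out-same o hu hv (inj₂ (refl , refl)) = OutE.far o (hv , hu)

  bad-same : ∀ {C s t u v} → RKeep C s t → Bad C u → Bad C v → ¬ Same s t u v
  bad-same k bu bv (inj₁ (refl , refl)) = k (bu , bv)
  bad-same k bu bv (inj₂ (refl , refl)) = k (bv , bu)

  -- Gluings of the words of sizes 3 and 4.

  private
    eqW : Word → Word → Bool
    eqW []          []          = true
    eqW (true ∷ v)  (true ∷ w)  = eqW v w
    eqW (false ∷ v) (false ∷ w) = eqW v w
    eqW _           _           = false

    eqW-sound : ∀ v w → eqW v w ≡ true → v ≡ w
    eqW-sound []          []          _ = refl
    eqW-sound (true ∷ v)  (true ∷ w)  e = cong (true ∷_) (eqW-sound v w e)
    eqW-sound (false ∷ v) (false ∷ w) e = cong (false ∷_) (eqW-sound v w e)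

  d1? : Word → Word → Bool
  d1? (true ∷ v)  (true ∷ w)  = d1? v w
  d1? (false ∷ v) (false ∷ w) = d1? v w
  d1? (true ∷ v)  (false ∷ w) = eqW v w
  d1? (false ∷ v) (true ∷ w)  = eqW v w
  d1? _           _           = false

  d1-sound : ∀ v w → d1? v w ≡ true → D1 v w
  d1-sound (true ∷ v)  (true ∷ w)  e = there (d1-sound v w e)
  d1-sound (false ∷ v) (false ∷ w) e = there (d1-sound v w e)
  d1-sound (true ∷ v)  (false ∷ w) e = subst (λ x → D1 (true ∷ v) (false ∷ x)) (eqW-sound v w e) here
  d1-sound (false ∷ v) (true ∷ w)  e = subst (λ x → D1 (false ∷ v) (true ∷ x)) (eqW-sound v w e) here

  -- The bit flip is tested by evaluation on the small words and carried into the context by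
  -- `pt-near`, so that `refl` settles each edge of a gluing cycle.
  ad! : ∀ C {x y} (p : Pt x) (q : Pt y) → d1? (wd p) (wd q) ≡ true → odd p ≡ not (odd q) → Ad (at C p) (at C q)
  ad! C p q d o = near⇒Ad (pt-near C {p = p} {q} (near (d1-sound (wd p) (wd q) d) o))

  -- As words: `tA` is 101010, `tB` 101100, `tC` 110100, `tD` 110010, `tR` 111000 and `tE` 11001100.
  -- Below, `b4` is point 4 of `tB`, counted from 0, and `n-b4` is the edge from it to the next
  -- point; likewise for the other letters.
  ten tA tB tC tD tR tE : Dy
  ten = ε ◁ ε
  tA = ε ◁ ε ◁ ε ◁ ε
  tB = ε ◁ ten ◁ ε
  tC = (ε ◁ ε ◁ ε) ◁ ε
  tD = ten ◁ ten
  tR = (ten ◁ ε) ◁ ε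
  tE = ten ◁ ten ◁ ε

  a4 a5 : Pt tA
  a4 = aft (aft top)
  a5 = aft (aft (inn end))
  b0 b1 b4 b5 : Pt tB
  b0 = top
  b1 = inn end
  b4 = aft (inn (inn end))
  b5 = aft (inn (aft end))
  c0 c1 c3 c4 c5 c6 : Pt tC
  c0 = top
  c1 = inn top
  c3 = inn (aft top)
  c4 = inn (aft (inn end))
  c5 = inn (aft (aft end))
  c6 = aft end
  d0 d1 d2 d3 : Pt tD
  d0 = top
  d1 = inn top
  d2 = inn (inn end)
  d3 = inn (aft end)
  r1 r2 r3 r4 r5 r6 : Pt tR
  r1 = inn top
  r2 = inn (inn top)
  r3 = inn (inn (inn end))
  r4 = inn (inn (aft end))
  r5 = inn (aft end)
  r6 = aft end
  e1 e2 : Pt tE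
  e1 = inn top
  e2 = inn (inn end)

  n-a4 : Nx a4 a5
  n-a4 = nxa (nxa nxt)
  n-b0 : Nx b0 b1
  n-b0 = nxt
  n-b4 : Nx b4 b5
  n-b4 = nxa (nxi nxm)
  n-c0 : Nx c0 c1
  n-c0 = nxt
  n-c3 : Nx c3 c4
  n-c3 = nxi (nxa nxt)
  n-c5 : Nx c5 c6
  n-c5 = nxm
  n-d1 : Nx d1 d2
  n-d1 = nxi nxt
  n-d2 : Nx d2 d3
  n-d2 = nxi nxm
  n-r1 : Nx r1 r2
  n-r1 = nxi nxt
  n-r2 : Nx r2 r3
  n-r2 = nxi (nxi nxt)
  n-r3 : Nx r3 r4
  n-r3 = nxi (nxi nxm)
  n-r4 : Nx r4 r5
  n-r4 = nxi nxm
  n-r5 : Nx r5 r6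
  n-r5 = nxm
  n-e1 : Nx e1 e2
  n-e1 = nxi nxt

  open Opened using (list; walk; perm; edges)

  rev : ∀ {D s h} (O : Opened D s h) → Walk Ad (D , s) (D , h) (reverse (list O))
  rev O = reverseW Ad-sym (walk O)

  rev-perm : ∀ {D s h} (O : Opened D s h) → reverse (list O) ↭ allV D
  rev-perm O = ↭-trans (↭-reverse (list O)) (perm O)

  -- The 8-cycle 101100@0, 110010@2, 111000@4, 110100@0, where w@i is the i-th edge of the cycle of w.
  r-op3 : ROp 3
  r-op3 = tD ∷ tR ∷ tC ∷ [] , (u , snd , full) , run
    where
    u : Unique (tD ∷ tR ∷ tC ∷ [])
    u = ((λ ()) ∷ (λ ()) ∷ []) ∷ ((λ ()) ∷ []) ∷ [] ∷ []
    snd : ∀ {x} → x ∈ tD ∷ tR ∷ tC ∷ [] → NewR 3 x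
    snd (here refl)                 = refl , λ ()
    snd (there (here refl))         = refl , λ ()
    snd (there (there (here refl))) = refl , λ ()
    full : ∀ {x} → NewR 3 x → x ∈ tD ∷ tR ∷ tC ∷ []
    full {ε ◁ v} (_ , nt) = ⊥-elim (nt (v , refl))
    full {(ε ◁ ε) ◁ ε} (() , _)
    full {(ε ◁ ε) ◁ (ε ◁ ε)} _ = here refl
    full {(ε ◁ ε) ◁ (ε ◁ (_ ◁ _))} (() , _)
    full {(ε ◁ ε) ◁ ((_ ◁ _) ◁ _)} (() , _)
    full {(ε ◁ (ε ◁ ε)) ◁ ε} _ = there (there (here refl))
    full {(ε ◁ (ε ◁ ε)) ◁ (_ ◁ _)} (() , _)
    full {(ε ◁ (ε ◁ (_ ◁ _))) ◁ _} (() , _)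
    full {(ε ◁ ((_ ◁ _) ◁ _)) ◁ _} (() , _)
    full {((ε ◁ ε) ◁ ε) ◁ ε} _ = there (here refl)
    full {((ε ◁ ε) ◁ ε) ◁ (_ ◁ _)} (() , _)
    full {((ε ◁ ε) ◁ (_ ◁ _)) ◁ _} (() , _)
    full {((ε ◁ (_ ◁ _)) ◁ _) ◁ _} (() , _)
    full {(((_ ◁ _) ◁ _) ◁ _) ◁ _} (() , _)
    run : ∀ C {es zs} → St′ es zs → Idx0 C 3 zs → Step es zs (blk C (tD ∷ tR ∷ tC ∷ [])) (RKeep C) (RAdd C (tD ∷ tR ∷ tC ∷ []))
    run C st ix = weaken pm (λ k → bad-same {C} k (bad-at C b0 (λ ())) (bad-at C b1 (λ ()))) add
      (insertSt st (ix (ten ◁ ε) refl)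
        (walk Od ⟨ ad! C d2 r5 refl refl ⟩ (walk Or ⟨ ad! C r4 c1 refl refl ⟩ walk Oc))
        (ad! C b0 d3 refl refl) (ad! C c0 b1 refl refl))
      where
      Od = op C n-d2
      Or = op C n-r4
      Oc = op C n-c0
      pm : list Od ++ (list Or ++ list Oc) ↭ blk C (tD ∷ tR ∷ tC ∷ [])
      pm = ++⁺ (perm Od) (++⁺ (perm Or) (↭-trans (perm Oc) (↭-reflexive (sym (++-identityʳ _)))))
      add : ∀ {s t} → RAdd C (tD ∷ tR ∷ tC ∷ []) s t → Cons s t (list Od ++ (list Or ++ list Oc))
      add (_ , here refl , o)                 = cons-++ʳ _ (out-op C n-d2 o)
      add (_ , there (here refl) , o)         = cons-++ˡ (list Od) (cons-++ʳ _ (out-op C n-r4 o))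
      add (_ , there (there (here refl)) , o) = cons-++ˡ (list Od) (cons-++ˡ (list Or) (out-op C n-c0 o))

  -- The last component is recovered from a word, so operations in the contexts `sufC w` for
  -- different `w` concern disjoint sets of words.
  hole-snoc : ∀ {C} x {w w′} {p} → Hole (C ∘C sufC w) (cx C (x ⧺ (w′ ◁ ε)) , p) → w ≡ w′
  hole-snoc {C} x (y , q , e) = sym (proj₂ (snoc-inj x y (cx-inj C (cong proj₁ e))))

  -- Size 4 lies below the range of `Big`. Of its nine words, three end in 10 and come from size 3;
  -- the other six form one walk, which is inserted into the first edge of 10110100.
  r-op4 : ROp 4
  r-op4 = L , (u , snd , full) , run
    where
    L3 = proj₁ r-op3
    L0 L1 L : List Dy
    L0 = tR ◁ ε ∷ tD ◁ ε ∷ tA ◁ ε ∷ tE ∷ tC ◁ ε ∷ tB ◁ ε ∷ []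
    L1 = map (_⧺ ten) L3
    L  = L1 ++ L0
    u : Unique L
    u = ((λ ()) ∷ (λ ()) ∷ (λ ()) ∷ (λ ()) ∷ (λ ()) ∷ (λ ()) ∷ (λ ()) ∷ (λ ()) ∷ []) ∷
        ((λ ()) ∷ (λ ()) ∷ (λ ()) ∷ (λ ()) ∷ (λ ()) ∷ (λ ()) ∷ (λ ()) ∷ []) ∷
        ((λ ()) ∷ (λ ()) ∷ (λ ()) ∷ (λ ()) ∷ (λ ()) ∷ (λ ()) ∷ []) ∷
        ((λ ()) ∷ (λ ()) ∷ (λ ()) ∷ (λ ()) ∷ (λ ()) ∷ []) ∷
        ((λ ()) ∷ (λ ()) ∷ (λ ()) ∷ (λ ()) ∷ []) ∷
        ((λ ()) ∷ (λ ()) ∷ (λ ()) ∷ []) ∷ ((λ ()) ∷ (λ ()) ∷ []) ∷ ((λ ()) ∷ []) ∷ [] ∷ []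
    snd : ∀ {x} → x ∈ L → NewR 4 x
    snd (here refl) = refl , λ ()
    snd (there (here refl)) = refl , λ ()
    snd (there (there (here refl))) = refl , λ ()
    snd (there (there (there (here refl)))) = refl , λ ()
    snd (there (there (there (there (here refl))))) = refl , λ ()
    snd (there (there (there (there (there (here refl)))))) = refl , λ ()
    snd (there (there (there (there (there (there (here refl))))))) = refl , λ ()
    snd (there (there (there (there (there (there (there (here refl)))))))) = refl , λ ()
    snd (there (there (there (there (there (there (there (there (here refl))))))))) = refl , λ ()
    sub3 : ∀ x → size x ≡ 3 → x ◁ ε ∈ L
    sub3 (ε ◁ ε) ()
    sub3 (ε ◁ (ε ◁ ε)) ()
    sub3 (ε ◁ (ε ◁ (ε ◁ ε))) _ = there (there (there (there (there (here refl)))))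
    sub3 (ε ◁ (ε ◁ (ε ◁ (_ ◁ _)))) ()
    sub3 (ε ◁ (ε ◁ ((_ ◁ _) ◁ _))) ()
    sub3 (ε ◁ ((ε ◁ ε) ◁ ε)) _ = there (there (there (there (there (there (there (there (here refl))))))))
    sub3 (ε ◁ ((ε ◁ ε) ◁ (_ ◁ _))) ()
    sub3 (ε ◁ ((ε ◁ (_ ◁ _)) ◁ _)) ()
    sub3 (ε ◁ (((_ ◁ _) ◁ _) ◁ _)) ()
    sub3 x@((_ ◁ _) ◁ _) e with proj₂ (proj₂ (proj₁ (proj₂ r-op3))) {x} (e , λ ())
    ... | here refl                 = there (there (there (there (here refl))))
    ... | there (here refl)         = there (there (there (here refl)))
    ... | there (there (here refl)) = there (there (there (there (there (there (there (here refl)))))))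
    sz1 : ∀ x → size x ≡ 1 → x ≡ ten
    sz1 (ε ◁ ε) _ = refl
    sz1 (ε ◁ (_ ◁ _)) ()
    sz1 ((_ ◁ _) ◁ _) ()
    sz2 : ∀ x → size x ≡ 2 → x ≡ ε ◁ ten ⊎ x ≡ ten ◁ ε
    sz2 (ε ◁ ε) ()
    sz2 (ε ◁ (ε ◁ ε)) _ = inj₁ refl
    sz2 (ε ◁ (ε ◁ (_ ◁ _))) ()
    sz2 (ε ◁ ((_ ◁ _) ◁ _)) ()
    sz2 ((ε ◁ ε) ◁ ε) _ = inj₂ refl
    sz2 ((ε ◁ ε) ◁ (_ ◁ _)) ()
    sz2 ((ε ◁ (_ ◁ _)) ◁ _) ()
    sz2 (((_ ◁ _) ◁ _) ◁ _) ()
    full : ∀ {x} → NewR 4 x → x ∈ L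
    full {ε ◁ v} (_ , nt) = ⊥-elim (nt (v , refl))
    full {u@(_ ◁ _) ◁ ε} (e , _) = sub3 u (trans (sym (ℕₚ.+-identityʳ _)) (ℕₚ.suc-injective e))
    full {u@(p ◁ q) ◁ v@(x ◁ y)} (e , _) = two (size p + size q) refl
      where
      tot : size p + size q + (size x + size y) ≡ 1
      tot = ℕₚ.suc-injective (trans (sym (ℕₚ.+-suc _ _)) (ℕₚ.suc-injective (ℕₚ.suc-injective e)))
      two : ∀ a → size p + size q ≡ a → u ◁ v ∈ L
      two zero eq with sz1 u (cong suc eq) | sz2 v (cong suc (trans (sym (cong (_+ (size x + size y)) eq)) tot))
      ... | refl | inj₁ refl = here refl
      ... | refl | inj₂ refl = there (there (there (there (there (there (here refl))))))
      two (suc a) eq with sz2 u (cong suc (trans eq (cong suc (ℕₚ.m+n≡0⇒m≡0 a rest)))) | sz1 v (cong suc (ℕₚ.m+n≡0⇒n≡0 a rest))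
        where rest : a + (size x + size y) ≡ 0
              rest = ℕₚ.suc-injective (trans (sym (cong (_+ (size x + size y)) eq)) tot)
      ... | inj₁ refl | refl = there (there (here refl))
      ... | inj₂ refl | refl = there (here refl)
    run : ∀ C {es zs} → St′ es zs → Idx0 C 4 zs → Step es zs (blk C L) (RKeep C) (RAdd C L)
    run C {es} {zs} st ix = weaken pm keep add
      (proj₂ (proj₂ r-op3) (C ∘C sufC ε) st (λ v e → ix (v ⧺ ten) (cong suc (trans (size-⧺ v ten) (trans (ℕₚ.+-comm (size v) 1) e)))) then
        λ st′ keep add → insertSt st′ (keep (ix tC refl) far) (reverseW Ad-sym (proj₁ yw) ⟨ ad! CN r3 b0 refl refl ⟩ walk Ob)
          (ad! C {ε ◁ tC} {tR ◁ ε} top (inn r2) refl refl) (ad! C {tB ◁ ε} {ε ◁ tC} top (inn end) refl refl))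
      where
      CN = C ∘C nestC
      Or = op CN n-r2
      Od = op CN n-d1
      Oa = op CN n-a4
      Oe = op C n-e1
      Oc = op CN n-c3
      n-b′ : Nx {tB ◁ ε} top (inn b0)
      n-b′ = nxt
      Ob = op C n-b′
      -- The operation of size 3 uses up edges of words ending in 10 only, and 10110100 is not one
      -- of them.
      far : RKeep (C ∘C sufC ε) (at C (top {ε} {tC})) (at C (inn {ε} {tC} end))
      far (h , _) with hole-snoc {C} ten {w′ = ε ◁ ε ◁ ε} (bad⇒hole {C ∘C sufC ε} h)
      ... | ()
      ends : V × V
      ends = at CN r3 , at CN r2
      -- Three 6-cycles attach the six words: `s₁` joins `tR`, `tD` and `tA`, all nested in one
      -- component; `s₂` joins the nested `tD` and `tC` with `tE`; the insertion at the top of `run`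
      -- joins 10110100 with the nested `tR` and `tB`.
      s₁ = insertSt {ends ∷ []} {list Or ∷ []} (walk Or ∷ []) (here (edges Or (pt-nx CN n-r5) (λ { e → r5≢ (pt-inj CN {p = r5} {r2} (cong (cx CN tR ,_) e)) })))
             (walk Od ⟨ ad! CN d1 a4 refl refl ⟩ rev Oa) (ad! CN r5 d2 refl refl) (ad! CN a5 r6 refl refl)
        where r5≢ : (tR , r5) ≡ⱽ (tR , r2) → ⊥
              r5≢ ()
      d′ : Ed (at C (top {tD} {ε})) (at CN d0) (Step.out s₁)
      d′ = Step.add s₁ (cons-++ʳ _ (edges Od (pt-nx C nxt) (λ { e → ne (pt-inj C {p = top} {inn d1} (cong (cx C (tD ◁ ε) ,_) e)) })))
        where ne : (tD ◁ ε , top) ≡ⱽ (tD ◁ ε , inn d1) → ⊥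
              ne ()
      s₂ = insertSt (Step.st s₁) d′ (rev Oe ⟨ ad! C e2 (inn {tC} {ε} c4) refl refl ⟩ walk Oc)
             (ad! C (top {tD} {ε}) e1 refl refl) (ad! CN c3 d0 refl refl)
      single : ∀ {zs} → St′ (ends ∷ []) zs → ∃ λ Y → zs ≡ Y ∷ [] × Walk Ad (at CN r3) (at CN r2) Y
      single (w ∷ []) = _ , refl , w
      Y = proj₁ (single (Step.st s₂))
      out≡ : Step.out s₂ ≡ Y ∷ []
      out≡ = proj₁ (proj₂ (single (Step.st s₂)))
      yw : Walk Ad (at CN r3) (at CN r2) Y × (∀ {s t} → Ed s t (Step.out s₂) → Cons s t Y)
      yw = proj₂ (proj₂ (single (Step.st s₂))) , λ k → un (subst (Ed _ _) out≡ k)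
        where un : ∀ {s t Y} → Ed s t (Y ∷ []) → Cons s t Y
              un (here k) = k
      yp : Y ↭ ((list Or ++ []) ++ (list Od ++ reverse (list Oa))) ++ (reverse (list Oe) ++ list Oc)
      yp = ↭-trans (↭-reflexive (sym (trans (cong concat out≡) (++-identityʳ Y)))) (↭-trans (Step.perm s₂) (++⁺ʳ _ (Step.perm s₁)))
      pm : blk (C ∘C sufC ε) L3 ++ (reverse Y ++ list Ob) ↭ blk C L
      pm = ↭-trans (++⁺ (↭-reflexive (sym (blk-map C (sufC ε) L3)))
             (↭-trans (++⁺ (↭-trans (↭-reverse Y) (↭-trans yp
                (++⁺ (++⁺ (++⁺ʳ [] (perm Or)) (++⁺ (perm Od) (rev-perm Oa))) (++⁺ (rev-perm Oe) (perm Oc))))) (perm Ob))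
              (prove 6 ((((var (# 0) ⊕ id) ⊕ (var (# 1) ⊕ var (# 2))) ⊕ (var (# 3) ⊕ var (# 4))) ⊕ var (# 5))
                       (var (# 0) ⊕ (var (# 1) ⊕ (var (# 2) ⊕ (var (# 3) ⊕ (var (# 4) ⊕ (var (# 5) ⊕ id))))))
                       (allV (cx C (tR ◁ ε)) ∷ allV (cx C (tD ◁ ε)) ∷ allV (cx C (tA ◁ ε)) ∷ allV (cx C tE) ∷ allV (cx C (tC ◁ ε)) ∷ allV (cx C (tB ◁ ε)) ∷ []))))
             (↭-reflexive (sym (blk-++ C L1 L0)))
      keep : ∀ {s t} → RKeep C s t → RKeep (C ∘C sufC ε) s t × ¬ Same s t (at C (top {ε} {tC})) (at C (inn {ε} {tC} end))
      keep k = (λ { (a , b) → k (bad-suf {C} {ε} a , bad-suf {C} {ε} b) }) , bad-same {C} k (bad-at C top (λ ())) (bad-at C (inn end) (λ ()))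
      inY : ∀ {s t} → Cons s t Y → Cons s t (reverse Y ++ list Ob)
      inY k = cons-++ʳ _ (cons-reverse k)
      kp₂ : ∀ {x s t} → OutE C x s t → Ed s t (Step.out s₁) → Cons s t Y
      kp₂ o k = proj₂ yw (Step.keep s₂ k (out-same {C} o (hole-at C (top {tD} {ε})) (hole-at C (inn {tD} {ε} d0))))
      kp₁ : ∀ {x s t} → OutE C x s t → Cons s t (list Or) → Cons s t Y
      kp₁ o k = kp₂ o (Step.keep s₁ (here k) (out-same {C} o (hole-at C (inn {tR} {ε} r5)) (hole-at C (inn {tR} {ε} r6))))
      add : ∀ {s t} → RAdd C L s t → (RAdd (C ∘C sufC ε) L3 s t × ¬ Same s t (at C (top {ε} {tC})) (at C (inn {ε} {tC} end))) ⊎ Cons s t (reverse Y ++ list Ob)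
      add (x , k , o) with ∈-++⁻ L1 k
      ... | inj₁ k₁ with ∈-map⁻ (_⧺ ten) k₁
      ...   | y , k₂ , refl = inj₁ ((y , k₂ , out-∘ {C} {sufC ε} o) , out-same {C} o (hole-at C top) (hole-at C (inn end)))
      add (x , k , o) | inj₂ (here refl) = inj₂ (inY (kp₁ o (out-op CN n-r2 (out-∘ {C} {nestC} o))))
      add (x , k , o) | inj₂ (there (here refl)) = inj₂ (inY (kp₂ o (Step.add s₁ (cons-++ʳ _ (out-op CN n-d1 (out-∘ {C} {nestC} o))))))
      add (x , k , o) | inj₂ (there (there (here refl))) = inj₂ (inY (kp₂ o (Step.add s₁ (cons-++ˡ (list Od) (cons-reverse (out-op CN n-a4 (out-∘ {C} {nestC} o)))))))
      add (x , k , o) | inj₂ (there (there (there (here refl)))) = inj₂ (inY (proj₂ yw (Step.add s₂ (cons-++ʳ _ (cons-reverse (out-op C n-e1 o))))))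
      add (x , k , o) | inj₂ (there (there (there (there (here refl))))) = inj₂ (inY (proj₂ yw (Step.add s₂ (cons-++ˡ (reverse (list Oe)) (out-op CN n-c3 (out-∘ {C} {nestC} o))))))
      add (x , k , o) | inj₂ (there (there (there (there (there (here refl)))))) = inj₂ (cons-++ˡ (reverse Y) (out-op C n-b′ o))

  -- Gluings of larger sizes, organised by last components.

  trees : ℕ → List Dy
  trees zero    = ε ∷ []
  trees (suc n) = ε ∷ filter (λ x → size x ≤? suc n) (cartesianProductWith _◁_ (trees n) (trees n))

  ∈-trees : ∀ n x → size x ≤ n → x ∈ trees n
  ∈-trees zero    ε       _       = here refl
  ∈-trees (suc n) ε       _       = here refl
  ∈-trees (suc n) (u ◁ v) (s≤s l) = there (∈-filter⁺ (λ x → size x ≤? suc n)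
    (∈-cartesianProductWith⁺ _◁_ (∈-trees n u (ℕₚ.≤-trans (ℕₚ.m≤m+n _ _) l)) (∈-trees n v (ℕₚ.≤-trans (ℕₚ.m≤n+m _ (size u)) l))) (s≤s l))

  trees-size : ∀ n {x} → x ∈ trees n → size x ≤ n
  trees-size zero    (here refl) = z≤n
  trees-size (suc n) (here refl) = z≤n
  trees-size (suc n) (there i)   = proj₂ (∈-filter⁻ (λ x → size x ≤? suc n) {xs = cartesianProductWith _◁_ (trees n) (trees n)} i)

  trees-unique : ∀ n → Unique (trees n)
  trees-unique zero    = [] ∷ []
  trees-unique (suc n) = All.tabulate (λ i → ne (proj₁ (∈-filter⁻ (λ x → size x ≤? suc n) {xs = cartesianProductWith _◁_ (trees n) (trees n)} i))) ∷
    UP.filter⁺ (λ x → size x ≤? suc n) (UP.cartesianProductWith⁺ _◁_ (λ { refl → refl , refl }) (trees-unique n) (trees-unique n))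
    where
    ne : ∀ {x} → x ∈ cartesianProductWith _◁_ (trees n) (trees n) → ε ≢ x
    ne i refl with ∈-cartesianProductWith⁻ _◁_ (trees n) (trees n) i
    ... | _ , _ , _ , _ , ()

  module Blocks (k : ℕ) (rop : ∀ w → size w + 4 ≤ k → ROp (k ∸ suc (size w))) where

    Lw : ∀ w → size w + 4 ≤ k → List Dy
    Lw w l = proj₁ (rop w l)

    -- The bound leaves at least 3 nodes in front of the last component, the size at which `ROp`
    -- starts.
    Fit : List Dy → Set
    Fit ws = ∀ w → w ∈ ws → size w + 4 ≤ k

    Lws : ∀ ws → Fit ws → List Dy
    Lws []       _ = []
    Lws (w ∷ ws) f = map (_⧺ (w ◁ ε)) (Lw w (f w (here refl))) ++ Lws ws (λ v i → f v (there i))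

    idx : ∀ w {j} → size w + 4 ≤ k → suc (size w) + j ≡ k → j ≡ k ∸ suc (size w)
    idx w {j} l e = trans (sym (ℕₚ.m+n∸m≡n (suc (size w)) j)) (cong (_∸ suc (size w)) e)

    idx′ : ∀ w → size w + 4 ≤ k → suc (size w) + (k ∸ suc (size w)) ≡ k
    idx′ w l = ℕₚ.m+[n∸m]≡n (ℕₚ.≤-trans (ℕₚ.≤-trans (ℕₚ.m≤m+n (suc (size w)) 3) (ℕₚ.≤-reflexive (sym (ℕₚ.+-suc (size w) 3)))) l)

    ∈-Lws⁻ : ∀ ws (f : Fit ws) {x} → x ∈ Lws ws f → ∃₂ λ w y → Σ (w ∈ ws) λ i → Σ (size w + 4 ≤ k) λ l → y ∈ Lw w l × x ≡ y ⧺ (w ◁ ε)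
    ∈-Lws⁻ (w ∷ ws) f i with ∈-++⁻ (map (_⧺ (w ◁ ε)) (Lw w (f w (here refl)))) i
    ... | inj₁ j with ∈-map⁻ (_⧺ (w ◁ ε)) j
    ...   | y , h , refl = w , y , here refl , _ , h , refl
    ∈-Lws⁻ (w ∷ ws) f i | inj₂ j with ∈-Lws⁻ ws (λ v i → f v (there i)) j
    ...   | w′ , y , h , l , g , e = w′ , y , there h , l , g , e

    ∈-Lws⁺ : ∀ ws (f : Fit ws) {w y} → w ∈ ws → NewR (k ∸ suc (size w)) y → y ⧺ (w ◁ ε) ∈ Lws ws f
    ∈-Lws⁺ (w ∷ ws) f (here refl) n = ∈-++⁺ˡ (∈-map⁺ (_⧺ (w ◁ ε)) (proj₂ (proj₂ (proj₁ (proj₂ (rop w _)))) n))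
    ∈-Lws⁺ (w ∷ ws) f (there i)   n = ∈-++⁺ʳ (map (_⧺ (w ◁ ε)) (Lw w _)) (∈-Lws⁺ ws _ i n)

    Lws-unique : ∀ ws (f : Fit ws) → Unique ws → Unique (Lws ws f)
    Lws-unique []       f []      = []
    Lws-unique (w ∷ ws) f (n ∷ u) = UP.++⁺ (UP.map⁺ (λ {x} {y} e → proj₁ (snoc-inj x y e)) (proj₁ (proj₁ (proj₂ (rop w _)))))
      (Lws-unique ws _ u) dis
      where
      dis : ∀ {x} → x ∈ map (_⧺ (w ◁ ε)) (Lw w _) × x ∈ Lws ws _ → ⊥
      dis (i , j) with ∈-map⁻ (_⧺ (w ◁ ε)) i | ∈-Lws⁻ ws _ j
      ... | y , _ , refl | w′ , y′ , h , _ , _ , e = All.lookup n h (proj₂ (snoc-inj y y′ e))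

    module _ (C : Ctx) where
      KeepW AddW : List Dy → V → V → Set
      KeepW ws s t = ∀ w → w ∈ ws → RKeep (C ∘C sufC w) s t
      AddW ws s t = ∃₂ λ w y → w ∈ ws × NewR (k ∸ suc (size w)) y × OutE (C ∘C sufC w) y s t

      -- The calls for different `w` do not interfere: each uses up only edges between words with
      -- last component `w`, and the first edges needed by the other calls belong to other words.
      blocks : ∀ ws (f : Fit ws) → Unique ws → ∀ {es zs} → St′ es zs →
        (∀ {w} → w ∈ ws → ∀ v → suc (size w) + suc (size v) ≡ k → Ed (at C (top {ε} {v ⧺ (w ◁ ε)})) (at C (inn {ε} {v ⧺ (w ◁ ε)} end)) zs) →
        Step es zs (blk C (Lws ws f)) (KeepW ws) (AddW ws)
      blocks [] f [] {zs = zs} st ix = step _ st (↭-reflexive (sym (++-identityʳ (concat zs)))) (λ e _ → e) (λ { (_ , _ , () , _) })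
      blocks (w ∷ ws) f (n ∷ u) st ix = weaken pm (λ k → k w (here refl) , λ v i → k v (there i)) addc
        (proj₂ (proj₂ (rop w _)) (C ∘C sufC w) st (λ v e → ix (here refl) v (trans (cong (suc (size w) +_) e) (idx′ w (f w (here refl))))) then
          λ st′ keep add → blocks ws (λ v i → f v (there i)) u st′ (λ {w′} i v e → keep (ix (there i) v e)
            (λ { (b , _) → All.lookup n i (hole-snoc {C} (ε ◁ v) (bad⇒hole {C ∘C sufC w} b)) })))
        where
        pm : blk (C ∘C sufC w) (Lw w _) ++ blk C (Lws ws _) ↭ blk C (Lws (w ∷ ws) f)
        pm = ↭-reflexive (trans (cong (_++ blk C (Lws ws _)) (sym (blk-map C (sufC w) (Lw w _)))) (sym (blk-++ C (map (_⧺ (w ◁ ε)) (Lw w _)) (Lws ws _))))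
        addc : ∀ {s t} → AddW (w ∷ ws) s t → (RAdd (C ∘C sufC w) (Lw w _) s t × KeepW ws s t) ⊎ AddW ws s t
        addc (w′ , y , here refl , nr , o@(out _ refl refl _)) = inj₁ ((y , proj₂ (proj₂ (proj₁ (proj₂ (rop w _)))) nr , o) ,
          λ w″ i → λ { (b , _) → All.lookup n i (sym (hole-snoc {C} y (bad⇒hole {C ∘C sufC w″} b))) })
        addc (w′ , y , there i , nr , o) = inj₂ (w′ , y , i , nr , o)

  snocView : ∀ u v → ∃₂ λ y w → u ◁ v ≡ y ⧺ (w ◁ ε)
  snocView u ε       = ε , u , refl
  snocView u (p ◁ q) with snocView p q
  ... | y , w , e = u ◁ y , w , cong (u ◁_) e

  -- The edge p → q lies in the last component of a word that is attached block-wise.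
  Parent : ℕ → ∀ {x} → Pt x → Pt x → Set
  Parent n p q = ∃₂ λ w y → size w ≤ suc n × NewR (5 + n ∸ suc (size w)) y × ((C : Ctx) → OutE (C ∘C sufC w) y (at C p) (at C q))

  module Big (n : ℕ) (rop : ∀ k → 3 ≤ k → k ≤ 4 + n → ROp k)
             {M M′ : Dy} {mt mh : Pt M} {mt′ mh′ : Pt M′}
             (q′ : QOp (3 + n) M′ mt′ mh′) (q : QOp (5 + n) M mt mh)
             (par : Parent n mt mh) (par′ : Parent n (aft {ten} mt′) (aft {ten} mh′))
             (nb : ¬ IsTen M)
             (diff : ∀ C → ¬ Same (at C mt) (at C mh) (at C (aft {ten} mt′)) (at C (aft {ten} mh′)))
             where

    k = 5 + n

    private
      rp : ∀ w → size w + 4 ≤ k → ROp (k ∸ suc (size w))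
      rp w l = rop (k ∸ suc (size w)) lo hi
        where
        lo : 3 ≤ k ∸ suc (size w)
        lo = ℕₚ.≤-trans (ℕₚ.≤-reflexive (sym (ℕₚ.m+n∸m≡n (suc (size w)) 3))) (ℕₚ.∸-monoˡ-≤ (suc (size w)) (ℕₚ.≤-trans (ℕₚ.≤-reflexive (sym (ℕₚ.+-suc (size w) 3))) l))
        hi : k ∸ suc (size w) ≤ 4 + n
        hi = ℕₚ.m∸n≤m (4 + n) (size w)

    open Blocks k rp

    private
      fits : ∀ {w} → size w ≤ suc n → size w + 4 ≤ k
      fits l = ℕₚ.≤-trans (ℕₚ.+-monoˡ-≤ 4 l) (ℕₚ.≤-reflexive (ℕₚ.+-comm (suc n) 4))
      ws = trees (suc n)
      f : ∀ w → w ∈ ws → size w + 4 ≤ k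
      f w i = fits (trees-size (suc n) i)
      LB = Lws ws f
      L′ = proj₁ (proj₂ q′)
      LQ = proj₁ (proj₂ q)
      enum′ = proj₁ (proj₂ (proj₂ q′))
      enumQ = proj₁ (proj₂ (proj₂ q))

    -- A word that does not start with 10 is handled by `Blocks` if at least 3 nodes precede its
    -- last component. Of the smaller front parts only the empty one and 1100 do not start with 10.
    -- They leave the one-component words and those of the form 1100 followed by one component, for
    -- which `q` and `q′` provide walks.
    L : List Dy
    L = LB ++ (map (ten ◁_) L′ ++ LQ)

    private
      nz : ∀ {j y} → 3 ≤ j → NewR j y → ∃₂ λ p q → ∃ λ v → y ≡ (p ◁ q) ◁ v
      nz {y = ε} () (refl , _)
      nz {y = ε ◁ v} l (_ , nt) = ⊥-elim (nt (v , refl))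
      nz {y = (p ◁ q) ◁ v} l _ = p , q , v , refl

      lo : ∀ {w} → size w + 4 ≤ k → 3 ≤ k ∸ suc (size w)
      lo {w} l = ℕₚ.≤-trans (ℕₚ.≤-reflexive (sym (ℕₚ.m+n∸m≡n (suc (size w)) 3))) (ℕₚ.∸-monoˡ-≤ (suc (size w)) (ℕₚ.≤-trans (ℕₚ.≤-reflexive (sym (ℕₚ.+-suc (size w) 3))) l))

      uniq : Unique L
      uniq = UP.++⁺ (Lws-unique ws f (trees-unique (suc n))) (UP.++⁺ (UP.map⁺ (λ { refl → refl }) (proj₁ enum′)) (proj₁ enumQ) dis₂) dis₁
        where
        dis₂ : ∀ {x} → x ∈ map (ten ◁_) L′ × x ∈ LQ → ⊥
        dis₂ (i , j) with ∈-map⁻ (ten ◁_) i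
        ... | y , h , refl with proj₁ (proj₂ enum′) h | proj₁ (proj₂ enumQ) j
        ...   | _ , _ , refl | _ , _ , ()
        dis₁ : ∀ {x} → x ∈ LB × x ∈ map (ten ◁_) L′ ++ LQ → ⊥
        dis₁ (i , j) with ∈-Lws⁻ ws f i | ∈-++⁻ (map (ten ◁_) L′) j
        ... | w , y , _ , l , g , refl | inj₁ h with ∈-map⁻ (ten ◁_) h
        ...   | z , h′ , e with proj₁ (proj₂ enum′) h′
        ...     | _ , v , refl with snoc-inj y (ten ◁ ε) e
        ...       | refl , _ = three (lo {w} l) (proj₁ (proj₁ (proj₂ (proj₁ (proj₂ (rp w l)))) g))
          where three : ∀ {j} → 3 ≤ j → 2 ≡ j → ⊥
                three (s≤s (s≤s ())) refl
        dis₁ (i , j) | w , y , _ , l , g , refl | inj₂ h with proj₁ (proj₂ enumQ) h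
        ... | _ , v , e with snoc-inj y ε e
        ...   | refl , _ = three (lo {w} l) (proj₁ (proj₁ (proj₂ (proj₁ (proj₂ (rp w l)))) g))
          where three : ∀ {j} → 3 ≤ j → 0 ≡ j → ⊥
                three () refl

      snd : ∀ {x} → x ∈ L → NewR k x
      snd i with ∈-++⁻ LB i
      ... | inj₁ j with ∈-Lws⁻ ws f j
      ...   | w , y , _ , l , g , refl with proj₁ (proj₂ (proj₁ (proj₂ (rp w l)))) g
      ...     | nr@(e , nt) with nz (lo {w} l) nr
      ...       | p , q , v , refl = trans (size-⧺ ((p ◁ q) ◁ v) (w ◁ ε)) (trans (ℕₚ.+-comm (size ((p ◁ q) ◁ v)) _)
                    (trans (cong₂ _+_ (cong suc (ℕₚ.+-identityʳ (size w))) e) (idx′ w l))) , λ ()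
      snd i | inj₂ j with ∈-++⁻ (map (ten ◁_) L′) j
      ... | inj₁ h with ∈-map⁻ (ten ◁_) h
      ...   | y , g , refl = cong (λ z → suc (suc z)) (proj₁ (proj₁ (proj₂ enum′) g)) , λ ()
      snd i | inj₂ j | inj₂ h with proj₁ (proj₂ enumQ) h
      ... | e , ε , refl = ⊥-elim (bad e)
        where bad : 1 ≡ 5 + n → ⊥
              bad ()
      ... | e , (_ ◁ _) , refl = e , λ ()

      inB : ∀ y w → ¬ IsTen y → 3 ≤ size y → size (y ⧺ (w ◁ ε)) ≡ k → y ⧺ (w ◁ ε) ∈ LB
      inB y w nt l e = ∈-Lws⁺ ws f (∈-trees (suc n) w lw) (idx w (fits lw) tot , nt)
        where
        tot : suc (size w) + size y ≡ k
        tot = trans (ℕₚ.+-comm (suc (size w)) (size y)) (trans (cong (size y +_) (cong suc (sym (ℕₚ.+-identityʳ (size w))))) (trans (sym (size-⧺ y (w ◁ ε))) e))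
        lw : size w ≤ suc n
        lw = ℕₚ.+-cancelʳ-≤ 3 (size w) (suc n) (ℕₚ.≤-trans (ℕₚ.+-monoʳ-≤ (size w) l) (ℕₚ.≤-reflexive (ℕₚ.suc-injective (trans tot (cong suc (ℕₚ.+-comm 3 (suc n)))))))

      full : ∀ {x} → NewR k x → x ∈ L
      full {ε} (() , _)
      full {a ◁ b} (e , nt) with snocView a b
      ... | ε , w , refl = ∈-++⁺ʳ LB (∈-++⁺ʳ (map (ten ◁_) L′) (proj₂ (proj₂ enumQ) (e , w , refl)))
      ... | ε ◁ y , w , refl = ⊥-elim (nt (_ , refl))
      ... | (ε ◁ ε) ◁ ε , w , refl = ∈-++⁺ʳ LB (∈-++⁺ˡ (∈-map⁺ (ten ◁_) (proj₂ (proj₂ enum′) (ℕₚ.suc-injective (ℕₚ.suc-injective e) , w , refl))))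
      ... | y@((ε ◁ ε) ◁ (_ ◁ _)) , w , refl = ∈-++⁺ˡ (inB y w (λ ()) (s≤s (s≤s (s≤s z≤n))) e)
      ... | y@((ε ◁ (_ ◁ _)) ◁ _) , w , refl = ∈-++⁺ˡ (inB y w (λ ()) (s≤s (s≤s (s≤s z≤n))) e)
      ... | y@(((_ ◁ _) ◁ _) ◁ _) , w , refl = ∈-++⁺ˡ (inB y w (λ ()) (s≤s (s≤s (s≤s z≤n))) e)

      run : ∀ C {es zs} → St′ es zs → Idx0 C k zs → Step es zs (blk C L) (RKeep C) (RAdd C L)
      run C {es} {zs} st ix with proj₂ (proj₂ (proj₂ q′)) (C ∘C preC ten) | proj₂ (proj₂ (proj₂ q)) C
      ... | P′ , s′ , f′ , w′ , i′ , o′ , p′ , a′ | P , s , t , w , i , o , p , a = weaken pm keep add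
        (blocks C ws f (trees-unique (suc n)) st (λ {w} _ v e → ix (v ⧺ (w ◁ ε)) (trans (cong suc (trans (size-⧺ v (w ◁ ε)) (cong (size v +_) (cong suc (ℕₚ.+-identityʳ (size w)))))) (trans (ℕₚ.+-comm (suc (size v)) (suc (size w))) e))) then
          -- Both host edges belong to words that the blocks have just attached, and `Parent` makes
          -- them available. By `diff`, the first insertion does not use up the host of the second.
          λ st₁ keep₁ add₁ → insertSt st₁ (add₁ (edge′ par′)) w′ i′ o′ then
          λ st₂ keep₂ add₂ → insertSt st₂ (keep₂ (add₁ (edge′ par)) (diff C)) w i o)
        where
        edge′ : ∀ {x} {p q : Pt x} → Parent n p q → AddW C ws (at C p) (at C q)
        edge′ (w , y , l , nr , o) = w , y , ∈-trees (suc n) w l , nr , o C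
        pm : blk C LB ++ (P′ ++ P) ↭ blk C L
        pm = ↭-trans (++⁺ˡ (blk C LB) (++⁺ (↭-trans p′ (↭-reflexive (sym (blk-map C (preC ten) L′)))) p))
               (↭-reflexive (trans (cong (blk C LB ++_) (sym (blk-++ C (map (ten ◁_) L′) LQ))) (sym (blk-++ C LB (map (ten ◁_) L′ ++ LQ)))))
        B′t = bad-at C (aft {ten} mt′) (λ ())
        B′h = bad-at C (aft {ten} mh′) (λ ())
        Bm : (p : Pt M) → Bad C (at C p)
        Bm p = bad-at C p (λ b → nb (lem b))
          where lem : ∀ {x} {p : Pt x} → Back p → IsTen x
                lem (back {v}) = v , refl
        keep : ∀ {s t} → RKeep C s t → KeepW C ws s t × (¬ Same s t (at C (aft {ten} mt′)) (at C (aft {ten} mh′)) × ¬ Same s t (at C mt) (at C mh))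
        keep k = (λ w _ → λ { (b , b′) → k (bad-suf {C} {w} b , bad-suf {C} {w} b′) }) , bad-same {C} k B′t B′h , bad-same {C} k (Bm mt) (Bm mh)
        add : ∀ {s t} → RAdd C L s t → (AddW C ws s t × (¬ Same s t (at C (aft {ten} mt′)) (at C (aft {ten} mh′)) × ¬ Same s t (at C mt) (at C mh)))
              ⊎ (Cons s t P′ × ¬ Same s t (at C mt) (at C mh) ⊎ Cons s t P)
        add (x , k , o) with ∈-++⁻ LB k
        ... | inj₁ k₁ with ∈-Lws⁻ ws f k₁
        ...   | w , y , j , l , g , refl = inj₁ ((w , y , j , proj₁ (proj₂ (proj₁ (proj₂ (rp w l)))) g , out-∘ {C} {sufC w} o) ,
                  out-same {C} o (hole-at C _) (hole-at C _) , out-same {C} o (hole-at C mt) (hole-at C mh))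
        add (x , k , o) | inj₂ k₁ with ∈-++⁻ (map (ten ◁_) L′) k₁
        ... | inj₁ k₂ with ∈-map⁻ (ten ◁_) k₂
        ...   | y , g , refl = inj₂ (inj₁ (a′ (y , g , out-∘ {C} {preC ten} o) , out-same {C} o (hole-at C mt) (hole-at C mh)))
        add (x , k , o) | inj₂ k₁ | inj₂ k₂ = inj₂ (inj₂ (a (x , k₂ , o)))

    r-op : ROp k
    r-op = L , (uniq , snd , full) , run

  open Opened using (list; walk; perm; edges)

  -- Words behind leading 10s, and walks through all one-component words.

  zC : ℕ → Ctx
  zC zero    = idC
  zC (suc n) = preC ε ∘C zC n

  zt : ℕ → Dy
  zt zero    = ε
  zt (suc n) = ε ◁ zt n

  zC-zt : ∀ n x → cx (zC n) x ≡ zt n ⧺ x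
  zC-zt zero    x = refl
  zC-zt (suc n) x = cong (ε ◁_) (zC-zt n x)

  size-zt : ∀ n → size (zt n) ≡ n
  size-zt zero    = refl
  size-zt (suc n) = cong suc (size-zt n)

  word-zC : ∀ n x → word (cx (zC n) x) ≡ word (zt n) ++ word x
  word-zC n x = trans (cong word (zC-zt n x)) (word-⧺ (zt n) x)

  wd-zC : ∀ n {x} (p : Pt x) → wd (pt (zC n) p) ≡ neg (word (zt n)) ++ wd p
  wd-zC zero    p = refl
  wd-zC (suc n) p = cong (λ w → false ∷ true ∷ w) (wd-zC n p)

  odd-zC : ∀ n {x} (p : Pt x) → odd (pt (zC n) p) ≡ odd p
  odd-zC zero    p = refl
  odd-zC (suc n) p = odd-zC n p

  lst-zC : ∀ n x → lst {cx (zC n) x} ≡ pt (zC n) (lst {x})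
  lst-zC zero    x = refl
  lst-zC (suc n) x = cong aft (lst-zC n x)

  five : List Dy
  five = tB ∷ tC ∷ tR ∷ tD ∷ tA ∷ []

  enum-five : Enum (λ x → size x ≡ 3) five
  enum-five = u , snd , full
    where
    u : Unique five
    u = ((λ ()) ∷ (λ ()) ∷ (λ ()) ∷ (λ ()) ∷ []) ∷ ((λ ()) ∷ (λ ()) ∷ (λ ()) ∷ []) ∷ ((λ ()) ∷ (λ ()) ∷ []) ∷ ((λ ()) ∷ []) ∷ [] ∷ []
    snd : ∀ {x} → x ∈ five → size x ≡ 3
    snd (here refl) = refl
    snd (there (here refl)) = refl
    snd (there (there (here refl))) = refl
    snd (there (there (there (here refl)))) = refl
    snd (there (there (there (there (here refl))))) = refl
    full : ∀ {x} → size x ≡ 3 → x ∈ five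
    full {ε ◁ ε} ()
    full {ε ◁ (ε ◁ ε)} ()
    full {ε ◁ (ε ◁ (ε ◁ ε))} _ = there (there (there (there (here refl))))
    full {ε ◁ (ε ◁ (ε ◁ (_ ◁ _)))} ()
    full {ε ◁ (ε ◁ ((_ ◁ _) ◁ _))} ()
    full {ε ◁ ((ε ◁ ε) ◁ ε)} _ = here refl
    full {ε ◁ ((ε ◁ ε) ◁ (_ ◁ _))} ()
    full {ε ◁ ((ε ◁ (_ ◁ _)) ◁ _)} ()
    full {ε ◁ (((_ ◁ _) ◁ _) ◁ _)} ()
    full {x@((_ ◁ _) ◁ _)} e with proj₂ (proj₂ (proj₁ (proj₂ r-op3))) {x} (e , λ ())
    ... | here refl                 = there (there (there (here refl)))
    ... | there (here refl)         = there (there (here refl))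
    ... | there (there (here refl)) = there (here refl)

  roots : ℕ → List Dy
  roots n = map (cx (zC n)) five

  None : V → V → Set
  None _ _ = ⊥

  -- Slot contains the tails of the edges at which the walks through the roots have been opened.
  ExtOp : ℕ → Set₁
  ExtOp n = Σ (List Dy) λ L → Enum (λ x → size x ≡ 3 + n) (roots n ++ L) ×
    (∀ C (Slot : V → Set) → (∀ {s} → Slot s → Hole (C ∘C zC n) s) → ∀ {es zs} → St′ es zs →
      (∀ {x s t} → x ∈ five → OutE (C ∘C zC n) x s t → ¬ Slot s → Ed s t zs) →
      Step es zs (blk C L) None (λ s t → ∃ λ x → size x ≡ 3 + n × OutE C x s t × ¬ Slot s))

  ext-zero : ExtOp 0
  ext-zero = [] , enum-five , λ C Slot sl {zs = zs} st base → step zs st (↭-reflexive (sym (++-identityʳ (concat zs)))) (λ _ ())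
    (λ { (x , e , o , ns) → base (proj₂ (proj₂ enum-five) e) o ns })

  -- The words 10v are treated as the words v in the context of a leading 10, which leaves their
  -- first edges untouched; these are the edges that `ROp` needs for all remaining words.
  ext-suc : ∀ n → ROp (4 + n) → ExtOp n → ExtOp (suc n)
  ext-suc n (LR , (uR , sR , fR) , runR) (L , (u , s , f) , run) = map (ε ◁_) L ++ LR , (un , snd , full) , go
    where
    L≡ : roots (suc n) ++ (map (ε ◁_) L ++ LR) ≡ map (ε ◁_) (roots n ++ L) ++ LR
    L≡ = trans (sym (++-assoc (roots (suc n)) (map (ε ◁_) L) LR)) (cong (_++ LR) (sym (map-++ (ε ◁_) (roots n) L)))
    un : Unique (roots (suc n) ++ (map (ε ◁_) L ++ LR))
    un = subst Unique (sym L≡) (UP.++⁺ (UP.map⁺ (λ { refl → refl }) u) uR dis)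
      where
      dis : ∀ {x} → x ∈ map (ε ◁_) (roots n ++ L) × x ∈ LR → ⊥
      dis (i , j) with ∈-map⁻ (ε ◁_) i
      ... | y , _ , refl = proj₂ (sR j) (y , refl)
    snd : ∀ {x} → x ∈ roots (suc n) ++ (map (ε ◁_) L ++ LR) → size x ≡ 4 + n
    snd {x} i with ∈-++⁻ (map (ε ◁_) (roots n ++ L)) (subst (x ∈_) L≡ i)
    ... | inj₂ j = proj₁ (sR j)
    ... | inj₁ j with ∈-map⁻ (ε ◁_) j
    ...   | y , k , refl = cong suc (s k)
    full : ∀ {x} → size x ≡ 4 + n → x ∈ roots (suc n) ++ (map (ε ◁_) L ++ LR)
    full {x@(ε ◁ v)} e = subst (x ∈_) (sym L≡) (∈-++⁺ˡ (∈-map⁺ (ε ◁_) (f (ℕₚ.suc-injective e))))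
    full {x@((_ ◁ _) ◁ v)} e = subst (x ∈_) (sym L≡) (∈-++⁺ʳ (map (ε ◁_) (roots n ++ L)) (fR (e , λ ())))
    go : ∀ C (Slot : V → Set) → (∀ {s} → Slot s → Hole (C ∘C zC (suc n)) s) → ∀ {es zs} → St′ es zs →
      (∀ {x s t} → x ∈ five → OutE (C ∘C zC (suc n)) x s t → ¬ Slot s → Ed s t zs) →
      Step es zs (blk C (map (ε ◁_) L ++ LR)) None (λ s t → ∃ λ x → size x ≡ 4 + n × OutE C x s t × ¬ Slot s)
    go C Slot sl {es} {zs} st base = weaken (↭-reflexive (trans (cong (_++ blk C LR) (sym (blk-map C (preC ε) L))) (sym (blk-++ C (map (ε ◁_) L) LR))))
      (λ ()) add
      (run (C ∘C preC ε) Slot sl st base then λ st′ keep add → runR C st′ (λ v e → add (v , ℕₚ.suc-injective e ,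
        out {p = pt C top} {pt C (inn end)} (pt-nx C nxt) refl refl (λ { (h , _) → topA v h }) , λ q → topS v (sl q))))
      where
      topA : ∀ v → Hole (C ∘C preC ε) (at C (top {ε} {v})) → ⊥
      topA v (x , p , e) with pt-inj C {p = top {ε} {v}} {aft p} e
      ... | ()
      topS : ∀ v → Hole (C ∘C zC (suc n)) (at C (top {ε} {v})) → ⊥
      topS v (x , p , e) with pt-inj C {p = top {ε} {v}} {aft (pt (zC n) p)} e
      ... | ()
      add : ∀ {s t} → (∃ λ x → size x ≡ 4 + n × OutE C x s t × ¬ Slot s) →
            (∃ λ x → size x ≡ 3 + n × OutE (C ∘C preC ε) x s t × ¬ Slot s) × RKeep C s t ⊎ RAdd C LR s t
      add (ε ◁ v , e , o , ns) = inj₁ ((v , ℕₚ.suc-injective e , out-∘ {C} {preC ε} o , ns) ,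
        λ { (a , b) → OutE.far o (bad⇒hole {C} a , bad⇒hole {C} b) })
      add (x@((_ ◁ _) ◁ _) , e , o , ns) = inj₂ (x , fR (e , λ ()) , o)

  ext : ∀ n → (∀ k → 3 ≤ k → k ≤ 3 + n → ROp k) → ExtOp n
  ext zero    r = ext-zero
  ext (suc n) r = ext-suc n (r (4 + n) (s≤s (s≤s (s≤s z≤n))) ℕₚ.≤-refl) (ext n (λ k a b → r k a (ℕₚ.m≤n⇒m≤1+n b)))

  -- The 6-cycle 101010@4, 110010@1, 111000@5.
  insert-t1 : ∀ B {es zs} → St′ es zs → Ed (at B r5) (at B r6) zs →
    Step es zs (list (op B n-d1) ++ reverse (list (op B n-a4))) (λ s t → ¬ Same s t (at B r5) (at B r6))
      (λ s t → Cons s t (list (op B n-d1) ++ reverse (list (op B n-a4))))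
  insert-t1 B st e = insertSt st e (walk (op B n-d1) ⟨ ad! B d1 a4 refl refl ⟩ rev (op B n-a4)) (ad! B r5 d2 refl refl) (ad! B a5 r6 refl refl)

  -- The 6-cycle 101100@4, 111000@1, 110100@5.
  q-op3 : QOp 3 tB b4 b5
  q-op3 = n-b4 , tR ∷ tC ∷ [] , (((λ ()) ∷ []) ∷ [] ∷ [] , snd , λ { {x} → full {x} }) , run
    where
    snd : ∀ {x} → x ∈ tR ∷ tC ∷ [] → Sing 3 x
    snd (here refl)         = refl , _ , refl
    snd (there (here refl)) = refl , _ , refl
    full : ∀ {x} → Sing 3 x → x ∈ tR ∷ tC ∷ []
    full {x} (e , u , refl) with proj₂ (proj₂ enum-five) {x} e
    ... | there (here refl)         = there (here refl)
    ... | there (there (here refl)) = here refl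
    ... | there (there (there (here ())))
    ... | there (there (there (there (here ()))))
    run : ∀ C → ∃ λ P → ∃₂ λ p q → Walk Ad p q P × Ad (at C b4) p × Ad q (at C b5) × P ↭ blk C (tR ∷ tC ∷ []) ×
       (∀ {s t} → RAdd C (tR ∷ tC ∷ []) s t → Cons s t P)
    run C = reverse (list Or) ++ reverse (list Oc) , _ , _ , rev Or ⟨ ad! C r2 c5 refl refl ⟩ rev Oc ,
      ad! C b4 r1 refl refl , ad! C c6 b5 refl refl , ++⁺ (rev-perm Or) (↭-trans (rev-perm Oc) (↭-reflexive (sym (++-identityʳ _)))) , add
      where
      Or = op C n-r1
      Oc = op C n-c5
      add : ∀ {s t} → RAdd C (tR ∷ tC ∷ []) s t → Cons s t (reverse (list Or) ++ reverse (list Oc))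
      add (_ , here refl , o)         = cons-++ʳ _ (cons-reverse (out-op C n-r1 o))
      add (_ , there (here refl) , o) = cons-++ˡ (reverse (list Or)) (cons-reverse (out-op C n-c5 o))

  -- The word 110010 followed by 1(10)ⁿ0. The edge from the last point inside its last component to
  -- the end is the host. As 110010 does not start with 10, the word is attached by the blocks.
  Mq : ℕ → Dy
  Mq n = ten ◁ ε ◁ zt n ◁ ε

  mt mh : ∀ n → Pt (Mq n)
  mt n = aft (aft (inn lst))
  mh n = aft (aft (aft end))

  private
    near! : ∀ {x y} {p : Pt x} {q : Pt y} {v w} → wd p ≡ v → wd q ≡ w → D1 v w → odd p ≡ not (odd q) → Near (x , p) (y , q)
    near! e f d o = near (subst₂ D1 (sym e) (sym f) d) o

  -- One-component words are the words of the previous size inside a component. Three walks,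
  -- starting from the roots over `tC`, `tB` and `tR`, are extended together to all of them and then
  -- joined along an 8-cycle that meets these three cycles and the one of `Mq n`.
  q-op : ∀ n → ExtOp n → QOp (4 + n) (Mq n) (mt n) (mh n)
  q-op n (L , (u , snd , full) , ex) = nxa (nxa nxm) , map (_◁ ε) (roots n ++ L) , (UP.map⁺ (λ { refl → refl }) u , snd′ , λ {x} → full′ {x}) , run
    where
    ρc = cx (zC n) tC
    zr = reverse (word (zt n))
    snd′ : ∀ {x} → x ∈ map (_◁ ε) (roots n ++ L) → Sing (4 + n) x
    snd′ i with ∈-map⁻ (_◁ ε) i
    ... | y , j , refl = cong suc (trans (ℕₚ.+-identityʳ (size y)) (snd j)) , y , refl
    full′ : ∀ {x} → Sing (4 + n) x → x ∈ map (_◁ ε) (roots n ++ L)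
    full′ (e , y , refl) = ∈-map⁺ (_◁ ε) (full (trans (sym (ℕₚ.+-identityʳ (size y))) (ℕₚ.suc-injective e)))
    -- `Mq n` is not in the common context of the nested roots, so the two edges at the host are
    -- checked for general n.
    near₁ : Near (Mq n , mt n) (ρc ◁ ε , aft end)
    near₁ = near! {v = false ∷ false ∷ true ∷ true ∷ false ∷ true ∷ true ∷ zr ++ true ∷ []} {false ∷ false ∷ false ∷ true ∷ false ∷ true ∷ true ∷ zr ++ true ∷ []}
      (cong (λ w → false ∷ false ∷ true ∷ true ∷ false ∷ true ∷ true ∷ w ++ true ∷ []) (trans (cong mir (wd-lst (zt n))) (cong reverse (neg-neg (word (zt n))))))
      (cong (false ∷_) (trans (cong (λ w → reverse w ++ true ∷ []) (word-zC n tC)) (cong (_++ true ∷ []) (reverse-++ (word (zt n)) (word tC)))))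
      (there (there here)) (cong not (odd-lst (zt n)))
    near₂ : Near (cx (zC n) tR ◁ ε , inn (pt (zC n) r2)) (Mq n , mh n)
    near₂ = near! {v = true ∷ false ∷ true ∷ true ∷ false ∷ true ∷ false ∷ zr ++ true ∷ []} {false ∷ false ∷ true ∷ true ∷ false ∷ true ∷ false ∷ zr ++ true ∷ []}
      (cong (true ∷_) (cong (_++ true ∷ []) (trans (cong mir (wd-zC n r2)) (trans (mir-++ (neg (word (zt n))) (wd r2)) (cong (mir (wd r2) ++_) (cong reverse (neg-neg (word (zt n)))))))))
      refl here (cong not (odd-zC n r2))
    Fits : Ctx → Set
    Fits C = ∃ λ P → ∃₂ λ p q → Walk Ad p q P × Ad (at C (mt n)) p × Ad q (at C (mh n)) × P ↭ blk C (map (_◁ ε) (roots n ++ L)) ×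
       (∀ {s t} → RAdd C (map (_◁ ε) (roots n ++ L)) s t → Cons s t P)
    run : ∀ C → Fits C
    run C = fin (Step.st s₂) (Step.perm s₂) (Step.add s₂)
      where
      B = (C ∘C nestC) ∘C zC n
      n-c : Nx (inn {ρc} {ε} lst) (aft end)
      n-c = nxm
      Oc = op C n-c
      Ob = op B n-b4
      Or = op B n-r1
      ends : Ends
      ends = (at C (aft {ρc} {ε} end) , at C (inn {ρc} {ε} lst)) ∷ (at B b5 , at B b4) ∷ (at B r2 , at B r1) ∷ []
      bs = list Oc ∷ list Ob ∷ list Or ∷ []
      r5e : Cons (at B r5) (at B r6) (list Or)
      r5e = edges Or (pt-nx B n-r5) (λ e → ne (pt-inj B {p = r5} {r1} (cong (cx B tR ,_) e)))
        where ne : (tR , r5) ≡ⱽ (tR , r1) → ⊥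
              ne ()
      s₁ = insert-t1 B {ends} {bs} (walk Oc ∷ walk Ob ∷ walk Or ∷ []) (there (there (here r5e)))
      -- The edge at which this cycle is opened leaves the hole. Unlike those of the other two
      -- cycles it would therefore count as available, and has to be excluded.
      Slot : V → Set
      Slot s = s ≡ at C (inn {ρc} {ε} lst)
      base : ∀ {x s t} → x ∈ five → OutE B x s t → ¬ Slot s → Ed s t (Step.out s₁)
      keep₁ : ∀ {x s t} → OutE B x s t → Ed s t bs → Ed s t (Step.out s₁)
      keep₁ o k = Step.keep s₁ k (out-same {B} o (hole-at B r5) (hole-at B r6))
      base (here refl) o ns = keep₁ o (there (here (out-op B n-b4 o)))
      base (there (here refl)) o@(out n refl refl _) ns = keep₁ o (here (edges Oc n (λ { refl → ns refl })))
      base (there (there (here refl))) o ns = keep₁ o (there (there (here (out-op B n-r1 o))))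
      base (there (there (there (here refl)))) o ns = Step.add s₁ (cons-++ʳ _ (out-op B n-d1 o))
      base (there (there (there (there (here refl))))) o ns = Step.add s₁ (cons-++ˡ (list (op B n-d1)) (cons-reverse (out-op B n-a4 o)))
      s₂ = ex (C ∘C nestC) Slot (λ { refl → tC , c6 , cong (λ p → at C (inn p)) (lst-zC n tC) }) (Step.st s₁) base
      new : List V
      new = list (op B n-d1) ++ reverse (list (op B n-a4))
      fin : ∀ {zs} → St′ ends zs → concat zs ↭ concat (Step.out s₁) ++ blk (C ∘C nestC) L →
        (∀ {s t} → (∃ λ x → size x ≡ 3 + n × OutE (C ∘C nestC) x s t × ¬ Slot s) → Ed s t zs) → Fits C
      fin {zc ∷ zb ∷ zr ∷ []} (wc ∷ wb ∷ wr ∷ []) p a =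
        zc ++ (zb ++ reverse zr) , _ , _ ,
        (wc ⟨ subst (λ p → Ad (at C (inn p)) (at B b5)) (sym (lst-zC n tC)) (ad! B c6 b5 refl refl) ⟩ (wb ⟨ ad! B b4 r1 refl refl ⟩ reverseW Ad-sym wr)) ,
        near⇒Ad (pt-near C {p = mt n} {aft end} near₁) , near⇒Ad (pt-near C {p = inn (pt (zC n) r2)} {mh n} near₂) , pm , add
        where
        pm : zc ++ (zb ++ reverse zr) ↭ blk C (map (_◁ ε) (roots n ++ L))
        pm = ↭-trans (++⁺ˡ zc (++⁺ˡ zb (↭-trans (↭-reverse zr) (↭-reflexive (sym (++-identityʳ zr))))))
          (↭-trans p (↭-trans (++⁺ʳ (blk (C ∘C nestC) L) (↭-trans (Step.perm s₁)
            (↭-trans (++⁺ (++⁺ (perm Oc) (++⁺ (perm Ob) (++⁺ʳ [] (perm Or)))) (++⁺ (perm (op B n-d1)) (rev-perm (op B n-a4))))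
              (prove 5 ((var (# 1) ⊕ (var (# 0) ⊕ (var (# 2) ⊕ id))) ⊕ (var (# 3) ⊕ var (# 4)))
                       (var (# 0) ⊕ (var (# 1) ⊕ (var (# 2) ⊕ (var (# 3) ⊕ (var (# 4) ⊕ id)))))
                       (allV (cx B tB) ∷ allV (cx B tC) ∷ allV (cx B tR) ∷ allV (cx B tD) ∷ allV (cx B tA) ∷ [])))))
            (↭-reflexive (trans (cong (_++ blk (C ∘C nestC) L) (sym (blk-map (C ∘C nestC) (zC n) five)))
              (trans (sym (blk-++ (C ∘C nestC) (roots n) L)) (sym (blk-map C nestC (roots n ++ L))))))))
        un : ∀ {s t} → Ed s t (zc ∷ zb ∷ zr ∷ []) → Cons s t (zc ++ (zb ++ reverse zr))
        un (here k)                 = cons-++ʳ _ k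
        un (there (here k))         = cons-++ˡ zc (cons-++ʳ _ k)
        un (there (there (here k))) = cons-++ˡ zc (cons-++ˡ zb (cons-reverse k))
        add : ∀ {s t} → RAdd C (map (_◁ ε) (roots n ++ L)) s t → Cons s t (zc ++ (zb ++ reverse zr))
        add (x , i , o) with ∈-map⁻ (_◁ ε) i
        ... | y , j , refl = un (a (y , snd j , out-∘ {C} {nestC} o , λ sl → not-slot o sl))
          where
          not-slot : ∀ {y s t} → OutE C (y ◁ ε) s t → s ≡ at C (inn {ρc} {ε} lst) → ⊥
          not-slot o@(out n refl refl _) sl with cx-inj C (cong proj₁ sl)
          ... | refl = out-slot {C} {p = inn lst} {aft end} o n-c sl

  -- Induction on the size, and the Hamilton cycle of the odd graph.

  private
    outside : ∀ C w {y} {p q : Pt (y ⧺ (w ◁ ε))} → Nx p q → Inside p → OutE (C ∘C sufC w) y (at C p) (at C q)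
    outside C w {p = p} n i = out (pt-nx C n) refl refl (λ { ((x , r , e) , _) →
      emb-not-inside w r (subst (λ v → Inside (proj₂ v)) (pt-inj C {p = p} {emb (w ◁ ε) r} e) i) })

  private
    size3 : ∀ n → 3 ≡ 5 + n ∸ suc (suc (size (zt n)))
    size3 n = sym (trans (cong (λ z → 5 + n ∸ suc (suc z)) (size-zt n)) (ℕₚ.m+n∸n≡m 3 n))
    par : ∀ n → Parent n (mt (suc n)) (mh (suc n))
    par n = zt (suc n) , tD , ℕₚ.≤-reflexive (size-zt (suc n)) , (size3 n , λ ()) , λ C → outside C (zt (suc n)) {tD} (nxa (nxa nxm)) (ina (ina ini))
    big : ∀ n → (∀ k → 3 ≤ k → k ≤ 4 + n → ROp k) → ROp (5 + n)
    big zero r = Big.r-op zero r q-op3 (q-op 1 (ext 1 r)) (par 0)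
      (ten , tD , s≤s z≤n , (refl , λ ()) , λ C → outside C ten {tD} (nxa n-b4) (ina (ina ini))) (λ ()) diff
      where
      diff : ∀ C → ¬ Same (at C (mt 1)) (at C (mh 1)) (at C (aft {ten} b4)) (at C (aft {ten} b5))
      diff C (inj₁ (e , _)) with pt-inj C {p = mt 1} {aft {ten} b4} e
      ... | ()
      diff C (inj₂ (_ , e)) with pt-inj C {p = mh 1} {aft {ten} b4} e
      ... | ()
    big (suc m) r = Big.r-op (suc m) r (q-op m (ext m (λ k a b → r k a (ℕₚ.≤-trans b (ℕₚ.m≤n+m (3 + m) 2))))) (q-op (2 + m) (ext (2 + m) r)) (par (suc m))
      (zt m , ten ◁ tD , ℕₚ.≤-trans (ℕₚ.≤-reflexive (size-zt m)) (ℕₚ.m≤n+m m 2) ,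
        (sym (trans (cong (λ z → 6 + m ∸ suc z) (size-zt m)) (ℕₚ.m+n∸n≡m 5 m)) , λ ()) ,
        λ C → outside C (zt m) {ten ◁ tD} (nxa (nxa (nxa nxm))) (ina (ina (ina ini)))) (λ ()) diff
      where
      ne : Mq (2 + m) ≡ ten ◁ Mq m → ⊥
      ne ()
      diff : ∀ C → ¬ Same (at C (mt (2 + m))) (at C (mh (2 + m))) (at C (aft {ten} (mt m))) (at C (aft {ten} (mh m)))
      diff C (inj₁ (e , _)) = ne (cx-inj C (cong proj₁ e))
      diff C (inj₂ (e , _)) = ne (cx-inj C (cong proj₁ e))

    big′ : ∀ n → (∀ k → 3 ≤ k → k ≤ 3 + n → ROp k) → ROp (4 + n)
    big′ zero    _ = r-op4
    big′ (suc n) r = big n r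

  -- The induction is well-founded because the walk through the one-component words of size 5+n
  -- nests words of size 4+n, and so needs `ROp` up to 4+n only.
  rops : ∀ n k → 3 ≤ k → k ≤ 3 + n → ROp k
  rops zero    k a b = subst ROp (ℕₚ.≤-antisym a b) r-op3
  rops (suc n) k a b with ℕₚ.m≤n⇒m<n∨m≡n b
  ... | inj₁ c    = rops n k a (ℕₚ.≤-pred c)
  ... | inj₂ refl = big′ n (rops n)

  unique-pts : ∀ D → Unique (pts D)
  unique-pts ε       = [] ∷ []
  unique-pts (u ◁ v) = All.tabulate ne ∷ UP.++⁺ (UP.map⁺ (λ { refl → refl }) (unique-pts u)) (UP.map⁺ (λ { refl → refl }) (unique-pts v)) dis
    where
    dis : ∀ {p} → p ∈ map inn (pts u) × p ∈ map aft (pts v) → ⊥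
    dis (i , j) with ∈-map⁻ inn i | ∈-map⁻ aft j
    ... | _ , _ , refl | _ , _ , ()
    ne : ∀ {p} → p ∈ map inn (pts u) ++ map aft (pts v) → top ≢ p
    ne i refl with ∈-++⁻ (map inn (pts u)) i
    ... | inj₁ j with ∈-map⁻ inn j
    ...   | _ , _ , ()
    ne i refl | inj₂ j with ∈-map⁻ aft j
    ...   | _ , _ , ()

  ∈-blk⁻ : ∀ L {v} → v ∈ blk idC L → proj₁ v ∈ L
  ∈-blk⁻ (x ∷ L) i with ∈-++⁻ (allV x) i
  ... | inj₂ j = there (∈-blk⁻ L j)
  ... | inj₁ j with ∈-map⁻ (x ,_) j
  ...   | _ , _ , refl = here refl

  ∈-blk⁺ : ∀ L {x} (p : Pt x) → x ∈ L → (x , p) ∈ blk idC L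
  ∈-blk⁺ (x ∷ L) p (here refl) = ∈-++⁺ˡ (∈-map⁺ (x ,_) (∈-pts p))
  ∈-blk⁺ (x ∷ L) p (there i)   = ∈-++⁺ʳ (allV x) (∈-blk⁺ L p i)

  unique-blk : ∀ L → Unique L → Unique (blk idC L)
  unique-blk []      []      = []
  unique-blk (x ∷ L) (n ∷ u) = UP.++⁺ (UP.map⁺ (λ { refl → refl }) (unique-pts x)) (unique-blk L u) dis
    where
    dis : ∀ {v} → v ∈ allV x × v ∈ blk idC L → ⊥
    dis (i , j) with ∈-map⁻ (x ,_) i
    ... | _ , _ , refl = All.lookup n (∈-blk⁻ L j) refl

  -- There is no host here: the cycle of the root over `tR` is opened at its closing edge, from the
  -- last point to the first, which serves for no gluing, and this edge closes the final walk.
  ham-V : ∀ n → Ham (λ v → size (proj₁ v) ≡ 3 + n) Ad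
  ham-V n with ext n (rops n)
  ... | L , (u , snd , full) , ex = fin (Step.st s₃) (Step.perm s₃)
    where
    B = zC n
    Or : Opened (cx B tR) lst fst
    Or = openAt close
    Ob = op B n-b0
    Oc = op B n-c0
    ends : Ends
    ends = ((cx B tR , fst) , (cx B tR , lst)) ∷ []
    all : ∀ {x s t} → x ≡ tR → OutE B x s t → Cons s t (list Or)
    all refl (out n refl refl _) = edges Or n (λ { refl → no-nx-lst n })
    edge! : ∀ {p q : Pt tR} → Nx p q → Ed (at B p) (at B q) (list Or ∷ [])
    edge! n = here (edges Or (pt-nx B n) (λ e → no-nx-lst (subst (λ p → Nx p _) e (pt-nx B n))))
    s₁ = insert-t1 B {ends} {list Or ∷ []} (walk Or ∷ []) (edge! n-r5)
    r3-r5 : ¬ Same (at B r3) (at B r4) (at B r5) (at B r6)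
    r3-r5 (inj₁ (e , _)) with pt-inj B {p = r3} {r5} e
    ... | ()
    r3-r5 (inj₂ (e , _)) with pt-inj B {p = r3} {r6} e
    ... | ()
    -- The 6-cycle 101100@0, 110100@0, 111000@3.
    s₂ = insertSt (Step.st s₁) (Step.keep s₁ (edge! n-r3) r3-r5)
           (rev Ob ⟨ ad! B b1 c0 refl refl ⟩ rev Oc) (ad! B r3 b0 refl refl) (ad! B c1 r4 refl refl)
    base : ∀ {x s t} → x ∈ five → OutE B x s t → ¬ ⊥ → Ed s t (Step.out s₂)
    keep₂ : ∀ {x s t} → OutE B x s t → Ed s t (Step.out s₁) → Ed s t (Step.out s₂)
    keep₂ o k = Step.keep s₂ k (out-same {B} o (hole-at B r3) (hole-at B r4))
    base (here refl) o _ = Step.add s₂ (cons-++ʳ _ (cons-reverse (out-op B n-b0 o)))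
    base (there (here refl)) o _ = Step.add s₂ (cons-++ˡ (reverse (list Ob)) (cons-reverse (out-op B n-c0 o)))
    base (there (there (here refl))) o _ = keep₂ o (Step.keep s₁ (here (all refl o)) (out-same {B} o (hole-at B r5) (hole-at B r6)))
    base (there (there (there (here refl)))) o _ = keep₂ o (Step.add s₁ (cons-++ʳ _ (out-op B n-d1 o)))
    base (there (there (there (there (here refl))))) o _ = keep₂ o (Step.add s₁ (cons-++ˡ (list (op B n-d1)) (cons-reverse (out-op B n-a4 o))))
    s₃ = ex idC (λ _ → ⊥) (λ ()) (Step.st s₂) base
    fin : ∀ {zs} → St′ ends zs → concat zs ↭ concat (Step.out s₂) ++ blk idC L → Ham (λ v → size (proj₁ v) ≡ 3 + n) Ad
    fin {Y ∷ []} (w ∷ []) p = record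
      { verts = Y ; cyc = _ , _ , w , nxc⇒Ad close ; uniq = Unique-↭ (↭-sym pm) (unique-blk (roots n ++ L) u)
      ; sound = λ i → snd (∈-blk⁻ (roots n ++ L) (∈-resp-↭ pm i)) ; full = λ { {_ , q} e → ∈-resp-↭ (↭-sym pm) (∈-blk⁺ (roots n ++ L) q (full e)) } }
      where
      pm : Y ↭ blk idC (roots n ++ L)
      pm = ↭-trans (↭-reflexive (sym (++-identityʳ Y))) (↭-trans p (↭-trans (++⁺ʳ (blk idC L) (↭-trans (Step.perm s₂) (↭-trans (++⁺ʳ _ (Step.perm s₁))
            (↭-trans (++⁺ (++⁺ (++⁺ʳ [] (perm Or)) (++⁺ (perm (op B n-d1)) (rev-perm (op B n-a4)))) (++⁺ (rev-perm Ob) (rev-perm Oc)))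
              (prove 5 (((var (# 2) ⊕ id) ⊕ (var (# 3) ⊕ var (# 4))) ⊕ (var (# 0) ⊕ var (# 1)))
                       (var (# 0) ⊕ (var (# 1) ⊕ (var (# 2) ⊕ (var (# 3) ⊕ (var (# 4) ⊕ id)))))
                       (allV (cx B tB) ∷ allV (cx B tC) ∷ allV (cx B tR) ∷ allV (cx B tD) ∷ allV (cx B tA) ∷ []))))))
            (↭-reflexive (trans (cong (_++ blk idC L) (sym (blk-map idC (zC n) five))) (sym (blk-++ idC (roots n) L))))))

  odd-graph : ∀ n → HamK (suc ((3 + n) + (3 + n))) (3 + n)
  odd-graph n = mapHam enc (λ {v} → sound {v}) (λ {v} {w} → inj {v} {w}) sur (λ _ _ (ad d) → d) (ham-V n)
    where
    k = 3 + n
    dbl : ∀ {a b k} → a + b ≡ k + k → a ≡ b → a ≡ k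
    dbl {a} {.a} {k} e refl = half a k e
      where
      half : ∀ a k → a + a ≡ k + k → a ≡ k
      half zero    zero    _ = refl
      half (suc a) (suc k) e = cong suc (half a k (ℕₚ.suc-injective (trans (sym (ℕₚ.+-suc a a)) (trans (ℕₚ.suc-injective e) (ℕₚ.+-suc k k)))))
    tot : ∀ {D} (p : Pt D) → size D ≡ k → ones (wd p) + zeros (wd p) ≡ k + k
    tot p e = trans (ones+zeros (wd p)) (trans (len-wd p) (cong (λ z → z + z) e))
    two : ∀ {a b k} → a + b ≡ k + k → a ≡ 2 + b → suc b ≡ k
    two {k = k} e refl = dbl {k = k} (trans (cong suc (ℕₚ.+-suc _ _)) e) refl
    len : ∀ (w : Word) b {j} → length w ≡ j → length (w ++ b ∷ []) ≡ suc j
    len w b {j} e = trans (length-++ w) (trans (ℕₚ.+-comm (length w) 1) (cong suc e))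
    sound : ∀ {v} → size (proj₁ v) ≡ k → IsW (suc (k + k)) k (enc v)
    sound {D , p} e with odd p | sum-wd p
    ... | false | s = len (wd p) false (trans (len-wd p) (cong (λ z → z + z) e)) ,
          trans (ones-++ (wd p) (false ∷ [])) (trans (ℕₚ.+-identityʳ _) (dbl (tot p e) s))
    ... | true  | s = len (neg (wd p)) true (trans (length-map not (wd p)) (trans (len-wd p) (cong (λ z → z + z) e))) ,
          trans (ones-++ (neg (wd p)) (true ∷ [])) (trans (ℕₚ.+-comm (zeros (wd p)) 1) (two (tot p e) s))
    inj : ∀ {v w} → size (proj₁ v) ≡ k → size (proj₁ w) ≡ k → enc v ≡ enc w → v ≡ w
    inj {D , p} {E , q} _ _ e with odd p in ep | odd q in eq
    ... | false | false = wd-inj p q (trans ep (sym eq)) (∷ʳ-injectiveˡ (wd p) (wd q) e)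
    ... | true  | true  = wd-inj p q (trans ep (sym eq)) (neg-inj (∷ʳ-injectiveˡ (neg (wd p)) (neg (wd q)) e))
    ... | false | true  with ∷ʳ-injectiveʳ (wd p) (neg (wd q)) e
    ...   | ()
    inj {D , p} {E , q} _ _ e | true  | false with ∷ʳ-injectiveʳ (neg (wd p)) (wd q) e
    ...   | ()
    sz : ∀ {D} (p : Pt D) → length (wd p) ≡ k + k → size D ≡ k
    sz {D} p e = dbl (trans (sym (len-wd p)) e) refl
    last : ∀ (w : Word) {j} → length w ≡ suc j → ∃₂ λ v b → w ≡ v ++ b ∷ []
    last w e with initLast w
    last _ () | []
    ... | v ∷ʳ′ b = v , b , refl
    enc-even : ∀ {D} (p : Pt D) → odd p ≡ false → enc (D , p) ≡ wd p ++ false ∷ []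
    enc-even p e with odd p
    ... | false = refl
    enc-odd : ∀ {D} (p : Pt D) → odd p ≡ true → enc (D , p) ≡ neg (wd p) ++ true ∷ []
    enc-odd p e with odd p
    ... | true = refl
    sur : ∀ {w} → IsW (suc (k + k)) k w → ∃ λ v → size (proj₁ v) ≡ k × enc v ≡ w
    sur {w} (l , o) with last w l
    ... | v , false , refl = fin (locate (length v) v false ℕₚ.≤-refl bl)
      where
      lv : length v ≡ k + k
      lv = ℕₚ.suc-injective (trans (sym (len v false refl)) l)
      ov : ones v ≡ k
      ov = trans (sym (ℕₚ.+-identityʳ _)) (trans (sym (ones-++ v (false ∷ []))) o)
      bl : ones v ≡ zeros v
      bl = trans ov (ℕₚ.+-cancelˡ-≡ k k (zeros v) (trans (sym lv) (trans (sym (ones+zeros v)) (cong (_+ zeros v) ov))))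
      fin : (∃ λ D → Σ (Pt D) λ p → wd p ≡ v × odd p ≡ false) → _
      fin (D , p , refl , e) = (D , p) , sz p lv , enc-even p e
    ... | v , true , refl = fin (locate (length (neg v)) (neg v) true ℕₚ.≤-refl bl)
      where
      lv : length v ≡ k + k
      lv = ℕₚ.suc-injective (trans (sym (len v true refl)) l)
      ov : suc (ones v) ≡ k
      ov = trans (ℕₚ.+-comm 1 (ones v)) (trans (sym (ones-++ v (true ∷ []))) o)
      bl : zeros v ≡ 2 + zeros (neg v)
      bl = trans (ℕₚ.+-cancelˡ-≡ (ones v) _ _ (trans (ones+zeros v) (trans lv (trans (sym (cong₂ _+_ ov ov)) (sym (trans (ℕₚ.+-suc (ones v) _) (cong suc (refl))))))))
             (cong (λ x → 2 + ones x) (sym (neg-neg v)))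
      fin : (∃ λ D → Σ (Pt D) λ p → wd p ≡ neg v × odd p ≡ true) → _
      fin (D , p , e , e′) = (D , p) , sz p (trans (cong length e) (trans (length-map not v) lv)) ,
        trans (enc-odd p e′) (cong (_++ true ∷ []) (trans (cong neg e) (neg-neg v)))

open OddGraphs using (odd-graph; ones-++)

-- Words with a given number of ones, and binomial coefficients.

module Doubling where

  _≟ʷ_ : (v w : Word) → Dec (v ≡ w)
  _≟ʷ_ = ≡-dec _≟ᵇ_

  iter : ∀ {A : Set} → (A → A) → ℕ → A → A
  iter f zero    x = x
  iter f (suc n) x = iter f n (f x)

  iter-comm : ∀ {A : Set} (f : A → A) n x → iter f n (f x) ≡ f (iter f n x)
  iter-comm f zero    x = refl
  iter-comm f (suc n) x = iter-comm f n (f x)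

  iter-+ : ∀ {A : Set} (f : A → A) m n x → iter f (m + n) x ≡ iter f n (iter f m x)
  iter-+ f zero    n x = refl
  iter-+ f (suc m) n x = iter-+ f m n (f x)

  words : ℕ → ℕ → List Word
  words zero    zero    = [] ∷ []
  words zero    (suc k) = []
  words (suc n) zero    = map (false ∷_) (words n zero)
  words (suc n) (suc k) = map (true ∷_) (words n k) ++ map (false ∷_) (words n (suc k))

  ∈-words⁻ : ∀ n k {w} → w ∈ words n k → IsW n k w
  ∈-words⁻ zero    zero    (here refl) = refl , refl
  ∈-words⁻ (suc n) zero    i with ∈-map⁻ (false ∷_) i
  ... | w , j , refl = cong suc (proj₁ (∈-words⁻ n zero j)) , proj₂ (∈-words⁻ n zero j)
  ∈-words⁻ (suc n) (suc k) i with ∈-++⁻ (map (true ∷_) (words n k)) i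
  ... | inj₁ j with ∈-map⁻ (true ∷_) j
  ...   | w , l , refl = cong suc (proj₁ (∈-words⁻ n k l)) , cong suc (proj₂ (∈-words⁻ n k l))
  ∈-words⁻ (suc n) (suc k) i | inj₂ j with ∈-map⁻ (false ∷_) j
  ...   | w , l , refl = cong suc (proj₁ (∈-words⁻ n (suc k) l)) , proj₂ (∈-words⁻ n (suc k) l)

  ∈-words⁺ : ∀ n k {w} → IsW n k w → w ∈ words n k
  ∈-words⁺ zero    zero    {[]}        _       = here refl
  ∈-words⁺ zero    (suc k) {[]}        (_ , ())
  ∈-words⁺ (suc n) zero    {false ∷ w} (l , o) = ∈-map⁺ (false ∷_) (∈-words⁺ n zero (ℕₚ.suc-injective l , o))
  ∈-words⁺ (suc n) (suc k) {true ∷ w}  (l , o) = ∈-++⁺ˡ (∈-map⁺ (true ∷_) (∈-words⁺ n k (ℕₚ.suc-injective l , ℕₚ.suc-injective o)))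
  ∈-words⁺ (suc n) (suc k) {false ∷ w} (l , o) = ∈-++⁺ʳ (map (true ∷_) (words n k)) (∈-map⁺ (false ∷_) (∈-words⁺ n (suc k) (ℕₚ.suc-injective l , o)))

  words-unique : ∀ n k → Unique (words n k)
  words-unique zero    zero    = [] ∷ []
  words-unique zero    (suc k) = []
  words-unique (suc n) zero    = UP.map⁺ (λ { refl → refl }) (words-unique n zero)
  words-unique (suc n) (suc k) = UP.++⁺ (UP.map⁺ (λ { refl → refl }) (words-unique n k)) (UP.map⁺ (λ { refl → refl }) (words-unique n (suc k))) dis
    where
    dis : ∀ {w} → w ∈ map (true ∷_) (words n k) × w ∈ map (false ∷_) (words n (suc k)) → ⊥
    dis (i , j) with ∈-map⁻ (true ∷_) i | ∈-map⁻ (false ∷_) j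
    ... | _ , _ , refl | _ , _ , ()

  binom : ℕ → ℕ → ℕ
  binom n k = length (words n k)

  pascal : ∀ n k → binom (suc n) (suc k) ≡ binom n k + binom n (suc k)
  pascal n k = trans (length-++ (map (true ∷_) (words n k))) (cong₂ _+_ (length-map _ (words n k)) (length-map _ (words n (suc k))))

  binom-zero : ∀ n → binom n 0 ≡ 1
  binom-zero zero    = refl
  binom-zero (suc n) = trans (length-map _ (words n 0)) (binom-zero n)

  -- The recursion (k+1)C(n,k+1) = (n-k)C(n,k) without subtraction.
  absorb : ∀ n k → suc k * binom n (suc k) + k * binom n k ≡ n * binom n k
  absorb zero    zero    = refl
  absorb zero    (suc k) = cong₂ _+_ (ℕₚ.*-zeroʳ (suc (suc k))) (ℕₚ.*-zeroʳ (suc k))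
  absorb (suc n) zero    = begin
    1 * binom (suc n) 1 + 0            ≡⟨ solve 1 (λ x → con 1 :* x :+ con 0 := x) refl _ ⟩
    binom (suc n) 1                    ≡⟨ pascal n 0 ⟩
    binom n 0 + binom n 1              ≡⟨ cong (binom n 0 +_) (solve 1 (λ x → x := con 1 :* x :+ con 0) refl _) ⟩
    binom n 0 + (1 * binom n 1 + 0)    ≡⟨ cong (binom n 0 +_) (absorb n 0) ⟩
    suc n * binom n 0                  ≡⟨ cong (suc n *_) (trans (binom-zero n) (sym (binom-zero (suc n)))) ⟩
    suc n * binom (suc n) 0            ∎
    where open ≡-Reasoning
          open +-*-Solver
  absorb (suc n) (suc k) = begin
    suc (suc k) * binom (suc n) (suc (suc k)) + suc k * binom (suc n) (suc k)
      ≡⟨ cong₂ (λ x y → suc (suc k) * x + suc k * y) (pascal n (suc k)) (pascal n k) ⟩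
    suc (suc k) * (b + a) + suc k * (c + b)
      ≡⟨ solve 4 (λ k a b c → (con 2 :+ k) :* (b :+ a) :+ (con 1 :+ k) :* (c :+ b)
                   := ((con 2 :+ k) :* a :+ (con 1 :+ k) :* b) :+ ((con 1 :+ k) :* b :+ k :* c) :+ (b :+ c)) refl k a b c ⟩
    (suc (suc k) * a + suc k * b) + (suc k * b + k * c) + (b + c)
      ≡⟨ cong₂ (λ x y → x + y + (b + c)) (absorb n (suc k)) (absorb n k) ⟩
    n * b + n * c + (b + c)
      ≡⟨ solve 3 (λ n b c → n :* b :+ n :* c :+ (b :+ c) := (con 1 :+ n) :* (c :+ b)) refl n b c ⟩
    suc n * (c + b)
      ≡⟨ cong (suc n *_) (sym (pascal n k)) ⟩
    suc n * binom (suc n) (suc k) ∎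
    where
    open ≡-Reasoning
    open +-*-Solver
    a = binom n (suc (suc k))
    b = binom n (suc k)
    c = binom n k

  binom-pos : ∀ n k → k ≤ n → 1 ≤ binom n k
  binom-pos n       zero    _       = ℕₚ.≤-reflexive (sym (binom-zero n))
  binom-pos (suc n) (suc k) (s≤s l) = ℕₚ.≤-trans (ℕₚ.≤-trans (binom-pos n k l) (ℕₚ.m≤m+n _ _)) (ℕₚ.≤-reflexive (sym (pascal n k)))

  -- In `absorb` the ratio (n-k)/(k+1) exceeds 1 as long as 2(k+1) is at most n.
  binom-mono : ∀ n k → 2 * suc k ≤ n → binom n k < binom n (suc k)
  binom-mono n k l = ℕₚ.≰⇒> λ le → ℕₚ.<-irrefl (absorb n k) (begin-strict
    suc k * binom n (suc k) + k * binom n k   ≤⟨ ℕₚ.+-monoˡ-≤ (k * binom n k) (ℕₚ.*-monoʳ-≤ (suc k) le) ⟩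
    suc k * binom n k + k * binom n k         ≡⟨ solve 2 (λ k x → (con 1 :+ k) :* x :+ k :* x := (con 1 :+ con 2 :* k) :* x) refl k (binom n k) ⟩
    suc (2 * k) * binom n k                   <⟨ ℕₚ.+-monoˡ-≤ _ (binom-pos n k (ℕₚ.≤-trans (ℕₚ.m≤n*m k 2) (ℕₚ.≤-trans (ℕₚ.*-monoʳ-≤ 2 (ℕₚ.n≤1+n k)) l))) ⟩
    suc (suc (2 * k)) * binom n k             ≡⟨ cong (_* binom n k) (solve 1 (λ k → con 2 :+ con 2 :* k := con 2 :* (con 1 :+ k)) refl k) ⟩
    2 * suc k * binom n k                     ≤⟨ ℕₚ.*-monoˡ-≤ (binom n k) l ⟩
    n * binom n k                             ∎)
    where open ℕₚ.≤-Reasoning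
          open +-*-Solver

  pigeonhole : ∀ {A : Set} (xs ys : List A) → Unique xs → (∀ {x} → x ∈ xs → x ∈ ys) → length xs ≤ length ys
  pigeonhole []       ys _       _ = z≤n
  pigeonhole (x ∷ xs) ys (n ∷ u) f with ∈-∃++ (f (here refl))
  ... | as , bs , refl = ℕₚ.≤-trans (s≤s (pigeonhole xs (as ++ bs) u g)) (ℕₚ.≤-reflexive (sym (↭-length (shift x as bs))))
    where
    g : ∀ {y} → y ∈ xs → y ∈ as ++ bs
    g i with ∈-resp-↭ (shift x as bs) (f (there i))
    ... | here refl = ⊥-elim (All.lookup n i refl)
    ... | there j   = j

  -- Beyond the end of the word the value is true, so that false positions exist.
  nth : ℕ → Word → Bool
  nth i       []      = true
  nth zero    (b ∷ w) = b
  nth (suc i) (b ∷ w) = nth i w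

  insert : ℕ → Bool → Word → Word
  insert zero    b w       = b ∷ w
  insert (suc i) b []      = b ∷ []
  insert (suc i) b (a ∷ w) = a ∷ insert i b w

  insert-inj : ∀ i b v w → insert i b v ≡ insert i b w → v ≡ w
  insert-inj zero    b v       .v      refl = refl
  insert-inj (suc i) b []      []      _    = refl
  insert-inj (suc zero)    b [] (a ∷ w) ()
  insert-inj (suc (suc i)) b [] (a ∷ []) ()
  insert-inj (suc (suc i)) b [] (a ∷ (_ ∷ _)) ()
  insert-inj (suc zero)    b (a ∷ v) [] ()
  insert-inj (suc (suc i)) b (a ∷ []) [] ()
  insert-inj (suc (suc i)) b (a ∷ (_ ∷ _)) [] ()
  insert-inj (suc i) b (x ∷ v) (y ∷ w) e with Data.List.Properties.∷-injective e
  ... | refl , e′ = cong (x ∷_) (insert-inj i b v w e′)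

  insert-nth : ∀ i b w → i ≤ length w → nth i (insert i b w) ≡ b
  insert-nth zero    b w       _       = refl
  insert-nth (suc i) b (_ ∷ w) (s≤s l) = insert-nth i b w l

  insert-len : ∀ i b w → length (insert i b w) ≡ suc (length w)
  insert-len zero    b w       = refl
  insert-len (suc i) b []      = refl
  insert-len (suc i) b (_ ∷ w) = cong suc (insert-len i b w)

  insert-ones : ∀ i b w → ones (insert i b w) ≡ ones (b ∷ w)
  insert-ones zero    b     w           = refl
  insert-ones (suc i) b     []          = refl
  insert-ones (suc i) true  (true ∷ w)  = cong suc (insert-ones i true w)
  insert-ones (suc i) false (true ∷ w)  = cong suc (insert-ones i false w)
  insert-ones (suc i) true  (false ∷ w) = insert-ones i true w
  insert-ones (suc i) false (false ∷ w) = insert-ones i false w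

  delete : ∀ i w → i < length w → ∃ λ v → w ≡ insert i (nth i w) v
  delete zero    (b ∷ w) _       = w , refl
  delete (suc i) (b ∷ w) (s≤s l) with delete i w l
  ... | v , e = b ∷ v , cong (b ∷_) e

  ⊥-nth : ∀ {v w} i → v ⊥ʷ w → i < length v → nth i v ≡ true → nth i w ≡ false
  ⊥-nth zero    (_∷_ {true} {false} _ _) _ refl = refl
  ⊥-nth (suc i) (_ ∷ d) (s≤s l) e = ⊥-nth i d l e

  -- Levels: permutations of the vertices of K(2j+s,j) along edges.

  size : ℕ → ℕ → ℕ
  size s j = j + j + s

  -- A step w → w′ is described by a pattern: F marks a slot that is full in w, G one that is full in
  -- w′, and * a free one.  The step ε → ε′ has the pattern *ˢ(FG)ʲ.
  pairsF pairsG : ℕ → Word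
  pairsF zero    = []
  pairsF (suc j) = true ∷ false ∷ pairsF j
  pairsG zero    = []
  pairsG (suc j) = false ∷ true ∷ pairsG j

  ε ε′ : ℕ → ℕ → Word
  ε s j = replicate s false ++ pairsF j
  ε′ s j = replicate s false ++ pairsG j

  -- The pattern FGF*G of the second pentagon of the Petersen graph.
  β β′ : Word
  β  = true ∷ false ∷ true ∷ false ∷ false ∷ []
  β′ = false ∷ true ∷ false ∷ false ∷ true ∷ []

  -- Several cycles are allowed, so as to admit the two pentagons; the common period is
  -- `suc period`.
  record Level (s j : ℕ) : Set where
    field
      next   : Word → Word
      period : ℕ
      next-W : ∀ {w} → IsW (size s j) j w → IsW (size s j) j (next w)
      next-⊥ : ∀ {w} → IsW (size s j) j w → w ⊥ʷ next w
      cycle  : ∀ {w} → IsW (size s j) j w → iter next (suc period) w ≡ w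

    iter-W : ∀ n {w} → IsW (size s j) j w → IsW (size s j) j (iter next n w)
    iter-W zero    p = p
    iter-W (suc n) p = iter-W n (next-W p)

    Free : ℕ → Word → Set
    Free i w = nth i w ≡ false × nth i (next w) ≡ false

    -- A position that is free once is free at times of both parities: between two free times of
    -- the same parity only, the values would alternate.
    private
      search : ∀ i → i < size s j → ∀ n w → IsW (size s j) j w → nth i w ≡ false → nth i (iter next (n + n) (next w)) ≡ false →
               ∃ λ t → (∀ b → iter not t b ≡ b) × Free i (iter next t w)
      search i l zero    w p e e′ = 0 , (λ _ → refl) , e , e′
      search i l (suc n) w p e e′ with nth i (next w) in eq
      ... | false = 0 , (λ _ → refl) , e , eq
      ... | true with search i l n (next (next w)) (next-W (next-W p))
                        (⊥-nth i (next-⊥ (next-W p)) (subst (i <_) (sym (proj₁ (next-W p))) l) eq)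
                        (subst (λ m → nth i (iter next m (next (next w))) ≡ false) (ℕₚ.+-suc n n) e′)
      ...   | t , par , fr = suc (suc t) , (λ b → trans (cong (iter not t) (not-involutive b)) (par b)) , fr

    cycles : ∀ n {w} → IsW (size s j) j w → iter next (n * suc period) w ≡ w
    cycles zero    p = refl
    cycles (suc n) {w} p = trans (iter-+ next (suc period) (n * suc period) w) (trans (cong (iter next (n * suc period)) (cycle p)) (cycles n p))

    both : ∀ i → i < size s j → ∀ {w} → IsW (size s j) j w → (∃ λ t → Free i (iter next t w)) →
           ∀ b → ∃ λ t → iter not t b ≡ true × Free i (iter next t w)
    both i l {w} p (t , fr) b with iter not t b in eq
    ... | true  = t , eq , fr
    -- Two rounds are an even number of steps whatever the period is; starting one step after a free
    -- time shifts the parity.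
    ... | false with search i l period (next w₀) (next-W pw) (proj₂ fr)
                       (subst (λ x → nth i x ≡ false) (sym (trans (cong (λ m → iter next m w₀) lem) (cycles 2 pw))) (proj₁ fr))
      where
      w₀ = iter next t w
      pw = iter-W t p
      lem : suc (suc (period + period)) ≡ 2 * suc period
      lem = solve 1 (λ x → con 2 :+ (x :+ x) := con 2 :* (con 1 :+ x)) refl period
        where open +-*-Solver
    ...   | t′ , par , fr′ = t + suc t′ , trans (iter-+ not t (suc t′) b) (trans (cong (λ x → iter not t′ (not x)) eq) (par true)) ,
              subst (Free i) (sym (iter-+ next t (suc t′) w)) fr′

  -- By `next-ε` one step is the same for all permutations, so that the linking triples can be
  -- written down explicitly; `reach` says that every orbit passes the tail of such a step, with `β`
  -- for the second pentagon.
  record Level⁺ (s j : ℕ) : Set where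
    field
      level : Level s j
    open Level level public
    field
      free   : ∀ i → i < size s j → ∀ {w} → IsW (size s j) j w → ∃ λ t → Free i (iter next t w)
      next-ε : next (ε s j) ≡ ε′ s j
      reach  : ∀ {w} → IsW (size s j) j w → ∃ λ t → iter next t w ≡ ε s j ⊎ (iter next t w ≡ β × next β ≡ β′)

  -- From a Hamilton cycle to a level.

  module Successor {A : Set} (_≟_ : (x y : A) → Dec (x ≡ y)) where

    private
      headOr : A → List A → A
      headOr z []      = z
      headOr z (y ∷ _) = y

    succ : A → List A → A → A
    succ z []       w = z
    succ z (x ∷ xs) w with w ≟ x
    ... | yes _ = headOr z xs
    ... | no  _ = succ z xs w

    succ-walk : ∀ {R : A → A → Set} z {a b xs} → Unique xs → Walk R a b xs →
                Walk (λ x y → R x y × succ z xs x ≡ y) a b xs × succ z xs b ≡ z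
    succ-walk z u (∎ a) = ∎ a , single
      where
      single : succ z (a ∷ []) a ≡ z
      single with a ≟ a
      ... | yes _ = refl
      ... | no _  = refl
    succ-walk {R} z (n ∷ u) (_∷_ {a} {b} {c} {ys} r w) with succ-walk z u w
    ... | w′ , e = (r , first ys w) ∷ mapW (λ i (r , e) → r , trans (skip ys (λ q → All.lookup n i (sym q))) e) w′ ,
                   trans (skip ys (λ q → All.lookup n (last∈ w) (sym q))) e
      where
      first : ∀ ys → Walk R b c ys → succ z (a ∷ ys) a ≡ b
      first _ (∎ _) with a ≟ a
      ... | yes _ = refl
      ... | no ne = ⊥-elim (ne refl)
      first _ (_ ∷ _) with a ≟ a
      ... | yes _ = refl
      ... | no ne = ⊥-elim (ne refl)
      skip : ∀ ys {x} → x ≢ a → succ z (a ∷ ys) x ≡ succ z ys x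
      skip ys {x} ne with x ≟ a
      ... | yes e = ⊥-elim (ne e)
      ... | no _  = refl

    along : ∀ {R : A → A → Set} (h : A → A) {a b xs} → Walk (λ x y → R x y × h x ≡ y) a b xs → ∃ λ n → suc n ≡ length xs × iter h n a ≡ b
    along h (∎ _) = 0 , refl , refl
    along h ((_ , refl) ∷ w) with along h w
    ... | n , e , e′ = suc n , cong suc e , e′

    module _ {P : A → Set} {R : A → A → Set} (H : Ham P R) where
      open Ham H
      private
        a = proj₁ cyc
        b = proj₁ (proj₂ cyc)

      hnext : A → A
      hnext = succ a verts

      private
        cyc′ : Cyc (λ x y → R x y × hnext x ≡ y) verts
        cyc′ with succ-walk a uniq (proj₁ (proj₂ (proj₂ cyc)))
        ... | w , e = a , b , w , proj₂ (proj₂ (proj₂ cyc)) , e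

      hnext-R : ∀ {x} → P x → R x (hnext x)
      hnext-R p with rotate (full p) cyc′
      ... | _ , _ , _ , (r , refl) , _ = r

      hnext-P : ∀ {x} → P x → P (hnext x)
      hnext-P p with rotate (full p) cyc′
      ... | _ , _ , w , (_ , refl) , q = sound (∈-resp-↭ q (first∈ w))

      hcycle : ∀ {x} → P x → iter hnext (length verts) x ≡ x
      hcycle {x} p with rotate (full p) cyc′
      ... | _ , ys , w , (_ , refl) , q with along hnext w
      ... | n , e , e′ = trans (cong (λ m → iter hnext m x) (sym (trans e (↭-length q)))) e′

      hreach : ∀ {x y} → P x → P y → ∃ λ t → iter hnext t x ≡ y
      hreach {x} {y} p q with rotate (full q) cyc′
      ... | _ , ys , w , _ , r with splitW (∈-resp-↭ (↭-sym r) (full p)) w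
      ... | _ , _ , inj₁ (refl , _) = 0 , refl
      ... | _ , _ , inj₂ (_ , _ , (_ , refl) , v , _) with along hnext v
      ...   | n , _ , e = suc n , e

  open Successor _≟ʷ_

  -- Only the shape of the permutation matters, not the entries, so that one found for lists of
  -- pairs acts on words.
  act : ∀ {A : Set} {xs ys : List A} → xs ↭ ys → Word → Word
  act _↭_.refl         w           = w
  act (prep x p)   []          = []
  act (prep x p)   (b ∷ w)     = b ∷ act p w
  act (swap x y p) []          = []
  act (swap x y p) (b ∷ [])    = b ∷ []
  act (swap x y p) (b ∷ c ∷ w) = c ∷ b ∷ act p w
  act (_↭_.trans p q)  w           = act q (act p w)

  act-map : ∀ {A : Set} (f : A → Bool) {xs ys : List A} (p : xs ↭ ys) → act p (map f xs) ≡ map f ys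
  act-map f _↭_.refl         = refl
  act-map f (prep x p)   = cong (f x ∷_) (act-map f p)
  act-map f (swap x y p) = cong (λ w → f y ∷ f x ∷ w) (act-map f p)
  act-map f (_↭_.trans p q)  = trans (cong (act q) (act-map f p)) (act-map f q)

  act-sym : ∀ {A : Set} {xs ys : List A} (p : xs ↭ ys) w → act (↭-sym p) (act p w) ≡ w
  act-sym _↭_.refl         w           = refl
  act-sym (prep x p)   []          = refl
  act-sym (prep x p)   (b ∷ w)     = cong (b ∷_) (act-sym p w)
  act-sym (swap x y p) []          = refl
  act-sym (swap x y p) (b ∷ [])    = refl
  act-sym (swap x y p) (b ∷ c ∷ w) = cong (λ w → b ∷ c ∷ w) (act-sym p w)
  act-sym (_↭_.trans p q)  w           = trans (cong (act (↭-sym p)) (act-sym q (act p w))) (act-sym p w)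

  act-sym′ : ∀ {A : Set} {xs ys : List A} (p : xs ↭ ys) w → act p (act (↭-sym p) w) ≡ w
  act-sym′ _↭_.refl         w           = refl
  act-sym′ (prep x p)   []          = refl
  act-sym′ (prep x p)   (b ∷ w)     = cong (b ∷_) (act-sym′ p w)
  act-sym′ (swap x y p) []          = refl
  act-sym′ (swap x y p) (b ∷ [])    = refl
  act-sym′ (swap x y p) (b ∷ c ∷ w) = cong (λ w → b ∷ c ∷ w) (act-sym′ p w)
  act-sym′ (_↭_.trans p q)  w           = trans (cong (act q) (act-sym′ p (act (↭-sym q) w))) (act-sym′ q w)

  act-↭ : ∀ {A : Set} {xs ys : List A} (p : xs ↭ ys) w → act p w ↭ w
  act-↭ _↭_.refl         w           = ↭-refl
  act-↭ (prep x p)   []          = ↭-refl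
  act-↭ (prep x p)   (b ∷ w)     = prep b (act-↭ p w)
  act-↭ (swap x y p) []          = ↭-refl
  act-↭ (swap x y p) (b ∷ [])    = ↭-refl
  act-↭ (swap x y p) (b ∷ c ∷ w) = swap c b (act-↭ p w)
  act-↭ (_↭_.trans p q)  w           = ↭-trans (act-↭ q (act p w)) (act-↭ p w)

  ones-↭ : ∀ {v w} → v ↭ w → ones v ≡ ones w
  ones-↭ _↭_.refl                 = refl
  ones-↭ (prep true p)        = cong suc (ones-↭ p)
  ones-↭ (prep false p)       = ones-↭ p
  ones-↭ (swap true true p)   = cong (λ n → suc (suc n)) (ones-↭ p)
  ones-↭ (swap true false p)  = cong suc (ones-↭ p)
  ones-↭ (swap false true p)  = cong suc (ones-↭ p)
  ones-↭ (swap false false p) = ones-↭ p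
  ones-↭ (_↭_.trans p q)          = trans (ones-↭ p) (ones-↭ q)

  act-W : ∀ {A : Set} {xs ys : List A} (p : xs ↭ ys) {n k w} → IsW n k w → IsW n k (act p w)
  act-W p {w = w} (l , o) = trans (↭-length (act-↭ p w)) l , trans (ones-↭ (act-↭ p w)) o

  act-⊥ : ∀ {A : Set} {xs ys : List A} (p : xs ↭ ys) {v w} → v ⊥ʷ w → act p v ⊥ʷ act p w
  act-⊥ _↭_.refl         d           = d
  act-⊥ (prep x p)   []          = []
  act-⊥ (prep x p)   (e ∷ d)     = e ∷ act-⊥ p d
  act-⊥ (swap x y p) []          = []
  act-⊥ (swap x y p) (e ∷ [])    = e ∷ []
  act-⊥ (swap x y p) (e ∷ e′ ∷ d) = e′ ∷ e ∷ act-⊥ p d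
  act-⊥ (_↭_.trans p q)  d           = act-⊥ q (act-⊥ p d)

  -- Two pairs of disjoint words of the same type differ by a permutation of the positions.
  normal : ∀ {v w} a b c → v ⊥ʷ w → ones v ≡ a → ones w ≡ b → length v ≡ a + b + c →
    zip v w ↭ replicate a (true , false) ++ (replicate b (false , true) ++ replicate c (false , false))
  normal zero zero zero [] _ _ _ = ↭-refl
  normal zero zero (suc c) [] _ _ ()
  normal zero (suc b) c [] _ () _
  normal (suc a) b c [] () _ _
  normal (suc a) b c (_∷_ {true} {false} _ d) o o′ l = prep _ (normal a b c d (ℕₚ.suc-injective o) o′ (ℕₚ.suc-injective l))
  normal zero b c (_∷_ {true} {false} _ d) () _ _
  normal a b c (_∷_ {true} {true} () d)
  normal a zero c (_∷_ {false} {true} _ d) _ () _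
  normal a (suc b) c (_∷_ {false} {true} _ d) o o′ l =
    ↭-trans (prep _ (normal a b c d o (ℕₚ.suc-injective o′) (ℕₚ.suc-injective (trans l (cong (_+ c) (ℕₚ.+-suc a b))))))
      (↭-sym (shift (false , true) (replicate a (true , false)) _))
  normal a b (suc c) (_∷_ {false} {false} _ d) o o′ l =
    ↭-trans (prep _ (normal a b c d o o′ (ℕₚ.suc-injective (trans l (ℕₚ.+-suc (a + b) c)))))
      (↭-trans (↭-sym (shift (false , false) (replicate a (true , false)) _))
        (++⁺ˡ (replicate a (true , false)) (↭-sym (shift (false , false) (replicate b (false , true)) _))))
  normal {_ ∷ v} {_ ∷ w} a b zero (_∷_ {false} {false} _ d) o o′ l =
    ⊥-elim (ℕₚ.<-irrefl (trans (cong₂ _+_ o o′) (trans (sym (ℕₚ.+-identityʳ _)) (sym l))) (s≤s (few d)))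
    where
    few : ∀ {v w} → v ⊥ʷ w → ones v + ones w ≤ length v
    few [] = z≤n
    few (_∷_ {true} {false} _ d) = s≤s (few d)
    few (_∷_ {false} {true} {v} {w} _ d) = ℕₚ.≤-trans (ℕₚ.≤-reflexive (ℕₚ.+-suc (ones v) (ones w))) (s≤s (few d))
    few (_∷_ {false} {false} _ d) = ℕₚ.m≤n⇒m≤1+n (few d)

  map-proj₁-zip : ∀ {v w} → v ⊥ʷ w → map proj₁ (zip v w) ≡ v
  map-proj₁-zip []      = refl
  map-proj₁-zip (_ ∷ d) = cong (_ ∷_) (map-proj₁-zip d)

  map-proj₂-zip : ∀ {v w} → v ⊥ʷ w → map proj₂ (zip v w) ≡ w
  map-proj₂-zip []      = refl
  map-proj₂-zip (_ ∷ d) = cong (_ ∷_) (map-proj₂-zip d)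

  ε-W : ∀ s j → IsW (size s j) j (ε s j)
  ε-W zero    zero    = refl , refl
  ε-W zero    (suc j) = cong suc (trans (cong suc (trans (proj₁ (ε-W zero j)) refl)) (cong (_+ 0) (sym (ℕₚ.+-suc j j)))) , cong suc (proj₂ (ε-W zero j))
  ε-W (suc s) j       = trans (cong suc (proj₁ (ε-W s j))) (sym (ℕₚ.+-suc (j + j) s)) , proj₂ (ε-W s j)

  ε′-ones : ∀ s j → ones (ε′ s j) ≡ j
  ε′-ones zero    zero    = refl
  ε′-ones zero    (suc j) = cong suc (ε′-ones zero j)
  ε′-ones (suc s) j       = ε′-ones s j

  ε-⊥ : ∀ s j → ε s j ⊥ʷ ε′ s j
  ε-⊥ zero    zero    = []
  ε-⊥ zero    (suc j) = refl ∷ refl ∷ ε-⊥ zero j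
  ε-⊥ (suc s) j       = refl ∷ ε-⊥ s j

  record Transitive (s j : ℕ) : Set where
    field
      level : Level s j
    open Level level public
    field
      reaches : ∀ {v w} → IsW (size s j) j v → IsW (size s j) j w → ∃ λ t → iter next t v ≡ w

    next-inj : ∀ {v w} → IsW (size s j) j v → IsW (size s j) j w → next v ≡ next w → v ≡ w
    next-inj p q e = trans (sym (cycle p)) (trans (cong (iter next period) e) (cycle q))

  ham⇒transitive : ∀ s j {w} → IsW (size s j) j w → HamK (size s j) j → Transitive s j
  ham⇒transitive s j {v} p H = record
    { level = record { next = hnext H ; period = proj₁ ne ; next-W = hnext-P H ; next-⊥ = hnext-R H
                     ; cycle = λ {w} q → trans (cong (λ n → iter (hnext H) n w) (sym (proj₂ ne))) (hcycle H q) }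
    ; reaches = hreach H }
    where
    ne : ∃ λ n → length (Ham.verts H) ≡ suc n
    ne with Ham.verts H | Ham.full H {v} p
    ... | _ ∷ vs | _ = length vs , refl

  module Relabel {s j : ℕ} (T : Transitive s j) {A : Set} {xs ys : List A} (π : xs ↭ ys) where
    open Transitive T
    private
      to from h : Word → Word
      to   = act π
      from = act (↭-sym π)
      h w  = to (next (from w))
      conj : ∀ n w → iter h n w ≡ to (iter next n (from w))
      conj zero    w = sym (act-sym′ π w)
      conj (suc n) w = trans (conj n (h w)) (cong (λ x → to (iter next n x)) (act-sym π (next (from w))))

    relabel : Transitive s j
    relabel = record
      { level = record
        { next = h ; period = period
        ; next-W = λ p → act-W π (next-W (act-W (↭-sym π) p))
        ; next-⊥ = λ {w} p → subst (_⊥ʷ h w) (act-sym′ π w) (act-⊥ π (next-⊥ (act-W (↭-sym π) p)))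
        ; cycle = λ {w} p → trans (conj (suc period) w) (trans (cong to (cycle (act-W (↭-sym π) p))) (act-sym′ π w)) }
      ; reaches = λ {v} {w} p q → let (t , e) = reaches (act-W (↭-sym π) p) (act-W (↭-sym π) q)
                                  in t , trans (conj t v) (trans (cong to e) (act-sym′ π w)) }

  module Free {s′ j′ : ℕ} (T : Transitive (suc s′) (suc j′)) (i : ℕ) (l : i < size (suc s′) (suc j′)) where
    open Transitive T
    private
      j = suc j′
      n = j′ + j + suc s′

      free? : ∀ w → Dec (Free i w)
      free? w with nth i w | nth i (next w)
      ... | false | false = yes (refl , refl)
      ... | true  | _     = no λ ()
      ... | false | true  = no λ { (_ , ()) }

      Es Fs : List Word
      Es = map (insert i false) (words n j)
      Fs = map (insert i true) (words n j′)

      i≤ : ∀ {k w} → w ∈ words n k → i ≤ length w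
      i≤ {k} m = subst (i ≤_) (sym (proj₁ (∈-words⁻ n k m))) (ℕₚ.≤-pred l)

      E-W : ∀ {w} → w ∈ Es → IsW (suc n) j w × nth i w ≡ false
      E-W m with ∈-map⁻ (insert i false) m
      ... | v , k , refl = (trans (insert-len i false v) (cong suc (proj₁ (∈-words⁻ n j k))) , trans (insert-ones i false v) (proj₂ (∈-words⁻ n j k))) , insert-nth i false v (i≤ {j} k)

      F-∈ : ∀ {w} → IsW (suc n) j w → nth i w ≡ true → w ∈ Fs
      F-∈ {w} (p , o) e with delete i w (subst (i <_) (sym p) l)
      ... | v , e′ = subst (_∈ Fs) (sym w≡) (∈-map⁺ (insert i true) (∈-words⁺ n j′
              (ℕₚ.suc-injective (trans (sym (insert-len i true v)) (trans (cong length (sym w≡)) p)) ,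
               ℕₚ.suc-injective (trans (sym (insert-ones i true v)) (trans (cong ones (sym w≡)) o)))))
        where w≡ : w ≡ insert i true v
              w≡ = trans e′ (cong (λ b → insert i b v) e)

      -- Here `n` is 2j+s-1, one less than the length of the words; s ≥ 1 puts j into the increasing
      -- half of this row of Pascal's triangle.
      2j≤n : 2 * suc j′ ≤ n
      2j≤n = ℕₚ.≤-trans (ℕₚ.≤-reflexive (solve 1 (λ x → con 2 :* (con 1 :+ x) := x :+ (con 1 :+ x) :+ con 1) refl j′)) (ℕₚ.+-monoʳ-≤ (j′ + j) (s≤s (z≤n {s′})))
        where open +-*-Solver

      un : ∀ xs → (∀ {w} → w ∈ xs → w ∈ Es) → Unique xs → Unique (map next xs)
      un []       f []      = []
      un (x ∷ xs) f (u ∷ us) = All.tabulate (λ m → neq (∈-map⁻ next m)) ∷ un xs (λ m → f (there m)) us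
        where
        neq : ∀ {y} → (∃ λ z → z ∈ xs × y ≡ next z) → next x ≢ y
        neq (z , m , refl) e = All.lookup u m (next-inj (proj₁ (E-W (f (here refl)))) (proj₁ (E-W (f (there m)))) e)

      -- Otherwise next maps the words with false at i injectively to the fewer words with true at i.
      some : ∃ λ w → IsW (suc n) j w × Free i w
      some with any? free? (words (suc n) j)
      ... | yes a with find a
      ...   | w , m , fr = w , ∈-words⁻ (suc n) j m , fr
      some | no none = ⊥-elim (ℕₚ.<⇒≱ (binom-mono n j′ 2j≤n) le)
        where
        up : ∀ {w} → w ∈ Es → next w ∈ Fs
        up {w} m with E-W m
        ... | p , e with nth i (next w) in eq
        ...   | true  = F-∈ (next-W p) eq
        ...   | false = ⊥-elim (none (lose (∈-words⁺ (suc n) j p) (e , eq)))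
        fin : ∀ {y} → (∃ λ z → z ∈ Es × y ≡ next z) → y ∈ Fs
        fin (z , m , refl) = up m
        le : binom n j ≤ binom n j′
        le = subst₂ _≤_ (trans (length-map next Es) (length-map _ (words n j))) (length-map _ (words n j′))
          (pigeonhole (map next Es) Fs (un Es (λ m → m) (UP.map⁺ (λ {x} {y} → insert-inj i false x y) (words-unique n j))) (λ m → fin (∈-map⁻ next m)))

    freeAt : ∀ {w} → IsW (suc n) j w → ∃ λ t → Free i (iter next t w)
    freeAt p with some
    ... | v , q , fr with reaches p q
    ...   | t , e = t , subst (Free i) (sym e) fr

  module _ {s j : ℕ} (T : Transitive s j) where
    open Transitive T
    private
      w₀ = ε s j
      d₀ : w₀ ⊥ʷ next w₀
      d₀ = next-⊥ (ε-W s j)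

    -- Sorting the pairs carries the step out of `ε` to the prescribed one. As both steps start in
    -- the same word, the permutation fixes `ε`.
    relabelling : zip w₀ (next w₀) ↭ zip w₀ (ε′ s j)
    relabelling = ↭-trans (normal j j s d₀ (proj₂ (ε-W s j)) (proj₂ (next-W (ε-W s j))) (proj₁ (ε-W s j)))
      (↭-sym (normal j j s (ε-⊥ s j) (proj₂ (ε-W s j)) (ε′-ones s j) (proj₁ (ε-W s j))))

    relabelling-ε : ∀ (π : zip w₀ (next w₀) ↭ zip w₀ (ε′ s j)) → act π (next (act (↭-sym π) w₀)) ≡ ε′ s j
    relabelling-ε π = trans (cong (λ w → act π (next w)) from-w₀)
      (trans (cong (act π) (sym (map-proj₂-zip d₀))) (trans (act-map proj₂ π) (map-proj₂-zip (ε-⊥ s j))))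
      where
      to-w₀ : act π w₀ ≡ w₀
      to-w₀ = trans (cong (act π) (sym (map-proj₁-zip d₀))) (trans (act-map proj₁ π) (map-proj₁-zip (ε-⊥ s j)))
      from-w₀ : act (↭-sym π) w₀ ≡ w₀
      from-w₀ = trans (cong (act (↭-sym π)) (sym to-w₀)) (act-sym π w₀)

  mkLevel : ∀ s′ j′ → HamK (size (suc s′) (suc j′)) (suc j′) → Level⁺ (suc s′) (suc j′)
  mkLevel s′ j′ H = go (ham⇒transitive s j {ε s j} (ε-W s j) H)
    where
    s = suc s′
    j = suc j′
    go : Transitive s j → Level⁺ s j
    go T = fin (Relabel.relabel T (relabelling T)) (relabelling-ε T (relabelling T))
      where
      fin : (T : Transitive s j) → Transitive.next T (ε s j) ≡ ε′ s j → Level⁺ s j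
      fin T e = record
        { level = Transitive.level T ; free = λ i l p → Free.freeAt T i l p ; next-ε = e
        ; reach = λ p → let (t , q) = Transitive.reaches T {w = ε s j} p (ε-W s j) in t , inj₁ q }

  -- The pentagon of 01010, which is `ε 1 2`, is 01010, 00101, 11000, 00110, 10001; that of `β` is
  -- 10100, 01001, 10010, 01100, 00011. They are numbered so that the steps to `ε′` and `β′` hold
  -- without relabelling.
  petersen : Word → Word
  petersen (true ∷ true ∷ false ∷ false ∷ false ∷ []) = false ∷ false ∷ true ∷ true ∷ false ∷ []
  petersen (true ∷ false ∷ true ∷ false ∷ false ∷ []) = false ∷ true ∷ false ∷ false ∷ true ∷ []
  petersen (true ∷ false ∷ false ∷ true ∷ false ∷ []) = false ∷ true ∷ true ∷ false ∷ false ∷ []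
  petersen (true ∷ false ∷ false ∷ false ∷ true ∷ []) = false ∷ true ∷ false ∷ true ∷ false ∷ []
  petersen (false ∷ true ∷ true ∷ false ∷ false ∷ []) = false ∷ false ∷ false ∷ true ∷ true ∷ []
  petersen (false ∷ true ∷ false ∷ true ∷ false ∷ []) = false ∷ false ∷ true ∷ false ∷ true ∷ []
  petersen (false ∷ true ∷ false ∷ false ∷ true ∷ []) = true ∷ false ∷ false ∷ true ∷ false ∷ []
  petersen (false ∷ false ∷ true ∷ true ∷ false ∷ []) = true ∷ false ∷ false ∷ false ∷ true ∷ []
  petersen (false ∷ false ∷ true ∷ false ∷ true ∷ []) = true ∷ true ∷ false ∷ false ∷ false ∷ []
  petersen (false ∷ false ∷ false ∷ true ∷ true ∷ []) = true ∷ false ∷ true ∷ false ∷ false ∷ []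
  petersen w = w

  private
    each : (P : Word → Set) → All P (words 5 2) → ∀ w → IsW 5 2 w → P w
    each P a w p = All.lookup a (∈-words⁺ 5 2 {w} p)

    petersen-W : ∀ {w} → IsW 5 2 w → IsW 5 2 (petersen w)
    petersen-W {w} = each (λ w → IsW 5 2 (petersen w)) ((refl , refl) ∷ (refl , refl) ∷ (refl , refl) ∷ (refl , refl) ∷ (refl , refl) ∷ (refl , refl) ∷ (refl , refl) ∷ (refl , refl) ∷ (refl , refl) ∷ (refl , refl) ∷ []) w

    petersen-⊥ : ∀ {w} → IsW 5 2 w → w ⊥ʷ petersen w
    petersen-⊥ {w} = each (λ w → w ⊥ʷ petersen w)
      ((refl ∷ refl ∷ refl ∷ refl ∷ refl ∷ []) ∷ (refl ∷ refl ∷ refl ∷ refl ∷ refl ∷ []) ∷ (refl ∷ refl ∷ refl ∷ refl ∷ refl ∷ []) ∷ (refl ∷ refl ∷ refl ∷ refl ∷ refl ∷ []) ∷ (refl ∷ refl ∷ refl ∷ refl ∷ refl ∷ []) ∷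
       (refl ∷ refl ∷ refl ∷ refl ∷ refl ∷ []) ∷ (refl ∷ refl ∷ refl ∷ refl ∷ refl ∷ []) ∷ (refl ∷ refl ∷ refl ∷ refl ∷ refl ∷ []) ∷ (refl ∷ refl ∷ refl ∷ refl ∷ refl ∷ []) ∷ (refl ∷ refl ∷ refl ∷ refl ∷ refl ∷ []) ∷ []) w

    petersen-cycle : ∀ {w} → IsW 5 2 w → iter petersen 5 w ≡ w
    petersen-cycle {w} = each (λ w → iter petersen 5 w ≡ w) (refl ∷ refl ∷ refl ∷ refl ∷ refl ∷ refl ∷ refl ∷ refl ∷ refl ∷ refl ∷ []) w

    petersen-level : Level 1 2
    petersen-level = record { next = petersen ; period = 4 ; next-W = λ {w} → petersen-W {w} ; next-⊥ = λ {w} → petersen-⊥ {w} ; cycle = λ {w} → petersen-cycle {w} }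

    petersen-free : ∀ i → i < 5 → ∀ {w} → IsW 5 2 w → ∃ λ t → Level.Free petersen-level i (iter petersen t w)
    petersen-free 0 _ {w} = each (λ w → ∃ λ t → Level.Free petersen-level 0 (iter petersen t w)) ((3 , refl , refl) ∷ (3 , refl , refl) ∷ (1 , refl , refl) ∷ (1 , refl , refl) ∷ (0 , refl , refl) ∷ (0 , refl , refl) ∷ (2 , refl , refl) ∷ (2 , refl , refl) ∷ (4 , refl , refl) ∷ (4 , refl , refl) ∷ []) w
    petersen-free 1 _ {w} = each (λ w → ∃ λ t → Level.Free petersen-level 1 (iter petersen t w)) ((1 , refl , refl) ∷ (4 , refl , refl) ∷ (2 , refl , refl) ∷ (4 , refl , refl) ∷ (1 , refl , refl) ∷ (3 , refl , refl) ∷ (3 , refl , refl) ∷ (0 , refl , refl) ∷ (2 , refl , refl) ∷ (0 , refl , refl) ∷ []) w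
    petersen-free 2 _ {w} = each (λ w → ∃ λ t → Level.Free petersen-level 2 (iter petersen t w)) ((2 , refl , refl) ∷ (1 , refl , refl) ∷ (4 , refl , refl) ∷ (0 , refl , refl) ∷ (3 , refl , refl) ∷ (4 , refl , refl) ∷ (0 , refl , refl) ∷ (1 , refl , refl) ∷ (3 , refl , refl) ∷ (2 , refl , refl) ∷ []) w
    petersen-free 3 _ {w} = each (λ w → ∃ λ t → Level.Free petersen-level 3 (iter petersen t w)) ((4 , refl , refl) ∷ (0 , refl , refl) ∷ (3 , refl , refl) ∷ (2 , refl , refl) ∷ (2 , refl , refl) ∷ (1 , refl , refl) ∷ (4 , refl , refl) ∷ (3 , refl , refl) ∷ (0 , refl , refl) ∷ (1 , refl , refl) ∷ []) w
    petersen-free 4 _ {w} = each (λ w → ∃ λ t → Level.Free petersen-level 4 (iter petersen t w)) ((0 , refl , refl) ∷ (2 , refl , refl) ∷ (0 , refl , refl) ∷ (3 , refl , refl) ∷ (4 , refl , refl) ∷ (2 , refl , refl) ∷ (1 , refl , refl) ∷ (4 , refl , refl) ∷ (1 , refl , refl) ∷ (3 , refl , refl) ∷ []) w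
    petersen-free (suc (suc (suc (suc (suc i))))) (s≤s (s≤s (s≤s (s≤s (s≤s ())))))

  petersen⁺ : Level⁺ 1 2
  petersen⁺ = record
    { level = petersen-level ; free = λ i l {w} → petersen-free i l {w} ; next-ε = refl
    ; reach = λ {w} → each (λ w → ∃ λ t → iter petersen t w ≡ ε 1 2 ⊎ (iter petersen t w ≡ β × petersen β ≡ β′))
        ((3 , inj₁ refl) ∷ (0 , inj₂ (refl , refl)) ∷ (3 , inj₂ (refl , refl)) ∷ (1 , inj₁ refl) ∷ (2 , inj₂ (refl , refl)) ∷ (0 , inj₁ refl) ∷ (4 , inj₂ (refl , refl)) ∷ (2 , inj₁ refl) ∷ (4 , inj₁ refl) ∷ (1 , inj₂ (refl , refl)) ∷ []) w }

  -- Pairs of points as bits and slots; patterns of a step.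

  Frame : Set
  Frame = List (Maybe Bool)

  -- In the frame `nothing` is a slot and `just b` a bit, where `b` tells which point of the pair is
  -- in the set; the word gives the contents of the slots.
  Vtx : Set
  Vtx = Frame × Word

  _≟ᵛ_ : (x y : Vtx) → Dec (x ≡ y)
  _≟ᵛ_ = Prodₚ.≡-dec (≡-dec (Maybeₚ.≡-dec _≟ᵇ_)) _≟ʷ_

  slots : Frame → ℕ
  slots []            = 0
  slots (just _ ∷ c)  = slots c
  slots (nothing ∷ c) = suc (slots c)

  bits : Frame → Word
  bits []            = []
  bits (just b ∷ c)  = b ∷ bits c
  bits (nothing ∷ c) = bits c

  flip : Frame → Frame
  flip = map (Maybe.map not)

  enc : Frame → Word → Word
  enc []            w       = []
  enc (just b ∷ c)  w       = b ∷ not b ∷ enc c w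
  enc (nothing ∷ c) (b ∷ w) = b ∷ b ∷ enc c w
  enc (nothing ∷ c) []      = false ∷ false ∷ enc c []

  dec : Word → Vtx
  dec (true ∷ true ∷ u)   = nothing ∷ proj₁ (dec u) , true ∷ proj₂ (dec u)
  dec (false ∷ false ∷ u) = nothing ∷ proj₁ (dec u) , false ∷ proj₂ (dec u)
  dec (true ∷ false ∷ u)  = just true ∷ proj₁ (dec u) , proj₂ (dec u)
  dec (false ∷ true ∷ u)  = just false ∷ proj₁ (dec u) , proj₂ (dec u)
  dec _                   = [] , []

  -- The vertices of level j are the frames with j + j + s slots, filled with a word with j ones.
  record Vert (r s : ℕ) (x : Vtx) : Set where
    constructor vert
    field
      len : length (proj₁ x) ≡ r + s
      slt : slots (proj₁ x) ≡ length (proj₂ x)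
      bal : length (proj₂ x) ≡ size s (ones (proj₂ x))

  bits+slots : ∀ c → length (bits c) + slots c ≡ length c
  bits+slots []            = refl
  bits+slots (just _ ∷ c)  = cong suc (bits+slots c)
  bits+slots (nothing ∷ c) = trans (ℕₚ.+-suc (length (bits c)) (slots c)) (cong suc (bits+slots c))

  private
    enc-len : ∀ c w → length (enc c w) ≡ length c + length c
    enc-len []            w       = refl
    enc-len (just b ∷ c)  w       = cong suc (trans (cong suc (enc-len c w)) (sym (ℕₚ.+-suc (length c) (length c))))
    enc-len (nothing ∷ c) (b ∷ w) = cong suc (trans (cong suc (enc-len c w)) (sym (ℕₚ.+-suc (length c) (length c))))
    enc-len (nothing ∷ c) []      = cong suc (trans (cong suc (enc-len c [])) (sym (ℕₚ.+-suc (length c) (length c))))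

    enc-ones : ∀ c w → slots c ≡ length w → ones (enc c w) ≡ length (bits c) + (ones w + ones w)
    enc-ones []               []          _ = refl
    enc-ones (just true ∷ c)  w           e = cong suc (enc-ones c w e)
    enc-ones (just false ∷ c) w           e = cong suc (enc-ones c w e)
    enc-ones (nothing ∷ c)    (true ∷ w)  e = trans (cong (λ n → suc (suc n)) (enc-ones c w (ℕₚ.suc-injective e)))
      (solve 2 (λ a b → con 2 :+ (a :+ (b :+ b)) := a :+ ((con 1 :+ b) :+ (con 1 :+ b))) refl (length (bits c)) (ones w))
      where open +-*-Solver
    enc-ones (nothing ∷ c)    (false ∷ w) e = enc-ones c w (ℕₚ.suc-injective e)

  enc-W : ∀ {r s x} → Vert r s x → IsW ((r + s) + (r + s)) r (enc (proj₁ x) (proj₂ x))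
  enc-W {r} {s} {c , w} (vert len slt bal) = trans (enc-len c w) (cong₂ _+_ len len) ,
    trans (enc-ones c w slt) (ℕₚ.+-cancelʳ-≡ s _ r (trans (ℕₚ.+-assoc (length (bits c)) (ones w + ones w) s)
      (trans (cong (length (bits c) +_) (trans (sym bal) (sym slt))) (trans (bits+slots c) len))))

  dec-enc : ∀ c w → slots c ≡ length w → dec (enc c w) ≡ (c , w)
  dec-enc []               []          _ = refl
  dec-enc (just true ∷ c)  w           e rewrite dec-enc c w e = refl
  dec-enc (just false ∷ c) w           e rewrite dec-enc c w e = refl
  dec-enc (nothing ∷ c)    (true ∷ w)  e rewrite dec-enc c w (ℕₚ.suc-injective e) = refl
  dec-enc (nothing ∷ c)    (false ∷ w) e rewrite dec-enc c w (ℕₚ.suc-injective e) = refl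

  private
    enc-dec : ∀ m u → length u ≡ m + m → enc (proj₁ (dec u)) (proj₂ (dec u)) ≡ u × slots (proj₁ (dec u)) ≡ length (proj₂ (dec u)) × length (proj₁ (dec u)) ≡ m
    enc-dec zero    []      _ = refl , refl , refl
    enc-dec (suc m) (_ ∷ []) e with trans (ℕₚ.suc-injective e) (ℕₚ.+-suc m m)
    ... | ()
    enc-dec (suc m) (a ∷ b ∷ u) e with enc-dec m u (ℕₚ.suc-injective (trans (ℕₚ.suc-injective e) (ℕₚ.+-suc m m)))
    enc-dec (suc m) (true ∷ true ∷ u)   e | p , q , l = cong (λ x → true ∷ true ∷ x) p , cong suc q , cong suc l
    enc-dec (suc m) (false ∷ false ∷ u) e | p , q , l = cong (λ x → false ∷ false ∷ x) p , cong suc q , cong suc l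
    enc-dec (suc m) (true ∷ false ∷ u)  e | p , q , l = cong (λ x → true ∷ false ∷ x) p , q , cong suc l
    enc-dec (suc m) (false ∷ true ∷ u)  e | p , q , l = cong (λ x → false ∷ true ∷ x) p , q , cong suc l

  dec-V : ∀ {r s u} → IsW ((r + s) + (r + s)) r u → Vert r s (dec u) × enc (proj₁ (dec u)) (proj₂ (dec u)) ≡ u
  dec-V {r} {s} {u} (l , o) with dec u | enc-dec (r + s) u l
  ... | c , w | refl , q , m = vert m q (ℕₚ.+-cancelˡ-≡ (length (bits c)) _ _ (begin
      length (bits c) + length w                    ≡⟨ cong (length (bits c) +_) (sym q) ⟩
      length (bits c) + slots c                     ≡⟨ bits+slots c ⟩
      length c                              ≡⟨ m ⟩
      r + s                                 ≡⟨ cong (_+ s) (trans (sym o) (enc-ones c w q)) ⟩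
      length (bits c) + (ones w + ones w) + s       ≡⟨ ℕₚ.+-assoc (length (bits c)) (ones w + ones w) s ⟩
      length (bits c) + size s (ones w)             ∎)) , refl
    where open ≡-Reasoning

  -- Letters of a pattern in which every free slot has been filled by a bit.
  data Key : Set where
    bit : Bool → Key
    F G : Key

  _≟ᵏ_ : (a b : Key) → Dec (a ≡ b)
  bit a ≟ᵏ bit b with a ≟ᵇ b
  ... | yes refl = yes refl
  ... | no ne    = no λ { refl → ne refl }
  bit _ ≟ᵏ F = no λ ()
  bit _ ≟ᵏ G = no λ ()
  F ≟ᵏ bit _ = no λ ()
  F ≟ᵏ F = yes refl
  F ≟ᵏ G = no λ ()
  G ≟ᵏ bit _ = no λ ()
  G ≟ᵏ F = no λ ()
  G ≟ᵏ G = yes refl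

  -- `w` and `v` are the contents of the slots before and after the step. Only `free` leaves a
  -- choice, namely which bit stands for the free slot.
  data Fits : Frame → Word → Word → List Key → Set where
    []   : ∀ {w v} → Fits [] w v []
    bitf : ∀ {b c w v K} → Fits c w v K → Fits (just b ∷ c) w v (bit b ∷ K)
    free : ∀ {b c w v K} → Fits c w v K → Fits (nothing ∷ c) (false ∷ w) (false ∷ v) (bit b ∷ K)
    F    : ∀ {c w v K} → Fits c w v K → Fits (nothing ∷ c) (true ∷ w) (false ∷ v) (F ∷ K)
    G    : ∀ {c w v K} → Fits c w v K → Fits (nothing ∷ c) (false ∷ w) (true ∷ v) (G ∷ K)

  -- The reason why equal patterns allow an exchange of images: in each pair of points there are
  -- opposite bits, or a slot that is empty on at least one side.
  fits-⊥ : ∀ {c w v c′ w′ v′ K} → Fits c w v K → Fits c′ w′ v′ K → enc c w ⊥ʷ enc (flip c′) v′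
  fits-⊥ []           []       = []
  fits-⊥ (bitf {b} p) (bitf q) = ∧-inverseʳ b ∷ ∧-inverseʳ (not b) ∷ fits-⊥ p q
  fits-⊥ (bitf {b} p) (free q) = ∧-zeroʳ b ∷ ∧-zeroʳ (not b) ∷ fits-⊥ p q
  fits-⊥ (free p)     (bitf q) = refl ∷ refl ∷ fits-⊥ p q
  fits-⊥ (free p)     (free q) = refl ∷ refl ∷ fits-⊥ p q
  fits-⊥ (F p)        (F q)    = refl ∷ refl ∷ fits-⊥ p q
  fits-⊥ (G p)        (G q)    = refl ∷ refl ∷ fits-⊥ p q

  letter : Bool → Bool → Key
  letter true  _     = F
  letter false true  = G
  letter false false = bit true

  fill₁ : Frame → Word → Word → List Key
  fill₁ []            w       v       = []
  fill₁ (just b ∷ c)  w       v       = bit b ∷ fill₁ c w v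
  fill₁ (nothing ∷ c) (a ∷ w) (b ∷ v) = letter a b ∷ fill₁ c w v
  fill₁ (nothing ∷ c) _       _       = F ∷ fill₁ c [] []

  fill₁-fits : ∀ c {w v} → w ⊥ʷ v → slots c ≡ length w → Fits c w v (fill₁ c w v)
  fill₁-fits []            d _ = []
  fill₁-fits (just b ∷ c)  d e = bitf (fill₁-fits c d e)
  fill₁-fits (nothing ∷ c) (_∷_ {true} {false} _ d) e = F (fill₁-fits c d (ℕₚ.suc-injective e))
  fill₁-fits (nothing ∷ c) (_∷_ {false} {true} _ d) e = G (fill₁-fits c d (ℕₚ.suc-injective e))
  fill₁-fits (nothing ∷ c) (_∷_ {false} {false} _ d) e = free (fill₁-fits c d (ℕₚ.suc-injective e))

  -- At level 0 a free slot is filled by 1 if only zeros precede it, and by 0 otherwise.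
  fillB fillA : Frame → List Key
  fillB = map (λ m → bit (Maybe.fromMaybe false m))
  fillA []               = []
  fillA (just false ∷ c) = bit false ∷ fillA c
  fillA (just true ∷ c)  = bit true ∷ fillB c
  fillA (nothing ∷ c)    = bit true ∷ fillB c

  fillB-fits : ∀ c n → slots c ≡ n → Fits c (replicate n false) (replicate n false) (fillB c)
  fillB-fits []            n       e    = []
  fillB-fits (just b ∷ c)  n       e    = bitf (fillB-fits c n e)
  fillB-fits (nothing ∷ c) (suc n) refl = free (fillB-fits c n refl)

  fillA-fits : ∀ c n → slots c ≡ n → Fits c (replicate n false) (replicate n false) (fillA c)
  fillA-fits []               n       e    = []
  fillA-fits (just false ∷ c) n       e    = bitf (fillA-fits c n e)
  fillA-fits (just true ∷ c)  n       e    = bitf (fillB-fits c n e)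
  fillA-fits (nothing ∷ c)    (suc n) refl = free (fillB-fits c n refl)

  -- A free slot counts as 1, so in both orders the two letters become 1 1.
  fill₁-cross : ∀ c₁ {c₂} w v → nth (slots c₁) w ≡ false → nth (slots c₁) v ≡ false →
    fill₁ (c₁ ++ nothing ∷ just true ∷ c₂) w v ≡ fill₁ (c₁ ++ just true ∷ nothing ∷ c₂) w v
  fill₁-cross []              (false ∷ w) (false ∷ v) refl refl = refl
  fill₁-cross (just b ∷ c₁)   w           v           e    e′   = cong (bit b ∷_) (fill₁-cross c₁ w v e e′)
  fill₁-cross (nothing ∷ c₁)  (a ∷ w)     (b ∷ v)     e    e′   = cong (letter a b ∷_) (fill₁-cross c₁ w v e e′)

  fillB-cross : ∀ c₁ c₂ → fillB (c₁ ++ nothing ∷ just false ∷ c₂) ≡ fillB (c₁ ++ just false ∷ nothing ∷ c₂)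
  fillB-cross []       c₂ = refl
  fillB-cross (_ ∷ c₁) c₂ = cong (_ ∷_) (fillB-cross c₁ c₂)

  data Mark : Set where
    star one other : Mark

  bitMark : Bool → Mark
  bitMark true  = one
  bitMark false = other

  slotMark : Bool → Bool → Mark
  slotMark false false = star
  slotMark _     _     = other

  marks : Frame → Word → Word → List Mark
  marks (just b ∷ c)  w       v       = bitMark b ∷ marks c w v
  marks (nothing ∷ c) (a ∷ w) (b ∷ v) = slotMark a b ∷ marks c w v
  marks _             _       _       = []

  -- No free slot is next to a bit 1; the first argument is the preceding letter.
  Apart : Mark → List Mark → Set
  Apart p    []         = ⊤
  Apart star (one ∷ _)  = ⊥
  Apart one  (star ∷ _) = ⊥
  Apart p    (q ∷ ks)   = Apart q ks

  Safe : Mark → Frame → Word → Word → Set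
  Safe p c w v = Apart p (marks c w v)

  private
    tail : ∀ p q {ks} → Apart p (q ∷ ks) → Apart q ks
    tail star  star  a = a
    tail star  other a = a
    tail one   one   a = a
    tail one   other a = a
    tail other star  a = a
    tail other one   a = a
    tail other other a = a

  unsafe₁ : ∀ p c₁ {c₂} w v → nth (slots c₁) w ≡ false → nth (slots c₁) v ≡ false → ¬ Safe p (c₁ ++ nothing ∷ just true ∷ c₂) w v
  unsafe₁ p []             (false ∷ w) (false ∷ v) refl refl a = tail p star a
  unsafe₁ p (just b ∷ c₁)  w           v           e    e′   a = unsafe₁ (bitMark b) c₁ w v e e′ (tail p (bitMark b) a)
  unsafe₁ p (nothing ∷ c₁) (x ∷ w)     (y ∷ v)     e    e′   a = unsafe₁ (slotMark x y) c₁ w v e e′ (tail p (slotMark x y) a)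

  unsafe₂ : ∀ p c₁ {c₂} w v → nth (slots c₁) w ≡ false → nth (slots c₁) v ≡ false → ¬ Safe p (c₁ ++ just true ∷ nothing ∷ c₂) w v
  unsafe₂ p []             (false ∷ w) (false ∷ v) refl refl a = tail p one a
  unsafe₂ p (just b ∷ c₁)  w           v           e    e′   a = unsafe₂ (bitMark b) c₁ w v e e′ (tail p (bitMark b) a)
  unsafe₂ p (nothing ∷ c₁) (x ∷ w)     (y ∷ v)     e    e′   a = unsafe₂ (slotMark x y) c₁ w v e e′ (tail p (slotMark x y) a)

  -- Blocks of slots and strings of bits.

  S : ℕ → Frame
  S n = replicate n nothing

  dbl : ℕ → Frame
  dbl zero    = []
  dbl (suc j) = nothing ∷ nothing ∷ dbl j

  E^ : ℕ → Word
  E^ n = replicate n false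

  slots-++ : ∀ c d → slots (c ++ d) ≡ slots c + slots d
  slots-++ []            d = refl
  slots-++ (just _ ∷ c)  d = slots-++ c d
  slots-++ (nothing ∷ c) d = cong suc (slots-++ c d)

  slots-S : ∀ n c → slots (S n ++ c) ≡ n + slots c
  slots-S zero    c = refl
  slots-S (suc n) c = cong suc (slots-S n c)

  slots-just : ∀ α → slots (map just α) ≡ 0
  slots-just []      = refl
  slots-just (_ ∷ α) = slots-just α

  slots-flip : ∀ c → slots (flip c) ≡ slots c
  slots-flip []            = refl
  slots-flip (just _ ∷ c)  = slots-flip c
  slots-flip (nothing ∷ c) = cong suc (slots-flip c)

  bits-++ : ∀ c d → bits (c ++ d) ≡ bits c ++ bits d
  bits-++ []            d = refl
  bits-++ (just b ∷ c)  d = cong (b ∷_) (bits-++ c d)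
  bits-++ (nothing ∷ c) d = bits-++ c d

  bits-S : ∀ n c → bits (S n ++ c) ≡ bits c
  bits-S zero    c = refl
  bits-S (suc n) c = bits-S n c

  bits-dbl : ∀ j c → bits (dbl j ++ c) ≡ bits c
  bits-dbl zero    c = refl
  bits-dbl (suc j) c = bits-dbl j c

  bits-just : ∀ α → bits (map just α) ≡ α
  bits-just []      = refl
  bits-just (b ∷ α) = cong (b ∷_) (bits-just α)

  flip-flip : ∀ c → flip (flip c) ≡ c
  flip-flip []            = refl
  flip-flip (just b ∷ c)  = cong₂ (λ b c → just b ∷ c) (not-involutive b) (flip-flip c)
  flip-flip (nothing ∷ c) = cong (nothing ∷_) (flip-flip c)

  flip-S : ∀ n c → flip (S n ++ c) ≡ S n ++ flip c
  flip-S zero    c = refl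
  flip-S (suc n) c = cong (nothing ∷_) (flip-S n c)

  flip-just : ∀ α → flip (map just α) ≡ map just (map not α)
  flip-just []      = refl
  flip-just (b ∷ α) = cong (just (not b) ∷_) (flip-just α)

  snoc-rep : ∀ {A : Set} n (x : A) ys → replicate n x ++ x ∷ ys ≡ x ∷ replicate n x ++ ys
  snoc-rep zero    x ys = refl
  snoc-rep (suc n) x ys = cong (x ∷_) (snoc-rep n x ys)

  zero-⊥ : ∀ w → ones w ≡ 0 → w ⊥ʷ w
  zero-⊥ []          _ = []
  zero-⊥ (false ∷ w) e = refl ∷ zero-⊥ w e

  zero-E : ∀ w → ones w ≡ 0 → w ≡ E^ (length w)
  zero-E []          _ = refl
  zero-E (false ∷ w) e = cong (false ∷_) (zero-E w e)

  E-zero : ∀ n → ones (E^ n) ≡ 0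
  E-zero zero    = refl
  E-zero (suc n) = E-zero n

  -- `lead`, `stop` and `more` are invariants that tell linking frames from each other and from the
  -- frames used at level 0.
  lead : Frame → ℕ
  lead []            = 0
  lead (just _ ∷ _)  = 0
  lead (nothing ∷ c) = suc (lead c)

  stop : Frame → Bool
  stop []            = false
  stop (just b ∷ _)  = b
  stop (nothing ∷ c) = stop c

  more : Frame → Bool
  more []                    = false
  more (just _ ∷ just _ ∷ _) = true
  more (just _ ∷ _)          = false
  more (nothing ∷ c)         = more c

  lead-S : ∀ n c → lead (S n ++ c) ≡ n + lead c
  lead-S zero    c = refl
  lead-S (suc n) c = cong suc (lead-S n c)

  stop-S : ∀ n c → stop (S n ++ c) ≡ stop c
  stop-S zero    c = refl
  stop-S (suc n) c = stop-S n c

  more-S : ∀ n c → more (S n ++ c) ≡ more c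
  more-S zero    c = refl
  more-S (suc n) c = more-S n c

  ⊥-S : ∀ n {c w c′ w′} → enc c w ⊥ʷ enc c′ w′ → enc (S n ++ c) (E^ n ++ w) ⊥ʷ enc (S n ++ c′) (E^ n ++ w′)
  ⊥-S zero    d = d
  ⊥-S (suc n) d = refl ∷ refl ∷ ⊥-S n d

  ⊥-rest : ∀ j α → enc (dbl j ++ map just α) (pairsF j) ⊥ʷ enc (flip (dbl j ++ map just α)) (pairsG j)
  ⊥-rest (suc j) α           = refl ∷ refl ∷ refl ∷ refl ∷ ⊥-rest j α
  ⊥-rest zero    []          = []
  ⊥-rest zero    (true ∷ α)  = refl ∷ refl ∷ ⊥-rest zero α
  ⊥-rest zero    (false ∷ α) = refl ∷ refl ∷ ⊥-rest zero α

  safe-just : ∀ p α → p ≢ star → Safe p (map just α) [] []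
  safe-just star  α           ne = ⊥-elim (ne refl)
  safe-just one   []          ne = _
  safe-just other []          ne = _
  safe-just one   (true ∷ α)  ne = safe-just one α λ ()
  safe-just one   (false ∷ α) ne = safe-just other α λ ()
  safe-just other (true ∷ α)  ne = safe-just one α λ ()
  safe-just other (false ∷ α) ne = safe-just other α λ ()

  safe-rest : ∀ j α → Safe other (dbl j ++ map just α) (pairsF j) (pairsG j)
  safe-rest zero    α = safe-just other α λ ()
  safe-rest (suc j) α = safe-rest j α

  safe-S : ∀ n {c w v} → Safe star c w v → Safe other c w v → ∀ p → p ≢ one → Safe p (S n ++ c) (E^ n ++ w) (E^ n ++ v)
  safe-S zero    a b star  _  = a
  safe-S zero    a b other _  = b
  safe-S n       a b one   ne = ⊥-elim (ne refl)
  safe-S (suc n) a b star  _  = safe-S n a b star λ ()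
  safe-S (suc n) a b other _  = safe-S n a b star λ ()

  data Kind : Set where
    k₁ k₂ k₃ : Kind

  succᵏ predᵏ : Kind → Kind
  succᵏ k₁ = k₂
  succᵏ k₂ = k₃
  succᵏ k₃ = k₁
  predᵏ k₁ = k₃
  predᵏ k₂ = k₁
  predᵏ k₃ = k₂

  -- The permutation, the linking triples and the keys.

  module Johnson (s′ r : ℕ) (lev : ∀ j → Level⁺ (suc s′) (suc j)) (pet : s′ ≡ 0 → Level⁺.next (lev 1) β ≡ β′) where

    s : ℕ
    s = suc s′

    P : Vtx → Set
    P = Vert r s

    -- At level 0 all slots are empty; the only word is disjoint from itself, so the identity
    -- serves.
    hAt : ℕ → Word → Word
    hAt zero    w = w
    hAt (suc j) w = Level⁺.next (lev j) w

    h : Word → Word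
    h w = hAt (ones w) w

    per : ℕ → ℕ
    per zero    = 0
    per (suc j) = Level⁺.period (lev j)

    Bal : Word → Set
    Bal w = length w ≡ size s (ones w)

    hAt-W : ∀ j {w} → IsW (size s j) j w → IsW (size s j) j (hAt j w)
    hAt-W zero    p = p
    hAt-W (suc j) {w} p = Level⁺.next-W (lev j) {w} p

    hAt-cycle : ∀ j {w} → IsW (size s j) j w → iter (hAt j) (suc (per j)) w ≡ w
    hAt-cycle zero    p = refl
    hAt-cycle (suc j) {w} p = Level⁺.cycle (lev j) {w} p

    h-ones : ∀ w → Bal w → ones (h w) ≡ ones w
    h-ones w b = proj₂ (hAt-W (ones w) {w} (b , refl))

    h-len : ∀ w → Bal w → length (h w) ≡ length w
    h-len w b = trans (proj₁ (hAt-W (ones w) {w} (b , refl))) (sym b)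

    h-Bal : ∀ w → Bal w → Bal (h w)
    h-Bal w b = trans (h-len w b) (trans b (cong (size s) (sym (h-ones w b))))

    h-⊥ : ∀ w → Bal w → w ⊥ʷ h w
    h-⊥ w b = go (ones w) refl
      where
      go : ∀ j → ones w ≡ j → w ⊥ʷ hAt j w
      go zero    e = zero-⊥ w e
      go (suc j) e = Level⁺.next-⊥ (lev j) {w} (trans b (cong (size s) e) , e)

    iter-h : ∀ n j {w} → IsW (size s j) j w → iter h n w ≡ iter (hAt j) n w
    iter-h zero    j p = refl
    iter-h (suc n) j {w} p = trans (cong (iter h n) (cong (λ i → hAt i w) (proj₂ p))) (iter-h n j {hAt j w} (hAt-W j {w} p))

    h-cycle : ∀ w → Bal w → iter h (suc (per (ones w))) w ≡ w
    h-cycle w b = trans (iter-h (suc (per (ones w))) (ones w) {w} (b , refl)) (hAt-cycle (ones w) {w} (b , refl))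

    iter-Bal : ∀ n w → Bal w → Bal (iter h n w) × ones (iter h n w) ≡ ones w × length (iter h n w) ≡ length w
    iter-Bal zero    w b = b , refl , refl
    iter-Bal (suc n) w b with iter-Bal n (h w) (h-Bal w b)
    ... | b′ , o , l = b′ , trans o (h-ones w b) , trans l (h-len w b)

    f f⁻ : Vtx → Vtx
    f  (c , w) = flip c , h w
    f⁻ (c , w) = flip c , iter h (per (ones w)) w

    f-P : ∀ {x} → P x → P (f x)
    f-P {c , w} (vert l e b) = vert (trans (length-map _ c) l) (trans (slots-flip c) (trans e (sym (h-len w b)))) (h-Bal w b)

    f⁻-P : ∀ {x} → P x → P (f⁻ x)
    f⁻-P {c , w} (vert l e b) with iter-Bal (per (ones w)) w b
    ... | b′ , o , l′ = vert (trans (length-map _ c) l) (trans (slots-flip c) (trans e (sym l′))) b′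

    f⁻f : ∀ {x} → P x → f⁻ (f x) ≡ x
    f⁻f {c , w} (vert l e b) = cong₂ _,_ (flip-flip c) (trans (cong (λ j → iter h (per j) (h w)) (h-ones w b)) (h-cycle w b))

    ff⁻ : ∀ {x} → P x → f (f⁻ x) ≡ x
    ff⁻ {c , w} (vert l e b) = cong₂ _,_ (flip-flip c) (trans (sym (iter-comm h (per (ones w)) w)) (h-cycle w b))

    h-ε : ∀ j → h (ε s j) ≡ ε′ s j
    h-ε j = trans (cong (λ i → hAt i (ε s j)) (proj₂ (ε-W s j))) (go j)
      where
      go : ∀ j → hAt j (ε s j) ≡ ε′ s j
      go zero    = refl
      go (suc j) = Level⁺.next-ε (lev j)

    -- The triples that join level j+1 to level j, with an arbitrary string α of further bits: A j α is
    -- *ˢFG(FG)ʲα, 0*ˢb(FG)ʲα, 0*ˢ⁻¹0*(FG)ʲα, and B is FGF*Gα, *0F0Gα, 0*F0Gα in the second pentagon.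
    data Ix : Set where
      A : ℕ → Word → Ix
      B : s′ ≡ 0 → Word → Ix

    -- The bit b is 0, so that no free slot of a linking vertex is next to a 1; at level 0, where this
    -- is of no use, it is 1 to keep the vertices of toggle₁ and toggle₂ from being linking.
    low : ℕ → Bool
    low zero    = true
    low (suc _) = false

    fr : Ix → Kind → Frame
    fr (A j α) k₁ = nothing ∷ S s′ ++ (nothing ∷ nothing ∷ dbl j ++ map just α)
    fr (A j α) k₂ = just false ∷ S s′ ++ (nothing ∷ just (low j) ∷ dbl j ++ map just α)
    fr (A j α) k₃ = just false ∷ S s′ ++ (just false ∷ nothing ∷ dbl j ++ map just α)
    fr (B _ α) k₁ = nothing ∷ nothing ∷ nothing ∷ nothing ∷ nothing ∷ map just α
    fr (B _ α) k₂ = nothing ∷ just false ∷ nothing ∷ just false ∷ nothing ∷ map just α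
    fr (B _ α) k₃ = just false ∷ nothing ∷ nothing ∷ just false ∷ nothing ∷ map just α

    wd : Ix → Kind → Word
    wd (A j α) k₁ = ε s (suc j)
    wd (A j α) k₂ = E^ s′ ++ false ∷ pairsF j
    wd (A j α) k₃ = E^ s′ ++ false ∷ pairsF j
    wd (B _ α) k₁ = β
    wd (B _ α) k₂ = false ∷ true ∷ false ∷ []
    wd (B _ α) k₃ = false ∷ true ∷ false ∷ []

    X : Ix → Kind → Vtx
    X i k = fr i k , wd i k

    Link : Vtx → Set
    Link x = ∃₂ λ i k → x ≡ X i k

    ε-alt : ∀ j → E^ s′ ++ false ∷ pairsF j ≡ ε s j
    ε-alt j = snoc-rep s′ false (pairsF j)

    h-alt : ∀ j → h (E^ s′ ++ false ∷ pairsF j) ≡ E^ s′ ++ false ∷ pairsG j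
    h-alt j = trans (cong h (ε-alt j)) (trans (h-ε j) (sym (snoc-rep s′ false (pairsG j))))

    level : Ix → Kind → ℕ
    level (A j _) k₁ = suc j
    level (A j _) k₂ = j
    level (A j _) k₃ = j
    level (B _ _) k₁ = 2
    level (B _ _) k₂ = 1
    level (B _ _) k₃ = 1

    wd-ones : ∀ i k → ones (wd i k) ≡ level i k
    wd-ones (A j α) k₁ = proj₂ (ε-W s (suc j))
    wd-ones (A j α) k₂ = trans (cong ones (ε-alt j)) (proj₂ (ε-W s j))
    wd-ones (A j α) k₃ = trans (cong ones (ε-alt j)) (proj₂ (ε-W s j))
    wd-ones (B _ α) k₁ = refl
    wd-ones (B _ α) k₂ = refl
    wd-ones (B _ α) k₃ = refl

    wd-next : Ix → Kind → Word
    wd-next (A j α) k₁ = ε′ s (suc j)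
    wd-next (A j α) k₂ = E^ s′ ++ false ∷ pairsG j
    wd-next (A j α) k₃ = E^ s′ ++ false ∷ pairsG j
    wd-next (B _ α) k₁ = β′
    wd-next (B _ α) k₂ = false ∷ false ∷ true ∷ []
    wd-next (B _ α) k₃ = false ∷ false ∷ true ∷ []

    private
      h-one : s′ ≡ 0 → h (false ∷ true ∷ false ∷ []) ≡ false ∷ false ∷ true ∷ []
      h-one e = subst (λ n → h (ε (suc n) 1) ≡ ε′ (suc n) 1) e (h-ε 1)

    h-wd : ∀ i k → h (wd i k) ≡ wd-next i k
    h-wd (A j α) k₁ = h-ε (suc j)
    h-wd (A j α) k₂ = h-alt j
    h-wd (A j α) k₃ = h-alt j
    h-wd (B e α) k₁ = pet e
    h-wd (B e α) k₂ = h-one e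
    h-wd (B e α) k₃ = h-one e

    rest : Ix → Word
    rest (A _ α) = α
    rest (B _ α) = α

    private
      bits-rest : ∀ j α → bits (dbl j ++ map just α) ≡ α
      bits-rest j α = trans (bits-dbl j (map just α)) (bits-just α)

    get : Kind → Word → Word
    get k₁ α = α
    get k₂ α = drop 2 α
    get k₃ α = drop 2 α

    rest-bits : ∀ i k → get k (bits (fr i k)) ≡ rest i
    rest-bits (A j α) k₁ = trans (bits-S s′ _) (bits-rest j α)
    rest-bits (A j α) k₂ = trans (cong (drop 1) (bits-S s′ _)) (bits-rest j α)
    rest-bits (A j α) k₃ = trans (cong (drop 1) (bits-S s′ _)) (bits-rest j α)
    rest-bits (B _ α) k₁ = bits-just α
    rest-bits (B _ α) k₂ = bits-just α
    rest-bits (B _ α) k₃ = bits-just α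

    data Lab : Set where
      A₁ B₁ B₂ none : Lab
      N             : ℕ → Lab

    lab : Frame → Word → Lab
    lab (nothing ∷ nothing ∷ _) (false ∷ _) = A₁
    lab (nothing ∷ nothing ∷ _) (true ∷ _)  = B₁
    lab (nothing ∷ just _ ∷ _)  _           = B₂
    lab (just _ ∷ c)            _           = N (lead c)
    lab _                       _           = none

    L : Ix → Kind → Lab
    L (A _ _) k₁ = A₁
    L (A _ _) k₂ = N s
    L (A _ _) k₃ = N s′
    L (B _ _) k₁ = B₁
    L (B _ _) k₂ = B₂
    L (B _ _) k₃ = N 2

    -- For the kinds other than `k₁` the label does not depend on the word. This allows `only` to
    -- compare frames when the contents of the slots have moved on.
    lab-X : ∀ i k w → (k ≡ k₁ → w ≡ wd i k) → lab (fr i k) w ≡ L i k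
    lab-X (A j α) k₁ w e rewrite e refl = go s′
      where go : ∀ n {w} → lab (nothing ∷ S n ++ (nothing ∷ nothing ∷ dbl j ++ map just α)) (false ∷ w) ≡ A₁
            go zero    = refl
            go (suc n) = refl
    lab-X (A j α) k₂ w e = cong N (trans (lead-S s′ _) (ℕₚ.+-comm s′ 1))
    lab-X (A j α) k₃ w e = cong N (trans (lead-S s′ _) (ℕₚ.+-identityʳ s′))
    lab-X (B _ α) k₁ w e rewrite e refl = refl
    lab-X (B _ α) k₂ w e = refl
    lab-X (B _ α) k₃ w e = refl

    private
      N-inj : ∀ {m n} → N m ≡ N n → m ≡ n
      N-inj refl = refl
      s≢s′ : s ≢ s′
      s≢s′ e = ℕₚ.<-irrefl (sym e) (ℕₚ.n<1+n s′)
      s≢2 : s′ ≡ 0 → s ≢ 2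
      s≢2 e q with trans (cong suc (sym e)) q
      ... | ()
      s′≢2 : s′ ≡ 0 → s′ ≢ 2
      s′≢2 e q with trans (sym e) q
      ... | ()

    -- Among the frames beginning with a bit, the numbers of slots that follow it are s, s-1 and 2.
    -- The 2 occurs only with `B`, where s = 1, so all three differ; level and bits then give the
    -- index.
    determined : ∀ i k i′ k′ → L i k ≡ L i′ k′ → level i k ≡ level i′ k′ → bits (fr i k) ≡ bits (fr i′ k′) → i ≡ i′ × k ≡ k′
    determined i k i′ k′ l v b = go i k i′ k′ l v λ { refl → trans (sym (rest-bits i k)) (trans (cong (get k) b) (rest-bits i′ k)) }
      where
      go : ∀ i k i′ k′ → L i k ≡ L i′ k′ → level i k ≡ level i′ k′ → (k ≡ k′ → rest i ≡ rest i′) → i ≡ i′ × k ≡ k′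
      go (A j α) k₁ (A j′ α′) k₁ l v a = cong₂ A (ℕₚ.suc-injective v) (a refl) , refl
      go (A j α) k₂ (A j′ α′) k₂ l v a = cong₂ A v (a refl) , refl
      go (A j α) k₃ (A j′ α′) k₃ l v a = cong₂ A v (a refl) , refl
      go (B e α) k₁ (B e′ α′) k₁ l v a = cong₂ B (ℕₚ.≡-irrelevant e e′) (a refl) , refl
      go (B e α) k₂ (B e′ α′) k₂ l v a = cong₂ B (ℕₚ.≡-irrelevant e e′) (a refl) , refl
      go (B e α) k₃ (B e′ α′) k₃ l v a = cong₂ B (ℕₚ.≡-irrelevant e e′) (a refl) , refl
      go (A j α) k₂ (A j′ α′) k₃ l v a = ⊥-elim (s≢s′ (N-inj l))
      go (A j α) k₃ (A j′ α′) k₂ l v a = ⊥-elim (s≢s′ (sym (N-inj l)))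
      go (A j α) k₂ (B e _) k₃ l v a = ⊥-elim (s≢2 e (N-inj l))
      go (A j α) k₃ (B e _) k₃ l v a = ⊥-elim (s′≢2 e (N-inj l))
      go (B e _) k₃ (A j α) k₂ l v a = ⊥-elim (s≢2 e (sym (N-inj l)))
      go (B e _) k₃ (A j α) k₃ l v a = ⊥-elim (s′≢2 e (sym (N-inj l)))
      go (A _ _) k₁ (A _ _) k₂ ()
      go (A _ _) k₁ (A _ _) k₃ ()
      go (A _ _) k₁ (B _ _) k₂ ()
      go (A _ _) k₁ (B _ _) k₃ ()
      go (B _ _) k₁ (A _ _) k₂ ()
      go (B _ _) k₁ (A _ _) k₃ ()
      go (B _ _) k₁ (B _ _) k₂ ()
      go (B _ _) k₁ (B _ _) k₃ ()
      go (B _ _) k₂ (A _ _) k₁ ()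
      go (B _ _) k₂ (A _ _) k₃ ()
      go (B _ _) k₂ (B _ _) k₁ ()
      go (B _ _) k₂ (B _ _) k₃ ()

    X-inj : ∀ {i k i′ k′} → X i k ≡ X i′ k′ → i ≡ i′ × k ≡ k′
    X-inj {i} {k} {i′} {k′} e = determined i k i′ k′
      (trans (sym (lab-X i k _ (λ _ → refl))) (trans (cong (λ x → lab (proj₁ x) (proj₂ x)) e) (lab-X i′ k′ _ (λ _ → refl))))
      (trans (sym (wd-ones i k)) (trans (cong (λ x → ones (proj₂ x)) e) (wd-ones i′ k′)))
      (cong (λ x → bits (proj₁ x)) e)

    candB : Dec (s′ ≡ 0) → Word → List (Ix × Kind)
    candB (yes e) α = (B e (get k₁ α) , k₁) ∷ (B e (get k₂ α) , k₂) ∷ (B e (get k₃ α) , k₃) ∷ []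
    candB (no _)  α = []

    -- For each kind, level and bits leave one possible index, so that being linking is decidable by
    -- at most six comparisons.
    cand : Vtx → List (Ix × Kind)
    cand (c , w) = (A (pred (ones w)) (get k₁ α) , k₁) ∷ (A (ones w) (get k₂ α) , k₂) ∷ (A (ones w) (get k₃ α) , k₃) ∷ candB (s′ ℕₚ.≟ 0) α
      where α = bits c

    cand-X : ∀ i k → (i , k) ∈ cand (X i k)
    cand-X i@(A j α) k₁ = here (cong (_, k₁) (sym (cong₂ A (cong pred (wd-ones i k₁)) (rest-bits i k₁))))
    cand-X i@(A j α) k₂ = there (here (cong (_, k₂) (sym (cong₂ A (wd-ones i k₂) (rest-bits i k₂)))))
    cand-X i@(A j α) k₃ = there (there (here (cong (_, k₃) (sym (cong₂ A (wd-ones i k₃) (rest-bits i k₃))))))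
    cand-X i@(B e α) k = there (there (there (go (s′ ℕₚ.≟ 0) k)))
      where
      go : ∀ d k → (i , k) ∈ candB d (bits (fr i k))
      go (no ne)  _  = ⊥-elim (ne e)
      go (yes e′) k₁ = here (cong (_, k₁) (cong₂ B (ℕₚ.≡-irrelevant e e′) (sym (rest-bits i k₁))))
      go (yes e′) k₂ = there (here (cong (_, k₂) (cong₂ B (ℕₚ.≡-irrelevant e e′) (sym (rest-bits i k₂)))))
      go (yes e′) k₃ = there (there (here (cong (_, k₃) (cong₂ B (ℕₚ.≡-irrelevant e e′) (sym (rest-bits i k₃))))))

    link? : ∀ x → Dec (Link x)
    link? x with any? (λ (i , k) → x ≟ᵛ X i k) (cand x)
    ... | no ne  = no λ { (i , k , refl) → ne (lose (cand-X i k) refl) }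
    ... | yes a with find a
    ...   | (i , k) , _ , e = yes (i , k , e)

    τ τ⁻ : Vtx → Vtx
    τ x with link? x
    ... | yes (i , k , _) = X i (succᵏ k)
    ... | no _            = x
    τ⁻ x with link? x
    ... | yes (i , k , _) = X i (predᵏ k)
    ... | no _            = x

    τ-X : ∀ i k → τ (X i k) ≡ X i (succᵏ k)
    τ-X i k with link? (X i k)
    ... | no ne = ⊥-elim (ne (i , k , refl))
    ... | yes (i′ , k′ , e) with X-inj {i} {k} {i′} {k′} e
    ...   | refl , refl = refl

    τ⁻-X : ∀ i k → τ⁻ (X i k) ≡ X i (predᵏ k)
    τ⁻-X i k with link? (X i k)
    ... | no ne = ⊥-elim (ne (i , k , refl))
    ... | yes (i′ , k′ , e) with X-inj {i} {k} {i′} {k′} e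
    ...   | refl , refl = refl

    τ-no : ∀ {x} → ¬ Link x → τ x ≡ x
    τ-no {x} ne with link? x
    ... | no _  = refl
    ... | yes l = ⊥-elim (ne l)

    τ⁻-no : ∀ {x} → ¬ Link x → τ⁻ x ≡ x
    τ⁻-no {x} ne with link? x
    ... | no _  = refl
    ... | yes l = ⊥-elim (ne l)

    private
      predsucc : ∀ k → predᵏ (succᵏ k) ≡ k
      predsucc k₁ = refl
      predsucc k₂ = refl
      predsucc k₃ = refl
      succpred : ∀ k → succᵏ (predᵏ k) ≡ k
      succpred k₁ = refl
      succpred k₂ = refl
      succpred k₃ = refl

    τ⁻τ : ∀ x → τ⁻ (τ x) ≡ x
    τ⁻τ x = go (link? x)
      where
      go : Dec (Link x) → τ⁻ (τ x) ≡ x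
      go (yes (i , k , refl)) = trans (cong τ⁻ (τ-X i k)) (trans (τ⁻-X i (succᵏ k)) (cong (X i) (predsucc k)))
      go (no ne)              = trans (cong τ⁻ (τ-no ne)) (τ⁻-no ne)

    ττ⁻ : ∀ x → τ (τ⁻ x) ≡ x
    ττ⁻ x = go (link? x)
      where
      go : Dec (Link x) → τ (τ⁻ x) ≡ x
      go (yes (i , k , refl)) = trans (cong τ (τ⁻-X i k)) (trans (τ-X i (predᵏ k)) (cong (X i) (succpred k)))
      go (no ne)              = trans (cong τ (τ⁻-no ne)) (τ-no ne)

    private
      slots-rest : ∀ j α → slots (dbl j ++ map just α) ≡ length (pairsF j)
      slots-rest zero    α = slots-just α
      slots-rest (suc j) α = cong (λ n → suc (suc n)) (slots-rest j α)

      len-rep : ∀ {A B : Set} n (x : A) (y : B) xs ys → length xs ≡ length ys → length (replicate n x ++ xs) ≡ length (replicate n y ++ ys)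
      len-rep zero    x y xs ys e = e
      len-rep (suc n) x y xs ys e = cong suc (len-rep n x y xs ys e)

      slots-word : ∀ n c (w : Word) → slots c ≡ length w → slots (S n ++ c) ≡ length (E^ n ++ w)
      slots-word zero    c w e = e
      slots-word (suc n) c w e = cong suc (slots-word n c w e)

    fr-len : ∀ i k → length (fr i k) ≡ length (fr i k₁)
    fr-len (A j α) k₁ = refl
    fr-len (A j α) k₂ = cong suc (len-rep s′ nothing nothing (nothing ∷ just (low j) ∷ dbl j ++ map just α) (nothing ∷ nothing ∷ dbl j ++ map just α) refl)
    fr-len (A j α) k₃ = cong suc (len-rep s′ nothing nothing (just false ∷ nothing ∷ dbl j ++ map just α) (nothing ∷ nothing ∷ dbl j ++ map just α) refl)
    fr-len (B _ α) k₁ = refl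
    fr-len (B _ α) k₂ = refl
    fr-len (B _ α) k₃ = refl

    X-slots : ∀ i k → slots (fr i k) ≡ length (wd i k)
    X-slots (A j α) k₁ = cong suc (slots-word s′ _ _ (cong (λ n → suc (suc n)) (slots-rest j α)))
    X-slots (A j α) k₂ = slots-word s′ _ _ (cong suc (slots-rest j α))
    X-slots (A j α) k₃ = slots-word s′ _ _ (cong suc (slots-rest j α))
    X-slots (B _ α) k₁ = cong (5 +_) (slots-just α)
    X-slots (B _ α) k₂ = cong (3 +_) (slots-just α)
    X-slots (B _ α) k₃ = cong (3 +_) (slots-just α)

    X-Bal : ∀ i k → Bal (wd i k)
    X-Bal (A j α) k₁ = trans (proj₁ (ε-W s (suc j))) (cong (size s) (sym (wd-ones (A j α) k₁)))
    X-Bal (A j α) k₂ = trans (cong length (ε-alt j)) (trans (proj₁ (ε-W s j)) (cong (size s) (sym (wd-ones (A j α) k₂))))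
    X-Bal (A j α) k₃ = trans (cong length (ε-alt j)) (trans (proj₁ (ε-W s j)) (cong (size s) (sym (wd-ones (A j α) k₂))))
    X-Bal (B e α) k₁ = cong (λ n → size (suc n) 2) (sym e)
    X-Bal (B e α) k₂ = cong (λ n → size (suc n) 1) (sym e)
    X-Bal (B e α) k₃ = cong (λ n → size (suc n) 1) (sym e)

    X-P : ∀ i k k′ → P (X i k) → P (X i k′)
    X-P i k k′ (vert l _ _) = vert (trans (fr-len i k′) (trans (sym (fr-len i k)) l)) (X-slots i k′) (X-Bal i k′)

    τ-P : ∀ {x} → P x → P (τ x)
    τ-P {x} p = go (link? x)
      where
      go : Dec (Link x) → P (τ x)
      go (yes (i , k , refl)) = subst P (sym (τ-X i k)) (X-P i k (succᵏ k) p)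
      go (no ne)              = subst P (sym (τ-no ne)) p

    τ⁻-P : ∀ {x} → P x → P (τ⁻ x)
    τ⁻-P {x} p = go (link? x)
      where
      go : Dec (Link x) → P (τ⁻ x)
      go (yes (i , k , refl)) = subst P (sym (τ⁻-X i k)) (X-P i k (predᵏ k) p)
      go (no ne)              = subst P (sym (τ⁻-no ne)) p

    _~_ : Vtx → Vtx → Set
    (c , w) ~ (c′ , w′) = enc c w ⊥ʷ enc c′ w′

    X-adj : ∀ i k → X i k ~ f (X i (succᵏ k))
    X-adj i k = subst (λ v → X i k ~ (flip (fr i (succᵏ k)) , v)) (sym (h-wd i (succᵏ k))) (go i k)
      where
      ⊥-just : ∀ α → enc (map just α) [] ⊥ʷ enc (flip (map just α)) []
      ⊥-just = ⊥-rest 0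
      go : ∀ i k → X i k ~ (flip (fr i (succᵏ k)) , wd-next i (succᵏ k))
      go (A j α) k₁ = refl ∷ refl ∷ subst (λ c → enc (S s′ ++ (nothing ∷ nothing ∷ dbl j ++ map just α)) (E^ s′ ++ true ∷ false ∷ pairsF j) ⊥ʷ enc c (E^ s′ ++ false ∷ pairsG j))
        (sym (flip-S s′ (nothing ∷ just (low j) ∷ dbl j ++ map just α))) (⊥-S s′ (refl ∷ refl ∷ refl ∷ refl ∷ ⊥-rest j α))
      go (A j α) k₂ = refl ∷ refl ∷ subst (λ c → enc (S s′ ++ (nothing ∷ just (low j) ∷ dbl j ++ map just α)) (E^ s′ ++ false ∷ pairsF j) ⊥ʷ enc c (E^ s′ ++ false ∷ pairsG j))
        (sym (flip-S s′ (just false ∷ nothing ∷ dbl j ++ map just α))) (⊥-S s′ (refl ∷ refl ∷ ∧-zeroʳ (low j) ∷ ∧-zeroʳ (not (low j)) ∷ ⊥-rest j α))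
      go (A j α) k₃ = refl ∷ refl ∷ subst (λ c → enc (S s′ ++ (just false ∷ nothing ∷ dbl j ++ map just α)) (E^ s′ ++ false ∷ pairsF j) ⊥ʷ enc c (E^ s′ ++ false ∷ true ∷ pairsG j))
        (sym (flip-S s′ (nothing ∷ nothing ∷ dbl j ++ map just α))) (⊥-S s′ (refl ∷ refl ∷ refl ∷ refl ∷ ⊥-rest j α))
      go (B _ α) k₁ = refl ∷ refl ∷ refl ∷ refl ∷ refl ∷ refl ∷ refl ∷ refl ∷ refl ∷ refl ∷ ⊥-just α
      go (B _ α) k₂ = refl ∷ refl ∷ refl ∷ refl ∷ refl ∷ refl ∷ refl ∷ refl ∷ refl ∷ refl ∷ ⊥-just α
      go (B _ α) k₃ = refl ∷ refl ∷ refl ∷ refl ∷ refl ∷ refl ∷ refl ∷ refl ∷ refl ∷ refl ∷ ⊥-just α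

    g g⁻ : Vtx → Vtx
    g x  = f (τ x)
    g⁻ x = τ⁻ (f⁻ x)

    fillAt : ℕ → Vtx → List Key
    fillAt zero    (c , w) = fillA c
    fillAt (suc _) (c , w) = fill₁ c w (h w)

    fill : Vtx → List Key
    fill x = fillAt (ones (proj₂ x)) x

    fill-fits : ∀ {x} → P x → Fits (proj₁ x) (proj₂ x) (h (proj₂ x)) (fill x)
    fill-fits {c , w} (vert _ e b) = go (ones w) refl
      where
      go : ∀ j → ones w ≡ j → Fits c w (h w) (fillAt j (c , w))
      go zero    o = subst₂ (λ a b → Fits c a b (fillA c)) (sym w≡) (sym (trans (cong (λ i → hAt i w) o) w≡)) (fillA-fits c (length w) e)
        where w≡ = zero-E w o
      go (suc j) o = fill₁-fits c (h-⊥ w b) e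

    -- A linking vertex gets a key of its own, since `g` does not send it to its image under `f` and
    -- equal fillings would prove nothing about `g`.
    κ : Vtx → Vtx ⊎ List Key
    κ x with link? x
    ... | yes _ = inj₁ x
    ... | no _  = inj₂ (fill x)

    κ-no : ∀ {x} → ¬ Link x → κ x ≡ inj₂ (fill x)
    κ-no {x} ne with link? x
    ... | yes l = ⊥-elim (ne l)
    ... | no _  = refl

    κ-yes : ∀ {x} → Link x → κ x ≡ inj₁ x
    κ-yes {x} l with link? x
    ... | yes _ = refl
    ... | no ne = ⊥-elim (ne l)

    κ-adj : ∀ {x y} → P x → P y → κ x ≡ κ y → x ~ g y
    κ-adj {x} {y} p q e = go (link? x) (link? y)
      where
      go : Dec (Link x) → Dec (Link y) → x ~ g y
      go (yes l) (yes l′) with trans (sym (κ-yes l)) (trans e (κ-yes l′))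
      go (yes (i , k , refl)) (yes l′) | refl = subst (λ z → X i k ~ f z) (sym (τ-X i k)) (X-adj i k)
      go (no ne) (no ne′) with fill x in ex | fill y in ey | trans (sym (κ-no ne)) (trans e (κ-no ne′))
      ... | _ | _ | refl = subst (λ z → x ~ f z) (sym (τ-no ne′))
        (fits-⊥ (subst (Fits (proj₁ x) (proj₂ x) (h (proj₂ x))) ex (fill-fits p)) (subst (Fits (proj₁ y) (proj₂ y) (h (proj₂ y))) ey (fill-fits q)))
      go (yes l) (no ne) with trans (sym (κ-yes l)) (trans e (κ-no ne))
      ... | ()
      go (no ne) (yes l) with trans (sym (κ-no ne)) (trans e (κ-yes l))
      ... | ()

    -- All bits in front of α are 0 here, and slots F or G separate the free slots from α. At level
    -- 0 there are no such slots, and `low` is 1.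
    X-safe : ∀ i k → level i k ≢ 0 → Safe other (fr i k) (wd i k) (wd-next i k)
    X-safe (A j α) k₁ _ = safe-S s′ (safe-rest j α) (safe-rest j α) star λ ()
    X-safe (A zero α) k₂ ne = ⊥-elim (ne refl)
    X-safe (A (suc j) α) k₂ _ = safe-S s′ {nothing ∷ just false ∷ dbl (suc j) ++ map just α} (safe-rest j α) (safe-rest j α) other λ ()
    X-safe (A zero α) k₃ ne = ⊥-elim (ne refl)
    X-safe (A (suc j) α) k₃ _ = safe-S s′ {just false ∷ nothing ∷ dbl (suc j) ++ map just α} (safe-rest j α) (safe-rest j α) other λ ()
    X-safe (B _ α) k₁ _ = safe-just other α λ ()
    X-safe (B _ α) k₂ _ = safe-just other α λ ()
    X-safe (B _ α) k₃ _ = safe-just other α λ ()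

  -- Orbits of `f`; moving bits past slots and descending to level 0.

  flip-even : ∀ n c → iter flip (n + n) c ≡ c
  flip-even zero    c = refl
  flip-even (suc n) c = trans (cong (λ m → iter flip m (flip c)) (ℕₚ.+-suc n n)) (trans (cong (iter flip (n + n)) (flip-flip c)) (flip-even n c))

  flip-parity : ∀ n c → iter flip n c ≡ c ⊎ iter flip n c ≡ flip c
  flip-parity zero    c = inj₁ refl
  flip-parity (suc n) c with flip-parity n (flip c)
  ... | inj₁ e = inj₂ e
  ... | inj₂ e = inj₁ (trans e (flip-flip c))

  slots-iter : ∀ n c → slots (iter flip n c) ≡ slots c
  slots-iter zero    c = refl
  slots-iter (suc n) c = trans (slots-iter n (flip c)) (slots-flip c)

  iter-flip-S : ∀ n m α → ∃ λ α′ → iter flip n (S m ++ map just α) ≡ S m ++ map just α′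
  iter-flip-S zero    m α = α , refl
  iter-flip-S (suc n) m α with iter-flip-S n m (map not α)
  ... | α′ , e = α′ , trans (cong (iter flip n) (trans (flip-S m (map just α)) (cong (S m ++_) (flip-just α)))) e

  slots-↭ : ∀ {c d} → c ↭ d → slots c ≡ slots d
  slots-↭ _↭_.refl               = refl
  slots-↭ (prep (just _) p)      = slots-↭ p
  slots-↭ (prep nothing p)       = cong suc (slots-↭ p)
  slots-↭ (swap (just _) (just _) p) = slots-↭ p
  slots-↭ (swap (just _) nothing p)  = cong suc (slots-↭ p)
  slots-↭ (swap nothing (just _) p)  = cong suc (slots-↭ p)
  slots-↭ (swap nothing nothing p)   = cong (λ n → suc (suc n)) (slots-↭ p)
  slots-↭ (_↭_.trans p q)        = trans (slots-↭ p) (slots-↭ q)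

  fillB-star : ∀ c₁ c₂ → fillB (c₁ ++ nothing ∷ c₂) ≡ fillB (c₁ ++ just false ∷ c₂)
  fillB-star []       c₂ = refl
  fillB-star (_ ∷ c₁) c₂ = cong (_ ∷_) (fillB-star c₁ c₂)

  slots-0 : ∀ n j c → nothing ∷ S n ++ (nothing ∷ nothing ∷ dbl j ++ c) ≡ S (suc j + suc j + suc n) ++ c
  slots-0 n j c = trans (cong (nothing ∷_) (trans (snoc-rep n nothing _) (cong (nothing ∷_) (snoc-rep n nothing _))))
    (trans (cong (λ d → nothing ∷ nothing ∷ nothing ∷ d) (go n j)) (cong (λ m → S (suc m) ++ c) (solve 2 (λ j n → con 2 :+ (j :+ j :+ n) := j :+ (con 1 :+ j) :+ (con 1 :+ n)) refl j n)))
    where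
    open +-*-Solver
    go : ∀ n j → S n ++ dbl j ++ c ≡ S (j + j + n) ++ c
    go zero    zero    = refl
    go (suc n) j       = trans (cong (nothing ∷_) (go n j)) (cong (λ m → S m ++ c) (sym (ℕₚ.+-suc (j + j) n)))
    go zero    (suc j) = trans (cong (λ d → nothing ∷ nothing ∷ d) (go zero j)) (cong (λ m → S m ++ c) (cong (_+ 0) (cong suc (sym (ℕₚ.+-suc j j)))))

  iter-cross : ∀ n c₁ b c₂ → iter flip n (c₁ ++ nothing ∷ just b ∷ c₂) ≡ iter flip n c₁ ++ nothing ∷ just (iter not n b) ∷ iter flip n c₂
  iter-cross zero    c₁ b c₂ = refl
  iter-cross (suc n) c₁ b c₂ = trans (cong (iter flip n) (map-++ (Maybe.map not) c₁ _)) (iter-cross n (flip c₁) (not b) (flip c₂))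

  iter-cross′ : ∀ n c₁ b c₂ → iter flip n (c₁ ++ just b ∷ nothing ∷ c₂) ≡ iter flip n c₁ ++ just (iter not n b) ∷ nothing ∷ iter flip n c₂
  iter-cross′ zero    c₁ b c₂ = refl
  iter-cross′ (suc n) c₁ b c₂ = trans (cong (iter flip n) (map-++ (Maybe.map not) c₁ _)) (iter-cross′ n (flip c₁) (not b) (flip c₂))

  -- Distinguishes the linking frames of kind k₂ and k₃ from their complements.
  early : Frame → Maybe Bool
  early (just b ∷ _)           = just b
  early (nothing ∷ just b ∷ _) = just b
  early _                      = nothing

  module Connected (s′ r : ℕ) (lev : ∀ j → Level⁺ (suc s′) (suc j)) (pet : s′ ≡ 0 → Level⁺.next (lev 1) β ≡ β′) where

    open Johnson s′ r lev pet

    iter-f : ∀ n c w → iter f n (c , w) ≡ (iter flip n c , iter h n w)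
    iter-f zero    c w = refl
    iter-f (suc n) c w = iter-f n (flip c) (h w)

    iter-f-≡ : ∀ n {c d} w → iter flip n c ≡ d → iter f n (c , w) ≡ (d , iter h n w)
    iter-f-≡ n {c} w refl = iter-f n c w

    iter-P : ∀ n {x} → P x → P (iter f n x)
    iter-P zero    p = p
    iter-P (suc n) p = iter-P n (f-P p)

    returns : ∀ {x} → P x → ∃ λ n → iter f (suc n) x ≡ x
    -- Two rounds of the slots, so that the bits are complemented an even number of times.
    returns {c , w} (vert _ _ b) = per (ones w) + M , trans (iter-f (M + M) c w) (cong₂ _,_ (flip-even M c)
      (trans (iter-+ h M M w) (trans (cong (iter h M) (h-cycle w b)) (h-cycle w b))))
      where M = suc (per (ones w))

    early-X : ∀ i k → early (fr i k) ≡ just false ⊎ early (fr i k) ≡ nothing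
    early-X (A j α) k₁ = inj₂ (go s′)
      where go : ∀ n → early (nothing ∷ S n ++ (nothing ∷ nothing ∷ dbl j ++ map just α)) ≡ nothing
            go zero    = refl
            go (suc n) = refl
    early-X (A j α) k₂ = inj₁ refl
    early-X (A j α) k₃ = inj₁ refl
    early-X (B _ α) k₁ = inj₂ refl
    early-X (B _ α) k₂ = inj₁ refl
    early-X (B _ α) k₃ = inj₁ refl

    early-flip : ∀ i k → k ≢ k₁ → early (flip (fr i k)) ≡ just true
    early-flip i       k₁ ne = ⊥-elim (ne refl)
    early-flip (A j α) k₂ _ = refl
    early-flip (A j α) k₃ _ = refl
    early-flip (B _ α) k₂ _ = refl
    early-flip (B _ α) k₃ _ = refl

    -- Along the orbit the frame is `fr i k` or its complement. The complement has a bit 1 where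
    -- `early` finds 0 or no bit at all in linking frames, and `fr i k` itself, with the level,
    -- admits only the index `i` and the kind `k`.
    only : ∀ i k → k ≢ k₁ → ∀ n → Link (iter f n (X i k)) → iter f n (X i k) ≡ X i k
    only i k ne n (i′ , k′ , e) = go (flip-parity n (fr i k))
      where
      e′ : (iter flip n (fr i k) , iter h n (wd i k)) ≡ X i′ k′
      e′ = trans (sym (iter-f n (fr i k) (wd i k))) e
      lv : level i k ≡ level i′ k′
      lv = trans (sym (wd-ones i k)) (trans (sym (proj₁ (proj₂ (iter-Bal n (wd i k) (X-Bal i k))))) (trans (cong (λ x → ones (proj₂ x)) e′) (wd-ones i′ k′)))
      go : iter flip n (fr i k) ≡ fr i k ⊎ iter flip n (fr i k) ≡ flip (fr i k) → iter f n (X i k) ≡ X i k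
      go (inj₁ q) with determined i k i′ k′
          (trans (sym (lab-X i k (wd i′ k′) (λ z → ⊥-elim (ne z)))) (trans (cong (λ c → lab c (wd i′ k′)) (trans (sym q) (cong proj₁ e′))) (lab-X i′ k′ _ (λ _ → refl))))
          lv (cong bits (trans (sym q) (cong proj₁ e′)))
      ... | refl , refl = e
      go (inj₂ q) with trans (sym (early-flip i k ne)) (cong early (trans (sym q) (cong proj₁ e′))) | early-X i′ k′
      ... | z | inj₁ y with trans z y
      ...   | ()
      go (inj₂ q) | z | inj₂ y with trans z y
      ...   | ()

    module Closed (Q : Vtx → Set) (fwd : ∀ {x} → P x → Q x → Q (g x)) (bwd : ∀ {x} → P x → Q (g x) → Q x)
             (swp : ∀ {x y} → P x → P y → κ x ≡ κ y → Q x → Q y) where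

      infix 4 _≈_
      record _≈_ (x y : Vtx) : Set where
        constructor both
        field
          to   : Q x → Q y
          from : Q y → Q x
      open _≈_

      ≈-refl : ∀ {x} → x ≈ x
      ≈-refl = both (λ q → q) (λ q → q)

      ≈-sym : ∀ {x y} → x ≈ y → y ≈ x
      ≈-sym (both a b) = both b a

      infixr 5 _∙_
      _∙_ : ∀ {x y z} → x ≈ y → y ≈ z → x ≈ z
      both a b ∙ both c d = both (λ q → c (a q)) (λ q → b (d q))

      ≡⇒≈ : ∀ {x y} → x ≡ y → x ≈ y
      ≡⇒≈ refl = ≈-refl

      f-plain : ∀ {x} → P x → ¬ Link x → x ≈ f x
      f-plain {x} p ne = subst (λ y → x ≈ f y) (τ-no ne) (both (fwd p) (bwd p))

      X-step : ∀ i k → P (X i k) → X i k ≈ f (X i (succᵏ k))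
      X-step i k p = subst (λ y → X i k ≈ f y) (τ-X i k) (both (fwd p) (bwd p))

      -- Following f around its orbit, which meets the linking vertices only in x.
      around : ∀ {x} → P x → (∀ n → Link (iter f n x) → iter f n x ≡ x) → x ≈ f x
      around {x} p only with returns p
      ... | T , e = both (λ q → down q T (subst Q (sym e) q)) (λ q → fin (up q T))
        where
        step : ∀ n → Link (iter f n (f x)) ⊎ iter f n (f x) ≈ f (iter f n (f x))
        step n with link? (iter f n (f x))
        ... | yes l = inj₁ l
        ... | no ne = inj₂ (f-plain (iter-P n (f-P p)) ne)
        up : Q (f x) → ∀ n → Q x ⊎ Q (iter f n (f x))
        up q zero    = inj₂ q
        up q (suc n) with up q n
        ... | inj₁ a = inj₁ a
        ... | inj₂ a with step n
        ...   | inj₁ l = inj₁ (subst Q (only (suc n) l) a)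
        ...   | inj₂ s = inj₂ (subst Q (sym (iter-comm f n (f x))) (to s a))
        fin : Q x ⊎ Q (iter f T (f x)) → Q x
        fin (inj₁ a) = a
        fin (inj₂ a) = subst Q e a
        down : Q x → ∀ n → Q (iter f n (f x)) → Q (f x)
        down q zero    a = a
        down q (suc n) a with step n
        ... | inj₁ l = down q n (subst Q (sym (only (suc n) l)) q)
        ... | inj₂ s = down q n (from s (subst Q (iter-comm f n (f x)) a))

      X-around : ∀ i k → k ≢ k₁ → P (X i k) → X i k ≈ f (X i k)
      X-around i k ne p = around p (only i k ne)

      -- On a triple, `g` sends x₁ to f x₂, x₂ to f x₃ and x₃ to f x₁. Since `Q` does not separate
      -- x₂ from f x₂, nor x₃ from f x₃, because their own orbits lead around, going once through
      -- the triple connects x₁ with f x₁.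
      f-closed : ∀ {x} → P x → x ≈ f x
      f-closed {x} p = go (link? x)
        where
        go : Dec (Link x) → x ≈ f x
        go (no ne) = f-plain p ne
        go (yes (i , k₂ , refl)) = X-around i k₂ (λ ()) p
        go (yes (i , k₃ , refl)) = X-around i k₃ (λ ()) p
        go (yes (i , k₁ , refl)) = X-step i k₁ p ∙ ≈-sym (X-around i k₂ (λ ()) p₂) ∙ X-step i k₂ p₂ ∙ ≈-sym (X-around i k₃ (λ ()) p₃) ∙ X-step i k₃ p₃
          where
          p₂ = X-P i k₁ k₂ p
          p₃ = X-P i k₁ k₃ p

      iter-closed : ∀ n {x} → P x → x ≈ iter f n x
      iter-closed zero    p = ≈-refl
      iter-closed (suc n) p = f-closed p ∙ iter-closed n (f-P p)

      X-down : ∀ i → P (X i k₁) → X i k₁ ≈ X i k₂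
      X-down i p = X-step i k₁ p ∙ ≈-sym (f-closed (X-P i k₁ k₂ p))

      P-cong : ∀ {c d w} → length c ≡ length d → slots c ≡ slots d → P (c , w) → P (d , w)
      P-cong l s (vert a b e) = vert (trans (sym l) a) (trans (sym s) b) e

      P-↭ : ∀ {c d w} → c ↭ d → P (c , w) → P (d , w)
      P-↭ q = P-cong (↭-length q) (slots-↭ q)

      -- The bits move to the end, if every bit can be exchanged with a preceding slot.
      module Sort (w : Word) (pre : Frame)
        (cross : ∀ c₁ b c₂ → P (pre ++ c₁ ++ just b ∷ nothing ∷ c₂ , w) → (pre ++ c₁ ++ just b ∷ nothing ∷ c₂ , w) ≈ (pre ++ c₁ ++ nothing ∷ just b ∷ c₂ , w)) where

        push : ∀ c₁ b n c₂ → P (pre ++ c₁ ++ just b ∷ S n ++ c₂ , w) → (pre ++ c₁ ++ just b ∷ S n ++ c₂ , w) ≈ (pre ++ c₁ ++ S n ++ just b ∷ c₂ , w)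
        push c₁ b zero    c₂ p = ≈-refl
        push c₁ b (suc n) c₂ p = cross c₁ b (S n ++ c₂) p ∙
          subst₂ (λ x y → (pre ++ x , w) ≈ (pre ++ y , w)) (++-assoc c₁ (nothing ∷ []) _) (++-assoc c₁ (nothing ∷ []) _)
            (push (c₁ ++ nothing ∷ []) b n c₂ (subst (λ x → P (pre ++ x , w)) (sym (++-assoc c₁ (nothing ∷ []) _)) (P-↭ (++⁺ˡ pre (++⁺ˡ c₁ (swap _ _ ↭-refl))) p)))

        sort : ∀ c₁ c → P (pre ++ c₁ ++ c , w) → (pre ++ c₁ ++ c , w) ≈ (pre ++ c₁ ++ S (slots c) ++ map just (bits c) , w)
        sort c₁ []            p = ≈-refl
        sort c₁ (nothing ∷ c) p = subst₂ (λ x y → (pre ++ x , w) ≈ (pre ++ y , w)) (++-assoc c₁ (nothing ∷ []) _) (++-assoc c₁ (nothing ∷ []) _)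
          (sort (c₁ ++ nothing ∷ []) c (subst (λ x → P (pre ++ x , w)) (sym (++-assoc c₁ (nothing ∷ []) _)) p))
        sort c₁ (just b ∷ c)  p = subst₂ (λ x y → (pre ++ x , w) ≈ (pre ++ y , w)) (++-assoc c₁ (just b ∷ []) _) (++-assoc c₁ (just b ∷ []) _)
          (sort (c₁ ++ just b ∷ []) c (subst (λ x → P (pre ++ x , w)) (sym (++-assoc c₁ (just b ∷ []) _)) p)) ∙
          push c₁ b (slots c) (map just (bits c)) (P-↭ (++⁺ˡ pre (++⁺ˡ c₁ (prep (just b) (sorted c)))) p)
          where
          sorted : ∀ c → c ↭ S (slots c) ++ map just (bits c)
          sorted []            = ↭-refl
          sorted (nothing ∷ c) = prep nothing (sorted c)
          sorted (just b ∷ c)  = ↭-trans (prep (just b) (sorted c)) (↭-sym (shift (just b) (S (slots c)) (map just (bits c))))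

      not-link : ∀ {c w} → ones w ≢ 0 → ¬ Safe other c w (h w) → ¬ Link (c , w)
      not-link ne ns (i , k , refl) = ns (subst (Safe other (fr i k) (wd i k)) (sym (h-wd i k)) (X-safe i k (λ e → ne (trans (wd-ones i k) e))))

      κ-equal : ∀ {c d w j} → ones w ≡ suc j → ¬ Link (c , w) → ¬ Link (d , w) → fill₁ c w (h w) ≡ fill₁ d w (h w) → κ (c , w) ≡ κ (d , w)
      κ-equal {c} {d} {w} {j} o n n′ e = trans (κ-no n) (trans (cong inj₂ (trans (cong (λ i → fillAt i (c , w)) o) (trans e (sym (cong (λ i → fillAt i (d , w)) o))))) (sym (κ-no n′)))

      ≈-κ : ∀ {x y} → P x → P y → κ x ≡ κ y → x ≈ y
      ≈-κ p q e = both (swp p q e) (swp q p (sym e))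

      -- At time t the bit is 1 and the slot free, so both vertices have the same filling. A free
      -- slot next to a 1 also shows that neither is linking, hence their keys agree; then `f` is
      -- followed back.
      cross-at : ∀ t {w j} → ones w ≡ suc j → ∀ c₁ b c₂ → iter not t b ≡ true →
        nth (slots c₁) (iter h t w) ≡ false → nth (slots c₁) (h (iter h t w)) ≡ false → P (c₁ ++ just b ∷ nothing ∷ c₂ , w) →
        (c₁ ++ just b ∷ nothing ∷ c₂ , w) ≈ (c₁ ++ nothing ∷ just b ∷ c₂ , w)
      cross-at t {w} {j} o c₁ b c₂ par z₁ z₂ p =
        iter-closed t p ∙ ≡⇒≈ ex ∙ ≈-κ (subst P ex (iter-P t p)) (subst P ey (iter-P t q)) (κ-equal ot nx ny (sym (fill₁-cross d₁ wt (h wt) y₁ y₂))) ∙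
        ≡⇒≈ (sym ey) ∙ ≈-sym (iter-closed t q)
        where
        q : P (c₁ ++ nothing ∷ just b ∷ c₂ , w)
        q = P-↭ (++⁺ˡ c₁ (swap _ _ ↭-refl)) p
        d₁ d₂ : Frame
        d₁ = iter flip t c₁
        d₂ = iter flip t c₂
        wt : Word
        wt = iter h t w
        ot : ones wt ≡ suc j
        ot = trans (proj₁ (proj₂ (iter-Bal t w (Vert.bal p)))) o
        y₁ : nth (slots d₁) wt ≡ false
        y₁ = trans (cong (λ i → nth i wt) (slots-iter t c₁)) z₁
        y₂ : nth (slots d₁) (h wt) ≡ false
        y₂ = trans (cong (λ i → nth i (h wt)) (slots-iter t c₁)) z₂
        ex : iter f t (c₁ ++ just b ∷ nothing ∷ c₂ , w) ≡ (d₁ ++ just true ∷ nothing ∷ d₂ , wt)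
        ex = iter-f-≡ t w (trans (iter-cross′ t c₁ b c₂) (cong (λ a → d₁ ++ just a ∷ nothing ∷ d₂) par))
        ey : iter f t (c₁ ++ nothing ∷ just b ∷ c₂ , w) ≡ (d₁ ++ nothing ∷ just true ∷ d₂ , wt)
        ey = iter-f-≡ t w (trans (iter-cross t c₁ b c₂) (cong (λ a → d₁ ++ nothing ∷ just a ∷ d₂) par))
        o≢ : ones wt ≢ 0
        o≢ e with trans (sym e) ot
        ... | ()
        nx : ¬ Link (d₁ ++ just true ∷ nothing ∷ d₂ , wt)
        nx = not-link o≢ (unsafe₂ other d₁ wt (h wt) y₁ y₂)
        ny : ¬ Link (d₁ ++ nothing ∷ just true ∷ d₂ , wt)
        ny = not-link o≢ (unsafe₁ other d₁ wt (h wt) y₁ y₂)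

      cross : ∀ {w j} → ones w ≡ suc j → ∀ c₁ b c₂ → P (c₁ ++ just b ∷ nothing ∷ c₂ , w) →
              (c₁ ++ just b ∷ nothing ∷ c₂ , w) ≈ (c₁ ++ nothing ∷ just b ∷ c₂ , w)
      cross {w} {j} o c₁ b c₂ p = at (Level⁺.both (lev j) (slots c₁) lt {w} W (Level⁺.free (lev j) (slots c₁) lt {w} W) b)
        where
        W : IsW (size s (suc j)) (suc j) w
        W = trans (Vert.bal p) (cong (size s) o) , o
        lt : slots c₁ < size s (suc j)
        lt = ℕₚ.≤-trans (ℕₚ.≤-trans (s≤s (ℕₚ.m≤m+n (slots c₁) (slots c₂))) (ℕₚ.≤-reflexive (trans (sym (ℕₚ.+-suc (slots c₁) (slots c₂))) (sym (slots-++ c₁ (just b ∷ nothing ∷ c₂))))))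
               (ℕₚ.≤-reflexive (trans (Vert.slt p) (proj₁ W)))
        at : (∃ λ t → iter not t b ≡ true × Level⁺.Free (lev j) (slots c₁) (iter (hAt (suc j)) t w)) → _
        at (t , par , z₁ , z₂) = cross-at t o c₁ b c₂ par (trans (cong (nth (slots c₁)) wt≡) z₁)
            (trans (cong (nth (slots c₁)) (trans (cong (λ i → hAt i (iter h t w)) (trans (proj₁ (proj₂ (iter-Bal t w (Vert.bal p)))) o)) (cong (hAt (suc j)) wt≡))) z₂) p
          where wt≡ : iter h t w ≡ iter (hAt (suc j)) t w
                wt≡ = iter-h t (suc j) {w} W

      to-end : ∀ {c w j} → ones w ≡ suc j → P (c , w) → (c , w) ≈ (S (slots c) ++ map just (bits c) , w)
      to-end {c} {w} o p = Sort.sort w [] (cross o) [] c p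

      spread : ∀ c → Frame
      spread c = S (slots c) ++ map just (bits c)

      spread-P : ∀ {c w} → P (c , w) → P (spread c , w)
      spread-P {c} = P-cong (sym (trans (length-++ (S (slots c))) (trans (cong₂ _+_ (length-replicate (slots c)) (length-map just (bits c))) (trans (ℕₚ.+-comm (slots c) _) (bits+slots c)))))
        (sym (trans (slots-S (slots c) (map just (bits c))) (trans (cong (slots c +_) (slots-just (bits c))) (ℕₚ.+-identityʳ _))))

      at-time : ∀ t {c w j} → ones w ≡ suc j → P (c , w) → ∃ λ α → P (S (slots c) ++ map just α , iter h t w) × (c , w) ≈ (S (slots c) ++ map just α , iter h t w)
      at-time t {c} {w} o p with iter-flip-S t (slots c) (bits c)
      ... | α , e = α , subst P e′ (iter-P t (spread-P p)) , to-end o p ∙ iter-closed t (spread-P p) ∙ ≡⇒≈ e′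
        where
        e′ : iter f t (spread c , w) ≡ (S (slots c) ++ map just α , iter h t w)
        e′ = iter-f-≡ t w e

      -- With all bits at the end and the slots at `ε` or `β` the vertex is the first one of a
      -- triple, whose second vertex lies one level below.
      descend : ∀ {c w j} → ones w ≡ suc j → P (c , w) → ∃ λ y → P y × ones (proj₂ y) ≡ j × (c , w) ≈ y
      descend {c} {w} {j} o p = go (Level⁺.reach (lev j) {w} W)
        where
        W : IsW (size s (suc j)) (suc j) w
        W = trans (Vert.bal p) (cong (size s) o) , o
        finish : ∀ t i v → iter h t w ≡ v → (∀ α → (S (slots c) ++ map just α , v) ≡ X (i α) k₁) → (∀ α → level (i α) k₂ ≡ j) →
                 ∃ λ y → P y × ones (proj₂ y) ≡ j × (c , w) ≈ y
        finish t i v refl e l = end (at-time t o p)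
          where
          end : (∃ λ α → P (S (slots c) ++ map just α , iter h t w) × (c , w) ≈ (S (slots c) ++ map just α , iter h t w)) → ∃ λ y → P y × ones (proj₂ y) ≡ j × (c , w) ≈ y
          end (α , q , r) = X (i α) k₂ , X-P (i α) k₁ k₂ pX , trans (wd-ones (i α) k₂) (l α) , (r ∙ ≡⇒≈ (e α) ∙ X-down (i α) pX)
            where
            pX : P (X (i α) k₁)
            pX = subst P (e α) q
        go : (∃ λ t → iter (hAt (suc j)) t w ≡ ε s (suc j) ⊎ (iter (hAt (suc j)) t w ≡ β × hAt (suc j) β ≡ β′)) → ∃ λ y → P y × ones (proj₂ y) ≡ j × (c , w) ≈ y
        go (t , inj₁ e) = finish t (A j) (ε s (suc j)) (trans (iter-h t (suc j) {w} W) e)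
          (λ α → cong (_, ε s (suc j)) (trans (cong (λ m → S m ++ map just α) (trans (Vert.slt p) (proj₁ W))) (sym (slots-0 s′ j (map just α))))) (λ _ → refl)
        go (t , inj₂ (e , _)) = finish t (B z) β wt≡ (λ α → cong (λ m → S m ++ map just α , β) (trans (Vert.slt p) len≡5)) (λ _ → sym j≡1)
          where
          wt≡ : iter h t w ≡ β
          wt≡ = trans (iter-h t (suc j) {w} W) e
          bt : Bal (iter h t w) × ones (iter h t w) ≡ ones w × length (iter h t w) ≡ length w
          bt = iter-Bal t w (Vert.bal p)
          len≡5 : length w ≡ 5
          len≡5 = trans (sym (proj₂ (proj₂ bt))) (cong length wt≡)
          j≡1 : j ≡ 1
          j≡1 = ℕₚ.suc-injective (trans (sym o) (trans (sym (proj₁ (proj₂ bt))) (cong ones wt≡)))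
          -- `β` has length 5 and two ones, and 2+2+s = 5 forces s = 1.
          z : s′ ≡ 0
          z = ℕₚ.suc-injective (ℕₚ.+-cancelˡ-≡ 4 s 1 (trans (sym (cong (λ i → suc i + suc i + s) j≡1)) (trans (sym (proj₁ W)) len≡5)))

      to-zero : ∀ j {x} → ones (proj₂ x) ≡ j → P x → ∃ λ c → P (c , E^ s) × x ≈ (c , E^ s)
      to-zero zero {c , w} o p@(vert l sl b) = c , subst (λ v → P (c , v)) w≡ p , ≡⇒≈ (cong (c ,_) w≡)
        where w≡ : w ≡ E^ s
              w≡ = trans (zero-E w o) (cong E^ (trans b (cong (size s) o)))
      to-zero (suc j) o p with descend o p
      ... | y , q , o′ , e with to-zero j o′ q
      ...   | c , q′ , e′ = c , q′ , e ∙ e′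

  -- Level 0, where every slot is always free.

  bits-flip : ∀ c → bits (flip c) ≡ map not (bits c)
  bits-flip []            = refl
  bits-flip (just b ∷ c)  = cong (not b ∷_) (bits-flip c)
  bits-flip (nothing ∷ c) = bits-flip c

  find-slot : ∀ c n → slots c ≡ suc n → ∃₂ λ c₁ c₂ → c ≡ c₁ ++ nothing ∷ c₂
  find-slot (nothing ∷ c) n e = [] , c , refl
  find-slot (just b ∷ c)  n e with find-slot c n e
  ... | c₁ , c₂ , refl = just b ∷ c₁ , c₂ , refl

  fillB-S : ∀ n c → fillB (S n ++ just false ∷ c) ≡ fillB (nothing ∷ S n ++ c)
  fillB-S zero    c = refl
  fillB-S (suc n) c = cong (bit false ∷_) (fillB-S n c)

  module Zero (s′ r : ℕ) (lev : ∀ j → Level⁺ (suc s′) (suc j)) (pet : s′ ≡ 0 → Level⁺.next (lev 1) β ≡ β′) where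

    open Johnson s′ r lev pet
    open Connected s′ r lev pet

    P₀ : Frame → Set
    P₀ c = P (c , E^ s)

    h-E : h (E^ s) ≡ E^ s
    h-E = cong (λ j → hAt j (E^ s)) (E-zero s)

    P₀-mk : ∀ c → length c ≡ r + s → slots c ≡ s → P₀ c
    P₀-mk c l e = vert l (trans e (sym (length-replicate s))) (trans (length-replicate s) (cong (size s) (sym (E-zero s))))

    P₀-slots : ∀ {c} → P₀ c → slots c ≡ s
    P₀-slots (vert _ e _) = trans e (length-replicate s)

    P₀-cong : ∀ c d → length c ≡ length d → slots c ≡ slots d → P₀ c → P₀ d
    P₀-cong c d l e (vert a b z) = vert (trans (sym l) a) (trans (sym e) b) z

    P₀-flip : ∀ c → P₀ c → P₀ (flip c)
    P₀-flip c = P₀-cong c (flip c) (sym (length-map _ c)) (sym (slots-flip c))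

    P₀-bits : ∀ c → P₀ c → length (bits c) ≡ r
    P₀-bits c p@(vert l _ _) = ℕₚ.+-cancelʳ-≡ s _ r (trans (cong (length (bits c) +_) (sym (P₀-slots p))) (trans (bits+slots c) l))

    P₀-swap : ∀ a b c₁ c₂ → P₀ (just a ∷ c₁ ++ nothing ∷ c₂) → P₀ (nothing ∷ c₁ ++ just b ∷ c₂)
    P₀-swap a b c₁ c₂ = P₀-cong _ _ (cong suc (trans (length-++ c₁) (sym (length-++ c₁))))
      (trans (slots-++ c₁ (nothing ∷ c₂)) (trans (ℕₚ.+-suc (slots c₁) (slots c₂)) (cong suc (sym (slots-++ c₁ (just b ∷ c₂))))))

    Z : Word → Frame
    Z v = nothing ∷ S s′ ++ map just v

    P₀-Z : ∀ v → length v ≡ r → P₀ (Z v)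
    P₀-Z v e = P₀-mk (Z v) (trans (length-++ (S s)) (trans (cong₂ _+_ (length-replicate s) (trans (length-map just v) e)) (ℕₚ.+-comm s r)))
      (trans (slots-S s (map just v)) (trans (cong (s +_) (slots-just v)) (ℕₚ.+-identityʳ s)))

    data Tail (t : Frame) : Set where
      t₂ : lead t ≡ s → stop t ≡ true → Tail t
      t₃ : lead t ≡ s′ → stop t ≡ false → more t ≡ false → Tail t

    link₀ : ∀ {c} → Link (c , E^ s) → ∃ λ t → c ≡ just false ∷ t × Tail t
    link₀ (i , k , e) = go i k (cong proj₁ e) (trans (sym (wd-ones i k)) (trans (cong (λ x → ones (proj₂ x)) (sym e)) (E-zero s)))
      where
      go : ∀ i k {c} → c ≡ fr i k → level i k ≡ 0 → ∃ λ t → c ≡ just false ∷ t × Tail t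
      go (A zero α) k₂ refl _ = _ , refl , t₂ (trans (lead-S s′ _) (ℕₚ.+-comm s′ 1)) (stop-S s′ _)
      go (A zero α) k₃ refl _ = _ , refl , t₃ (trans (lead-S s′ _) (ℕₚ.+-identityʳ s′)) (stop-S s′ _) (more-S s′ _)
      go (A j α) k₁ _ ()
      go (A (suc j) α) k₂ _ ()
      go (A (suc j) α) k₃ _ ()
      go (B _ α) k₁ _ ()
      go (B _ α) k₂ _ ()
      go (B _ α) k₃ _ ()

    not-link₀ : ∀ {t} → ¬ Tail t → ¬ Link (just false ∷ t , E^ s)
    not-link₀ nt l with link₀ l
    ... | _ , refl , tl = nt tl

    std : ℕ → Word
    std zero    = []
    std (suc n) = true ∷ replicate n false

    module _ (Q : Vtx → Set) (fwd : ∀ {x} → P x → Q x → Q (g x)) (bwd : ∀ {x} → P x → Q (g x) → Q x)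
             (swp : ∀ {x y} → P x → P y → κ x ≡ κ y → Q x → Q y) where

      open Closed Q fwd bwd swp

      infix 4 _≋_
      _≋_ : Frame → Frame → Set
      c ≋ d = (c , E^ s) ≈ (d , E^ s)

      ≡⇒≋ : ∀ {c d} → c ≡ d → c ≋ d
      ≡⇒≋ refl = ≈-refl

      flip≋ : ∀ c → P₀ c → c ≋ flip c
      flip≋ c p = f-closed p ∙ ≡⇒≈ (cong (flip c ,_) h-E)

      κ₀ : ∀ {c d} → P₀ c → P₀ d → ¬ Link (c , E^ s) → ¬ Link (d , E^ s) → fillA c ≡ fillA d → c ≋ d
      κ₀ {c} {d} p q n n′ e = ≈-κ p q (trans (κ-no n) (trans (cong inj₂ (trans (cong (λ j → fillAt j (c , E^ s)) (E-zero s))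
        (trans e (sym (cong (λ j → fillAt j (d , E^ s)) (E-zero s)))))) (sym (κ-no n′))))

      not-zero : ∀ {c} → (∀ t → c ≢ just false ∷ t) → ¬ Link (c , E^ s)
      not-zero ne l with link₀ l
      ... | t , e , _ = ne t e

      -- Both sides fill to 1, c₁, 0, c₂: a slot in front counts as 1, and any later one as 0.
      star-first : ∀ c₁ c₂ → P₀ (just true ∷ c₁ ++ nothing ∷ c₂) → just true ∷ c₁ ++ nothing ∷ c₂ ≋ nothing ∷ c₁ ++ just false ∷ c₂
      star-first c₁ c₂ p = κ₀ p (P₀-swap true false c₁ c₂ p) (not-zero λ _ ()) (not-zero λ _ ()) (cong (bit true ∷_) (fillB-star c₁ c₂))

      -- Behind a leading slot the free slots count as 0, so only a bit 0 can be exchanged directly;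
      -- a bit 1 is complemented by `f` before and after.
      cross₀ : ∀ c₁ b c₂ → P₀ (nothing ∷ c₁ ++ just b ∷ nothing ∷ c₂) → nothing ∷ c₁ ++ just b ∷ nothing ∷ c₂ ≋ nothing ∷ c₁ ++ nothing ∷ just b ∷ c₂
      cross₀ c₁ false c₂ p = κ₀ p (P-↭ (prep nothing (++⁺ˡ c₁ (swap _ _ ↭-refl))) p) (not-zero λ _ ()) (not-zero λ _ ()) (cong (bit true ∷_) (sym (fillB-cross c₁ c₂)))
      cross₀ c₁ true c₂ p = flip≋ _ p ∙ ≡⇒≋ (cong (nothing ∷_) (map-++ (Maybe.map not) c₁ _)) ∙
        cross₀ (flip c₁) false (flip c₂) (subst P₀ (cong (nothing ∷_) (map-++ (Maybe.map not) c₁ _)) (P₀-flip _ p)) ∙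
        ≡⇒≋ (sym (cong (nothing ∷_) (map-++ (Maybe.map not) c₁ _))) ∙ ≈-sym (flip≋ _ (P-↭ (prep nothing (++⁺ˡ c₁ (swap _ _ ↭-refl))) p))

      normal-E : ∀ c → P₀ (nothing ∷ c) → nothing ∷ c ≋ Z (bits c)
      normal-E c p = Sort.sort (E^ s) (nothing ∷ []) cross₀ [] c p ∙ ≡⇒≋ (cong (λ n → nothing ∷ S n ++ map just (bits c)) (ℕₚ.suc-injective (P₀-slots p)))

      normal-1 : ∀ c₁ c₂ → P₀ (just true ∷ c₁ ++ nothing ∷ c₂) → just true ∷ c₁ ++ nothing ∷ c₂ ≋ Z (bits c₁ ++ false ∷ bits c₂)
      normal-1 c₁ c₂ p = star-first c₁ c₂ p ∙ normal-E _ (P₀-swap true false c₁ c₂ p) ∙ ≡⇒≋ (cong Z (bits-++ c₁ (just false ∷ c₂)))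

      Z-flip : ∀ v → length v ≡ r → Z v ≋ Z (map not v)
      Z-flip v e = flip≋ (Z v) (P₀-Z v e) ∙ ≡⇒≋ (cong (nothing ∷_) (trans (flip-S s′ (map just v)) (cong (S s′ ++_) (flip-just v))))

      normal-0 : ∀ c₁ c₂ → P₀ (just false ∷ c₁ ++ nothing ∷ c₂) → just false ∷ c₁ ++ nothing ∷ c₂ ≋ Z (bits c₁ ++ true ∷ bits c₂)
      normal-0 c₁ c₂ p = flip≋ _ p ∙ ≡⇒≋ eq ∙ normal-1 (flip c₁) (flip c₂) (subst P₀ eq (P₀-flip _ p)) ∙ ≡⇒≋ (cong Z eq′) ∙ ≈-sym (Z-flip _ len)
        where
        eq : just true ∷ flip (c₁ ++ nothing ∷ c₂) ≡ just true ∷ flip c₁ ++ nothing ∷ flip c₂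
        eq = cong (just true ∷_) (map-++ (Maybe.map not) c₁ _)
        eq′ : bits (flip c₁) ++ false ∷ bits (flip c₂) ≡ map not (bits c₁ ++ true ∷ bits c₂)
        eq′ = trans (cong₂ (λ a b → a ++ false ∷ b) (bits-flip c₁) (bits-flip c₂)) (sym (map-++ not (bits c₁) (true ∷ bits c₂)))
        len : length (bits c₁ ++ true ∷ bits c₂) ≡ r
        len = trans (cong length (sym (bits-++ c₁ (just true ∷ c₂)))) (P₀-bits _ (P₀-swap false true c₁ c₂ p))

      -- With s-1 further slots after each leading one, 0 * ... 0 v and 0 1 * ... v both fill to 0 1
      -- 0 ... 0 v, but moving their bits to the end by `normal-0` leads to different strings.
      toggle₁ : ∀ v → suc (suc (length v)) ≡ r → Z (true ∷ false ∷ v) ≋ Z (true ∷ true ∷ v)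
      toggle₁ v e = ≡⇒≋ (cong (λ u → Z (true ∷ u)) (sym (trans (bits-S s′ _) (cong (false ∷_) (bits-just v))))) ∙
        ≈-sym (normal-0 [] (S s′ ++ just false ∷ map just v) px) ∙
        κ₀ px py nx ny (cong (λ k → bit false ∷ bit true ∷ k) (fillB-S s′ (map just v))) ∙
        normal-0 (just true ∷ []) (S s′ ++ map just v) py ∙ ≡⇒≋ (cong (λ u → Z (true ∷ true ∷ u)) (trans (bits-S s′ _) (bits-just v)))
        where
        x y : Frame
        x = just false ∷ nothing ∷ S s′ ++ just false ∷ map just v
        y = just false ∷ just true ∷ nothing ∷ S s′ ++ map just v
        py : P₀ y
        py = P₀-cong (Z (true ∷ true ∷ v)) y
          (trans (cong suc (length-++ (S s′))) (trans (solve 2 (λ a b → con 1 :+ (a :+ (con 2 :+ b)) := con 3 :+ (a :+ b)) refl (length (S s′)) (length (map just v))) (cong (3 +_) (sym (length-++ (S s′))))))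
          (cong suc (trans (slots-S s′ _) (sym (slots-S s′ (map just v))))) (P₀-Z (true ∷ true ∷ v) e)
          where open +-*-Solver
        px : P₀ x
        px = P₀-cong y x (cong (λ n → suc (suc n)) (trans (cong suc (length-++ (S s′))) (trans (sym (ℕₚ.+-suc _ _)) (sym (length-++ (S s′))))))
          (cong suc (trans (slots-S s′ (map just v)) (sym (slots-S s′ _)))) py
        nx : ¬ Link (x , E^ s)
        nx = not-link₀ λ { (t₂ _ q) → bad₁ (trans (sym q) (stop-S s′ _)) ; (t₃ q _ _) → bad₂ (trans (sym q) (cong suc (trans (lead-S s′ _) (ℕₚ.+-identityʳ s′)))) }
          where
          bad₁ : true ≡ false → ⊥
          bad₁ ()
          bad₂ : s′ ≡ suc s′ → ⊥
          bad₂ q = ℕₚ.<-irrefl q (ℕₚ.n<1+n s′)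
        ny : ¬ Link (y , E^ s)
        ny = not-link₀ λ { (t₂ () _) ; (t₃ _ () _) }

      -- The same device with 0 * 0 v₁ 0 v₂ and 0 1 0 v₁ * v₂, each followed by s-1 slots; both fill
      -- to 0 1 0 v₁ 0 v₂ followed by zeros.
      toggle₂ : ∀ v₁ v₂ → suc (suc (length (v₁ ++ false ∷ v₂))) ≡ r → Z (true ∷ false ∷ v₁ ++ false ∷ v₂) ≋ Z (true ∷ false ∷ v₁ ++ true ∷ v₂)
      toggle₂ v₁ v₂ e = ≡⇒≋ (cong (λ u → Z (true ∷ false ∷ u)) (sym (trans (bits-++ (map just v₁) _) (cong₂ (λ a b → a ++ false ∷ b) (bits-just v₁) end)))) ∙
        ≈-sym (normal-0 [] (just false ∷ map just v₁ ++ just false ∷ c₂) px) ∙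
        κ₀ px py nx ny (cong (λ k → bit false ∷ bit true ∷ bit false ∷ k) (sym (fillB-star (map just v₁) c₂))) ∙
        normal-0 (just true ∷ just false ∷ map just v₁) c₂ py ∙
        ≡⇒≋ (cong (λ u → Z (true ∷ false ∷ u)) (cong₂ (λ a b → a ++ true ∷ b) (bits-just v₁) end))
        where
        c₂ x y : Frame
        c₂ = map just v₂ ++ S s′
        x = just false ∷ nothing ∷ just false ∷ map just v₁ ++ just false ∷ c₂
        y = just false ∷ just true ∷ just false ∷ map just v₁ ++ nothing ∷ c₂
        bits-rep : ∀ n → bits (S n) ≡ []
        bits-rep zero    = refl
        bits-rep (suc n) = bits-rep n
        slots-rep : ∀ n → slots (S n) ≡ n
        slots-rep zero    = refl
        slots-rep (suc n) = cong suc (slots-rep n)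
        end : bits c₂ ≡ v₂
        end = trans (bits-++ (map just v₂) (S s′)) (trans (cong₂ _++_ (bits-just v₂) (bits-rep s′)) (++-identityʳ v₂))
        slots-c₂ : slots c₂ ≡ s′
        slots-c₂ = trans (slots-++ (map just v₂) (S s′)) (cong₂ _+_ (slots-just v₂) (slots-rep s′))
        slots-x : slots x ≡ s
        slots-x = cong suc (trans (slots-++ (map just v₁) _) (cong₂ _+_ (slots-just v₁) slots-c₂))
        px : P₀ x
        px = P₀-mk x (trans (sym (bits+slots x)) (cong₂ _+_ bx slots-x)) slots-x
          where
          bx : length (bits x) ≡ r
          bx = trans (cong (λ u → suc (suc (length u))) (trans (bits-++ (map just v₁) _) (cong₂ (λ a b → a ++ false ∷ b) (bits-just v₁) end))) e
        py : P₀ y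
        py = P₀-cong x y (cong (3 +_) (trans (length-++ (map just v₁)) (sym (length-++ (map just v₁)))))
          (trans (cong suc (slots-++ (map just v₁) (just false ∷ c₂))) (trans (sym (ℕₚ.+-suc _ (slots c₂))) (sym (slots-++ (map just v₁) (nothing ∷ c₂))))) px
        nx : ¬ Link (x , E^ s)
        -- For s = 2 the number of leading slots and the bit after them agree with a linking frame
        -- of kind `k₃`; what differs is that this bit is followed by another bit instead of a slot.
        nx = not-link₀ λ { (t₂ _ ()) ; (t₃ _ _ q) → bad v₁ q }
          where
          bad : ∀ v₁ → more (nothing ∷ just false ∷ map just v₁ ++ just false ∷ c₂) ≡ false → ⊥
          bad []      ()
          bad (_ ∷ _) ()
        ny : ¬ Link (y , E^ s)
        ny = not-link₀ λ { (t₂ () _) ; (t₃ _ () _) }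

      clear : ∀ v₁ v₂ → suc (suc (length (v₁ ++ v₂))) ≡ r → Z (true ∷ false ∷ v₁ ++ v₂) ≋ Z (true ∷ false ∷ v₁ ++ replicate (length v₂) false)
      clear v₁ []      e = ≈-refl
      clear v₁ (b ∷ v₂) e = first b e ∙ subst₂ (λ u w → Z (true ∷ false ∷ u) ≋ Z (true ∷ false ∷ w)) (++-assoc v₁ (false ∷ []) v₂) (++-assoc v₁ (false ∷ []) _)
          (clear (v₁ ++ false ∷ []) v₂ (trans (cong (λ u → suc (suc (length u))) (++-assoc v₁ (false ∷ []) v₂)) (trans (cong (λ n → suc (suc n)) (trans (length-++ v₁) (sym (length-++ v₁)))) e)))
        where
        first : ∀ b → suc (suc (length (v₁ ++ b ∷ v₂))) ≡ r → Z (true ∷ false ∷ v₁ ++ b ∷ v₂) ≋ Z (true ∷ false ∷ v₁ ++ false ∷ v₂)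
        first false e = ≈-refl
        first true  e = ≈-sym (toggle₂ v₁ v₂ (trans (cong (λ n → suc (suc n)) (trans (length-++ v₁) (sym (length-++ v₁)))) e))

      -- Complementing the string if necessary makes its first bit 1, `toggle₁` makes the second one
      -- 0, and behind 1 0 every bit can be cleared.
      to-std : ∀ v → length v ≡ r → Z v ≋ Z (std r)
      to-std v e = subst (λ n → Z v ≋ Z (std n)) e (go v e)
        where
        one-first : ∀ v → suc (length v) ≡ r → Z (true ∷ v) ≋ Z (std (suc (length v)))
        one-first []          e = ≈-refl
        one-first (false ∷ v) e = clear [] v e
        one-first (true ∷ v)  e = ≈-sym (toggle₁ v e) ∙ clear [] v e
        go : ∀ v → length v ≡ r → Z v ≋ Z (std (length v))
        go []          e = ≈-refl
        go (true ∷ v)  e = one-first v e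
        go (false ∷ v) e = Z-flip (false ∷ v) e ∙ subst (λ n → Z (true ∷ map not v) ≋ Z (std (suc n))) (length-map not v) (one-first (map not v) (trans (cong suc (length-map not v)) e))

      to-Z : ∀ c → P₀ c → c ≋ Z (std r)
      to-Z []               p with P₀-slots p
      ... | ()
      to-Z (nothing ∷ c)    p = normal-E c p ∙ to-std _ (P₀-bits _ p)
      to-Z (just b ∷ c)     p with find-slot c s′ (P₀-slots p)
      ... | c₁ , c₂ , refl = go b p ∙ to-std _ (len b p)
        where
        len : ∀ b → P₀ (just b ∷ c₁ ++ nothing ∷ c₂) → length (bits c₁ ++ not b ∷ bits c₂) ≡ r
        len b p = trans (cong length (sym (bits-++ c₁ (just (not b) ∷ c₂)))) (P₀-bits _ (P₀-swap b (not b) c₁ c₂ p))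
        go : ∀ b → P₀ (just b ∷ c₁ ++ nothing ∷ c₂) → just b ∷ c₁ ++ nothing ∷ c₂ ≋ Z (bits c₁ ++ not b ∷ bits c₂)
        go true  p = normal-1 c₁ c₂ p
        go false p = normal-0 c₁ c₂ p

      connected : ∀ {x y} → P x → P y → Q x → Q y
      connected {x} {y} p q with to-zero (ones (proj₂ x)) refl p | to-zero (ones (proj₂ y)) refl q
      ... | c , pc , ec | d , pd , ed = _≈_.to (ec ∙ to-Z c pc ∙ ≈-sym (to-Z d pd) ∙ ≈-sym ed)

  johnson : ∀ s′ r → (lev : ∀ j → Level⁺ (suc s′) (suc j)) → (s′ ≡ 0 → Level⁺.next (lev 1) β ≡ β′) →
            HamK ((r + suc s′) + (r + suc s′)) r
  johnson s′ r lev pet = mapHam (λ x → enc (proj₁ x) (proj₂ x)) enc-W inj sur (λ _ _ d → d)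
    (mergeHam _≟ᵛ_ (Sumₚ.≡-dec _≟ᵛ_ (≡-dec _≟ᵏ_)) P _~_ vs unique snd fll g g⁻
      (λ p → f-P (τ-P p)) (λ p → τ⁻-P (f⁻-P p))
      (λ {x} p → trans (cong τ⁻ (f⁻f (τ-P p))) (τ⁻τ x)) (λ {x} p → trans (cong f (ττ⁻ (f⁻ x))) (ff⁻ p))
      κ κ-adj (λ Q a b c → connected Q a b c) (_ , P₀-Z (std r) (std-len r)))
    where
    open Johnson s′ r lev pet
    open Zero s′ r lev pet
    n = (r + suc s′) + (r + suc s′)
    std-len : ∀ r → length (std r) ≡ r
    std-len zero    = refl
    std-len (suc r) = cong suc (length-replicate r)
    inj : ∀ {x y} → P x → P y → enc (proj₁ x) (proj₂ x) ≡ enc (proj₁ y) (proj₂ y) → x ≡ y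
    inj {c , w} {d , v} (vert _ p _) (vert _ q _) e = trans (sym (dec-enc c w p)) (trans (cong dec e) (dec-enc d v q))
    sur : ∀ {u} → IsW n r u → ∃ λ x → P x × enc (proj₁ x) (proj₂ x) ≡ u
    sur {u} p = dec u , dec-V {r} {suc s′} {u} p
    vs : List Vtx
    vs = map dec (words n r)
    unique : Unique vs
    unique = go (words n r) (λ m → m) (words-unique n r)
      where
      go : ∀ us → (∀ {u} → u ∈ us → u ∈ words n r) → Unique us → Unique (map dec us)
      go []       f []      = []
      go (u ∷ us) f (a ∷ b) = All.tabulate (λ m → ne (∈-map⁻ dec m)) ∷ go us (λ m → f (there m)) b
        where
        ne : ∀ {y} → (∃ λ v → v ∈ us × y ≡ dec v) → dec u ≢ y
        ne (v , m , refl) e = All.lookup a m (trans (sym (proj₂ (dec-V {r} {suc s′} {u} (∈-words⁻ n r (f (here refl))))))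
          (trans (cong (λ x → enc (proj₁ x) (proj₂ x)) e) (proj₂ (dec-V {r} {suc s′} {v} (∈-words⁻ n r (f (there m)))))))
    snd : ∀ {x} → x ∈ vs → P x
    snd m with ∈-map⁻ dec m
    ... | u , k , refl = proj₁ (dec-V {r} {suc s′} {u} (∈-words⁻ n r k))
    fll : ∀ {x} → P x → x ∈ vs
    fll {c , w} p@(vert _ q _) = subst (_∈ vs) (dec-enc c w q) (∈-map⁺ dec (∈-words⁺ n r {enc c w} (enc-W p)))

open Doubling using (johnson; Level⁺; mkLevel; petersen⁺; size; β; β′)

-- The levels for s = 1, repeated doubling, and the theorem.

triangle : HamK 3 1
triangle = record
  { verts = x ∷ y ∷ z ∷ []
  ; cyc = x , z , (refl ∷ refl ∷ refl ∷ []) ∷ (refl ∷ refl ∷ refl ∷ []) ∷ (∎ z) , refl ∷ refl ∷ refl ∷ []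
  ; uniq = ((λ ()) ∷ (λ ()) ∷ []) ∷ ((λ ()) ∷ []) ∷ [] ∷ []
  ; sound = λ { (here refl) → refl , refl ; (there (here refl)) → refl , refl ; (there (there (here refl))) → refl , refl }
  ; full = λ { {true ∷ false ∷ false ∷ []} _ → here refl ; {false ∷ true ∷ false ∷ []} _ → there (here refl) ; {false ∷ false ∷ true ∷ []} _ → there (there (here refl))
             ; {[]} (() , _) ; {_ ∷ []} (() , _) ; {_ ∷ _ ∷ []} (() , _) ; {_ ∷ _ ∷ _ ∷ _ ∷ _} (() , _)
             ; {false ∷ false ∷ false ∷ []} (_ , ()) ; {true ∷ true ∷ false ∷ []} (_ , ()) ; {true ∷ false ∷ true ∷ []} (_ , ())
             ; {false ∷ true ∷ true ∷ []} (_ , ()) ; {true ∷ true ∷ true ∷ []} (_ , ()) } }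
  where
  x y z : Word
  x = true ∷ false ∷ false ∷ []
  y = false ∷ true ∷ false ∷ []
  z = false ∷ false ∷ true ∷ []

record Family (s′ : ℕ) : Set where
  field
    lev : ∀ j → Level⁺ (suc s′) (suc j)
    pet : s′ ≡ 0 → Level⁺.next (lev 1) β ≡ β′

family₀ : Family 0
family₀ = record { lev = lev ; pet = λ _ → refl }
  where
  lev : ∀ j → Level⁺ 1 (suc j)
  lev 0             = mkLevel 0 0 triangle
  lev 1             = petersen⁺
  lev (suc (suc j)) = mkLevel 0 (2 + j) (subst (λ n → HamK n (3 + j)) (ℕₚ.+-comm 1 ((3 + j) + (3 + j))) (odd-graph j))

kneser : ∀ {s′} → Family s′ → ∀ k → HamK ((k + suc s′) + (k + suc s′)) k
kneser {s′} F k = johnson s′ k (Family.lev F) (Family.pet F)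

-- The graphs K(2j+2s,j) obtained for s are the ones that form the levels for 2s. As 2s is at least
-- 2, the condition on `β` is vacuous.
double : ∀ {s′} → Family s′ → Family (s′ + suc s′)
double {s′} F = record { lev = λ j → mkLevel (s′ + suc s′) j (subst (λ n → HamK n (suc j)) (eq (suc j) (suc s′)) (kneser F (suc j)))
                       ; pet = λ e → absurd (ℕₚ.m+n≡0⇒n≡0 s′ e) }
  where
  eq : ∀ j s → (j + s) + (j + s) ≡ size (s + s) j
  eq = solve 2 (λ j s → (j :+ s) :+ (j :+ s) := j :+ j :+ (s :+ s)) refl
    where open +-*-Solver
  absurd : ∀ {A : Set} {n} → suc n ≡ 0 → A
  absurd ()

pred2^ : ℕ → ℕ
pred2^ zero    = 0
pred2^ (suc a) = pred2^ a + suc (pred2^ a)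

suc-pred2^ : ∀ a → suc (pred2^ a) ≡ 2 ^ a
suc-pred2^ zero    = refl
suc-pred2^ (suc a) = trans (cong₂ _+_ (suc-pred2^ a) (suc-pred2^ a)) (cong (2 ^ a +_) (sym (ℕₚ.+-identityʳ (2 ^ a))))

family : ∀ a → Family (pred2^ a)
family zero    = family₀
family (suc a) = double (family a)

-- The family of index a has s = 2^a, and `kneser` doubles this once more: exponent a+1 comes from
-- `family a`, exponent 0 from `odd-graph`.
hamK : ∀ k a → k ≥ 3 → HamK (2 * k + 2 ^ a) k
hamK (suc (suc (suc n))) zero (s≤s (s≤s (s≤s z≤n))) =
  subst (λ m → HamK m (3 + n)) (solve 1 (λ n → con 1 :+ ((con 3 :+ n) :+ (con 3 :+ n)) := con 2 :* (con 3 :+ n) :+ con 1) refl n) (odd-graph n)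
  where open +-*-Solver
hamK (suc zero) zero (s≤s ())
hamK (suc (suc zero)) zero (s≤s (s≤s ()))
hamK k (suc a) _ = subst (λ m → HamK m k) eq (kneser (family a) k)
  where
  open +-*-Solver
  eq : (k + suc (pred2^ a)) + (k + suc (pred2^ a)) ≡ 2 * k + 2 * 2 ^ a
  eq = trans (cong (λ s → (k + s) + (k + s)) (suc-pred2^ a)) (solve 2 (λ k s → (k :+ s) :+ (k :+ s) := con 2 :* k :+ con 2 :* s) refl k (2 ^ a))

-- A block of ones at a variable offset; the offsets 0, 1 and 2 give the three distinct vertices
-- that `hamiltonCycle` asks for.
word : ℕ → ℕ → ℕ → Word
word a k b = replicate a false ++ replicate k true ++ replicate b false

word-W : ∀ a k b → IsW (a + (k + b)) k (word a k b)
word-W a k b = trans (length-++ (replicate a false)) (cong₂ _+_ (length-replicate a) (trans (length-++ (replicate k true)) (cong₂ _+_ (length-replicate k) (length-replicate b)))) ,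
  trans (ones-++ (replicate a false) _) (trans (cong₂ _+_ (zeros a) (trans (ones-++ (replicate k true) _) (cong₂ _+_ (all k) (zeros b)))) (ℕₚ.+-identityʳ k))
  where
  zeros : ∀ n → ones (replicate n false) ≡ 0
  zeros zero    = refl
  zeros (suc n) = zeros n
  all : ∀ n → ones (replicate n true) ≡ n
  all zero    = refl
  all (suc n) = cong suc (all n)

theorem2 : ∀ (k a : ℕ) → k ≥ 3 → HamiltonCycle (Kneser (2 * k + 2 ^ a) k)
theorem2 k@(suc k′@(suc (suc n))) a l@(s≤s (s≤s (s≤s z≤n))) =
  hamiltonCycle _ k {word 0 k (3 + n + 2 ^ a)} {word 1 k (2 + n + 2 ^ a)} {word 2 k (1 + n + 2 ^ a)} (W 0 (3 + n + 2 ^ a) e₀) (W 1 (2 + n + 2 ^ a) e₁) (W 2 (1 + n + 2 ^ a) e₂) (λ ()) (λ ()) (λ ()) (hamK k a l)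
  where
  open +-*-Solver
  W : ∀ m b → m + (k + b) ≡ 2 * k + 2 ^ a → IsW (2 * k + 2 ^ a) k (word m k b)
  W m b e = subst (λ n → IsW n k (word m k b)) e (word-W m k b)
  e₀ : 0 + (k + (3 + n + 2 ^ a)) ≡ 2 * k + 2 ^ a
  e₀ = solve 2 (λ n p → (con 3 :+ n) :+ (con 3 :+ n :+ p) := con 2 :* (con 3 :+ n) :+ p) refl n (2 ^ a)
  e₁ : 1 + (k + (2 + n + 2 ^ a)) ≡ 2 * k + 2 ^ a
  e₁ = solve 2 (λ n p → con 1 :+ ((con 3 :+ n) :+ (con 2 :+ n :+ p)) := con 2 :* (con 3 :+ n) :+ p) refl n (2 ^ a)
  e₂ : 2 + (k + (1 + n + 2 ^ a)) ≡ 2 * k + 2 ^ a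
  e₂ = solve 2 (λ n p → con 2 :+ ((con 3 :+ n) :+ (con 1 :+ n :+ p)) := con 2 :* (con 3 :+ n) :+ p) refl n (2 ^ a)
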